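{- Let $(\mathcal N,\mathcal O)$ be an oriented plabic network representing $[A]$, with boundary sources indexed by $I=\{i_1<\dots<i_k\}$, and consider two gauge ray directions $\mathfrak l$ and $\mathfrak l'$. (1) For any boundary source edge $e_{i_r}$ (the edge at $b_{i_r}$) the edge vector $E_{e_{i_r}}$ does not depend on the gauge direction $\mathfrak l$, and it coincides with the $r$-th row $A[r]$ of the generalized reduced row echelon form of $[A]$ associated to the pivot set $I$, minus the $i_r$-th vector $E_{i_r}$ of the canonical basis: $E_{e_{i_r}}=A[r]-E_{i_r}$. (2) For any other edge $e$, $$E'_e=(-1)^{\mathrm{cr}(V_e)+\mathrm{par}(e)}E_e,$$ where $E_e$ and $E'_e$ are the edge vectors of $e$ for the gauge directions $\mathfrak l$ and $\mathfrak l'$ respectively, $\mathrm{par}(e)$ is $1$ if $e$ (as a direction) belongs to the angle $\widehat{\mathfrak l,\mathfrak l'}$ and $0$ otherwise, and $\mathrm{cr}(V_e)$ denotes the number of gauge rays passing the initial vertex $V_e$ of $e$ during the rotation from $\mathfrak l$ to $\mathfrak l'$ inside the disk.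
   Context: Fix positive integers $k<n$. A plabic graph $\mathcal G$ of type $(k,n)$ is a finite directed graph drawn planarly in a disk, with no component isolated from the boundary, such that: it has $n$ boundary vertices $b_1,\dots,b_n$ labelled clockwise, all on a common straight interval of the boundary of the disk, each of degree 1 (a boundary source if its edge is outgoing, a boundary sink if incoming; exactly $k$ are sources); all other (internal) vertices are strictly inside the disk and are bivalent or trivalent; each internal vertex either has exactly one incoming edge (white) or exactly one outgoing edge (black), bivalent vertices being assigned either colour. Edges are straight segments, regarded as vectors directed by the orientation $\mathcal O$. A plabic network $\mathcal N$ is a plabic graph with a positive weight $w_e$ on each edge; $\bar I=[n]\setminus I$. $\mathcal N$ represents $[A]$ if $[A]$ is the class of the matrix with identity submatrix in the columns $I$ (this representative is the generalized reduced row echelon form with pivot set $I$) and entries $A^r_j=(-1)^{\sigma(i_r,j)}\sum_{P:b_{i_r}\to b_j}(-1)^{\mathrm{wind}_{top}(P)}w(P)$ for $j\in\bar I$, where $\sigma(i_r,j)$ is the number of elements of $I$ strictly between $i_r$ and $j$, the sum is over directed walks (it sums to a rational function of the weights), and $\mathrm{wind}_{top}$ is the topological winding index ($(-1)^{\mathrm{wind}_{top}(P)}=(-1)^{\text{number of loops removed in the loop erasure of }P}$). A gauge ray direction $\mathfrak l$ is an oriented direction such that the ray in direction $\mathfrak l$ from any boundary vertex points inside the disk, no internal edge is parallel to $\mathfrak l$, and the rays starting at boundary vertices contain no internal vertices. The gauge rays are the rays $\mathfrak l_{i_r}$ in direction $\mathfrak l$ starting at the boundary sources $b_{i_r}$.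 The rotation from $\mathfrak l$ to $\mathfrak l'$ is the monotone rotation through directions pointing inside the disk at the boundary vertices, and $\widehat{\mathfrak l,\mathfrak l'}$ is the angle swept. For plane vectors $s(u,v)=+1,0,-1$ if $(u,v)$ is positively (counterclockwise) oriented, parallel, negatively oriented. For consecutive edges, $\mathrm{wind}(e,f)=\pm1$ if $s(e,f)=s(e,\mathfrak l)=s(\mathfrak l,f)=\pm1$, and $0$ otherwise. $\mathrm{int}(e)$ is the number of intersections of $e$ with the gauge rays (the common starting point of $\mathfrak l_{i_r}$ and the edge at $b_{i_r}$ is not counted). For a directed path $\mathcal P=(e_1,\dots,e_m)$ (edges may repeat): $w(\mathcal P)=\prod w_{e_l}$ with multiplicity, $\mathrm{wind}(\mathcal P)=\sum_{l=1}^{m-1}\mathrm{wind}(e_l,e_{l+1})$, $\mathrm{int}(\mathcal P)=\sum_{l=1}^m\mathrm{int}(e_l)$. The edge vector $E_e\in\mathbb R^n$ has components $(E_e)_j=\sum_{\mathcal P:e\to b_j}(-1)^{\mathrm{wind}(\mathcal P)+\mathrm{int}(\mathcal P)}w(\mathcal P)$, the sum over all directed paths with first edge $e$ ending at $b_j$ (zero if there is none), understood as the rational function of the weights to which this series sums (its denominator is positive for positive weights). -}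

module Defs where

open import Level using (Level; _⊔_; suc)
open import Algebra.Bundles using (CommutativeRing)
import Algebra.Properties.Semiring.Exp as Exp
import Algebra.Properties.Semiring.Sum as Sum
import Algebra.Properties.CommutativeMonoid.Sum as MonoidSum
import Algebra.Properties.Ring as RingProperties
import Algebra.Properties.AbelianGroup as AbelianGroupProperties
import Algebra.Solver.Ring.NaturalCoefficients.Default as SemiringSolver
open import Data.Bool using (if_then_else_)
open import Data.Fin as Fin using (Fin)
import Data.Fin.Properties as Fin
open import Data.Integer as ℤ using (ℤ; 0ℤ; 1ℤ; -1ℤ; ∣_∣)
import Data.Integer.Properties as ℤ
open import Data.List as List using (List; []; _∷_; length; filter; map; concatMap; allFin; dropWhile)
open import Data.List.Properties using (length-filter)
import Data.List.Membership.DecPropositional as Membership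
open import Data.List.Relation.Unary.Linked using (Linked; linked?)
open import Data.Maybe as Maybe using (just)
import Data.Maybe.Properties as Maybe
open import Data.Nat as ℕ using (ℕ)
import Data.Nat.Properties as ℕ
import Data.Nat.ListAction as ListAction
open import Data.Product using (_×_; _,_; ∃; ∃-syntax; ∃₂; proj₁; proj₂)
open import Data.Sum using (_⊎_; inj₁; inj₂; [_,_]′)
import Data.Sum.Properties as ⊎
open import Data.Vec as Vec using (Vec)
import Data.Vec.Properties as Vec
open import Data.Vec.Relation.Binary.Pointwise.Inductive as Pointwise using (Pointwise)
open import Function using (_⇔_)
open import Relation.Binary using (Rel; IsStrictTotalOrder; DecidableEquality; tri<; tri≈; tri>)
open import Relation.Binary.Construct.Closure.Equivalence using (EqClosure)
open import Relation.Binary.PropositionalEquality using (_≡_; _≢_; refl; cong; cong₂) renaming (sym to ≡-sym)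
open import Relation.Nullary using (¬_; Dec; yes; no; does; contradiction)
open import Relation.Nullary.Decidable using (¬?; _×-dec_; _⊎-dec_; map′)
open import Relation.Unary using (Pred; Decidable)

-- Stands in for ℝ, whose ordered field structure is all that is used: coordinates and weights lie in
-- an arbitrary ordered field.
record OrderedField (c ℓ₁ ℓ₂ : Level) : Set (suc (c ⊔ ℓ₁ ⊔ ℓ₂)) where
  field
    commutativeRing : CommutativeRing c ℓ₁
  open CommutativeRing commutativeRing public renaming (refl to ≈-refl)
  infix 4 _<_ _≤_
  field
    _<_                : Rel Carrier ℓ₂
    isStrictTotalOrder : IsStrictTotalOrder _≈_ _<_
    1≉0                : ¬ (1# ≈ 0#)
    inverse            : ∀ x → ¬ (x ≈ 0#) → ∃[ y ] x * y ≈ 1#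
    +-monoʳ-<          : ∀ x {y z} → y < z → x + y < x + z
    *-pos              : ∀ {x y} → 0# < x → 0# < y → 0# < x * y
  open IsStrictTotalOrder isStrictTotalOrder public using (compare; _≟_; _<?_; <-respʳ-≈; <-respˡ-≈)
  open Exp semiring public using (_^_; ^-homo-*)
  open Sum semiring public using (sum)
  open MonoidSum *-commutativeMonoid public using ()
    renaming (sum to product; sum-cong-≋ to product-cong; ∑-distrib-+ to product-distrib)

  _≤_ : Rel Carrier (ℓ₁ ⊔ ℓ₂)
  x ≤ y = x < y ⊎ x ≈ y

  sgn : Carrier → ℤ
  sgn x with compare x 0#
  ... | tri< _ _ _ = -1ℤ
  ... | tri≈ _ _ _ = 0ℤ
  ... | tri> _ _ _ = 1ℤ

count : ∀ {m p} {P : Pred (Fin m) p} → Decidable P → ℕ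
count {m} P? = length (filter P? (allFin m))

data Colour : Set where
  black white : Colour

pattern boundary i = inj₁ i
pattern internal v = inj₂ v

-- The directed graph underlying a plabic graph, with k boundary sources among n boundary vertices.
record PlabicGraph (k n : ℕ) : Set where
  field
    #internal #edges : ℕ

  Vertex = Fin n ⊎ Fin #internal
  Edge   = Fin #edges

  _≟ᵛ_ : DecidableEquality Vertex
  _≟ᵛ_ = ⊎.≡-dec Fin._≟_ Fin._≟_

  field
    source target : Edge → Vertex
    colour        : Fin #internal → Colour

  outdegree : Vertex → ℕ
  outdegree v = count (λ e → source e ≟ᵛ v)

  indegree : Vertex → ℕ
  indegree v = count (λ e → target e ≟ᵛ v)

  degree : Vertex → ℕ
  degree v = outdegree v ℕ.+ indegree v

  Adjacent : Rel Vertex _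
  Adjacent u v = ∃[ e ] source e ≡ u × target e ≡ v

  field
    boundary-degree : ∀ i → degree (boundary i) ≡ 1
    internal-degree : ∀ v → degree (internal v) ≡ 2 ⊎ degree (internal v) ≡ 3
    white-indegree  : ∀ v → colour v ≡ white → indegree (internal v) ≡ 1
    black-outdegree : ∀ v → colour v ≡ black → outdegree (internal v) ≡ 1
    not-isolated    : ∀ v → ∃[ i ] EqClosure Adjacent (internal v) (boundary i)
    -- i₁ < … < iₖ
    pivot           : Fin k → Fin n
    pivot-mono      : ∀ {r s} → r Fin.< s → pivot r Fin.< pivot s
    pivot-source    : ∀ i → (∃[ r ] pivot r ≡ i) ⇔ (∃[ e ] source e ≡ boundary i)

  IsPath : Pred (List Edge) _
  IsPath = Linked (λ e f → target e ≡ source f)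

  EndsAt : Fin n → Pred (List Edge) _
  EndsAt j P = Maybe.map target (List.last P) ≡ just (boundary j)

  PathFromEdge : Edge → Fin n → Pred (List Edge) _
  PathFromEdge e j P = IsPath P × List.head P ≡ just e × EndsAt j P

  PathFromBoundary : Fin n → Fin n → Pred (List Edge) _
  PathFromBoundary i j P = IsPath P × Maybe.map source (List.head P) ≡ just (boundary i) × EndsAt j P

  isPath? : Decidable IsPath
  isPath? = linked? (λ e f → target e ≟ᵛ source f)

  endsAt? : ∀ j → Decidable (EndsAt j)
  endsAt? j P = Maybe.≡-dec _≟ᵛ_ _ _

  pathFromEdge? : ∀ e j → Decidable (PathFromEdge e j)
  pathFromEdge? e j P = isPath? P ×-dec Maybe.≡-dec Fin._≟_ _ _ ×-dec endsAt? j P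

  pathFromBoundary? : ∀ i j → Decidable (PathFromBoundary i j)
  pathFromBoundary? i j P = isPath? P ×-dec Maybe.≡-dec _≟ᵛ_ _ _ ×-dec endsAt? j P

  open Membership _≟ᵛ_ using (_∈?_)

  -- Chronological loop erasure: `trail` is the loop-erased walk so far, most recent vertex first;
  -- returning to a vertex of the trail closes a loop, which is cut off.
  erasedLoops : List Vertex → List Vertex → ℕ
  erasedLoops trail []       = 0
  erasedLoops trail (v ∷ vs) with v ∈? trail
  ... | yes _ = ℕ.suc (erasedLoops (dropWhile (λ u → ¬? (u ≟ᵛ v)) trail) vs)
  ... | no  _ = erasedLoops (v ∷ trail) vs

  -- Only the parity of the topological winding index matters, and it is that of the number of
  -- loops removed by loop erasure.
  windTop : List Edge → ℕ
  windTop []       = 0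
  windTop (e ∷ es) = erasedLoops [] (source e ∷ map target (e ∷ es))

  σ : Fin k → Fin n → ℕ
  σ r j = count {k} λ s →
      (pivot r Fin.<? pivot s ×-dec pivot s Fin.<? j)
    ⊎-dec (j Fin.<? pivot s ×-dec pivot s Fin.<? pivot r)

  Exponent : Set
  Exponent = Vec ℕ #edges

  -- The exponent of the monomial w(P).
  multiplicity : List Edge → Exponent
  multiplicity P = Vec.tabulate λ e → length (filter (e Fin.≟_) P)

  edgeWords : ℕ → List (List Edge)
  edgeWords ℕ.zero    = [] ∷ []
  edgeWords (ℕ.suc m) = concatMap (λ e → map (e ∷_) (edgeWords m)) (allFin #edges)

module FormalSeries {c ℓ₁ ℓ₂} (K : OrderedField c ℓ₁ ℓ₂) (q : ℕ) where
  open OrderedField K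

  private
    Exponent = Vec ℕ q

  infixl 7 _⊛_
  infixl 6 _⊞_ _⊟_

  -- A formal power series in q variables is the function of its coefficients, a polynomial a list of
  -- terms (possibly with repeated exponents).
  Series : Set c
  Series = Exponent → Carrier

  Polynomial : Set c
  Polynomial = List (Carrier × Exponent)

  _⊞_ _⊟_ : Exponent → Exponent → Exponent
  _⊞_ = Vec.zipWith ℕ._+_
  _⊟_ = Vec.zipWith ℕ._∸_

  _≟ᵉ_ : DecidableEquality Exponent
  _≟ᵉ_ = Vec.≡-dec ℕ._≟_

  _≤ᵉ?_ : ∀ (α β : Exponent) → Dec (Pointwise ℕ._≤_ α β)
  _≤ᵉ?_ = Pointwise.decidable ℕ._≤?_

  coeff : Polynomial → Series
  coeff []            α = 0#
  coeff ((c , β) ∷ p) α = (if does (β ≟ᵉ α) then c else 0#) + coeff p α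

  _⊛_ : Polynomial → Series → Series
  ([]            ⊛ f) α = 0#
  (((c , β) ∷ p) ⊛ f) α = (if does (β ≤ᵉ? α) then c * f (α ⊟ β) else 0#) + (p ⊛ f) α

  monomial : (Fin q → Carrier) → Exponent → Carrier
  monomial w α = product (λ e → w e ^ Vec.lookup α e)

  eval : (Fin q → Carrier) → Polynomial → Carrier
  eval w []            = 0#
  eval w ((c , β) ∷ p) = c * monomial w β + eval w p

  -- The formal series f is the expansion of the rational function num/den, whose value at w is x.
  record SumsTo (w : Fin q → Carrier) (f : Series) (x : Carrier) : Set (c ⊔ ℓ₁) where
    field
      num den     : Polynomial
      expansion   : ∀ α → (den ⊛ f) α ≈ coeff num α
      den-nonzero : ¬ (eval w den ≈ 0#)
      value       : x * eval w den ≈ eval w num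

  private
    open import Relation.Binary.Reasoning.Setoid setoid
    open RingProperties ring using (-‿distribˡ-*; -0#≈0#)
    open AbelianGroupProperties +-abelianGroup using (⁻¹-∙-comm; x∙y⁻¹≈ε⇒x≈y)
    open SemiringSolver commutativeSemiring using (_:+_; _:*_; _:=_) renaming (solve to solveₛ)

    term : Carrier → Exponent → Series → Series
    term c β f α = if does (β ≤ᵉ? α) then c * f (α ⊟ β) else 0#

    term-cong : ∀ c β {f g : Series} → (∀ α → f α ≈ g α) → ∀ α → term c β f α ≈ term c β g α
    term-cong c β f≈g α with β ≤ᵉ? α
    ... | yes _ = *-congˡ (f≈g _)
    ... | no  _ = ≈-refl

    term-0 : ∀ c β α → term c β (λ _ → 0#) α ≈ 0#
    term-0 c β α with β ≤ᵉ? α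
    ... | yes _ = zeroʳ c
    ... | no  _ = ≈-refl

    term-+ : ∀ c β (f g : Series) α → term c β (λ γ → f γ + g γ) α ≈ term c β f α + term c β g α
    term-+ c β f g α with β ≤ᵉ? α
    ... | yes _ = distribˡ c _ _
    ... | no  _ = sym (+-identityʳ 0#)

    ⊞-≤ˡ : ∀ {m} {α β γ : Vec ℕ m} → Pointwise ℕ._≤_ (Vec.zipWith ℕ._+_ α β) γ → Pointwise ℕ._≤_ α γ
    ⊞-≤ˡ {α = Vec.[]}    {Vec.[]}    Pointwise.[]       = Pointwise.[]
    ⊞-≤ˡ {α = a Vec.∷ _} {b Vec.∷ _} (le Pointwise.∷ p) = ℕ.m+n≤o⇒m≤o a le Pointwise.∷ ⊞-≤ˡ p

    ⊞-≤ʳ : ∀ {m} {α β γ : Vec ℕ m} → Pointwise ℕ._≤_ (Vec.zipWith ℕ._+_ α β) γ →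
           Pointwise ℕ._≤_ β (Vec.zipWith ℕ._∸_ γ α)
    ⊞-≤ʳ {α = Vec.[]}    {Vec.[]}    Pointwise.[]       = Pointwise.[]
    ⊞-≤ʳ {α = a Vec.∷ _} {b Vec.∷ _} (le Pointwise.∷ p) =
      ℕ.m+n≤o⇒m≤o∸n b (ℕ.≤-trans (ℕ.≤-reflexive (ℕ.+-comm b a)) le) Pointwise.∷ ⊞-≤ʳ p

    ⊞-≤ : ∀ {m} {α β γ : Vec ℕ m} → Pointwise ℕ._≤_ α γ → Pointwise ℕ._≤_ β (Vec.zipWith ℕ._∸_ γ α) →
          Pointwise ℕ._≤_ (Vec.zipWith ℕ._+_ α β) γ
    ⊞-≤ Pointwise.[] Pointwise.[] = Pointwise.[]
    ⊞-≤ {α = a Vec.∷ _} {b Vec.∷ _} {g Vec.∷ _} (l Pointwise.∷ p) (m Pointwise.∷ r) =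
      ℕ.≤-trans (ℕ.+-monoʳ-≤ a m) (ℕ.≤-reflexive (ℕ.m+[n∸m]≡n l)) Pointwise.∷ ⊞-≤ p r

    ⊞-comm : ∀ {m} (α β : Vec ℕ m) → Vec.zipWith ℕ._+_ α β ≡ Vec.zipWith ℕ._+_ β α
    ⊞-comm = Vec.zipWith-comm ℕ.+-comm

    ⊟-⊟ : ∀ {m} (γ α β : Vec ℕ m) →
          Vec.zipWith ℕ._∸_ (Vec.zipWith ℕ._∸_ γ α) β ≡ Vec.zipWith ℕ._∸_ γ (Vec.zipWith ℕ._+_ α β)
    ⊟-⊟ Vec.[] Vec.[] Vec.[] = refl
    ⊟-⊟ (g Vec.∷ γ) (a Vec.∷ α) (b Vec.∷ β) = cong₂ Vec._∷_ (ℕ.∸-+-assoc g a b) (⊟-⊟ γ α β)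

    ⊞-⊟ : ∀ {m} (α β : Vec ℕ m) → Vec.zipWith ℕ._∸_ (Vec.zipWith ℕ._+_ α β) α ≡ β
    ⊞-⊟ Vec.[] Vec.[] = refl
    ⊞-⊟ (a Vec.∷ α) (b Vec.∷ β) = cong₂ Vec._∷_ (ℕ.m+n∸m≡n a b) (⊞-⊟ α β)

    ⊟-⊞ : ∀ {m} {α γ : Vec ℕ m} → Pointwise ℕ._≤_ α γ → Vec.zipWith ℕ._+_ α (Vec.zipWith ℕ._∸_ γ α) ≡ γ
    ⊟-⊞ Pointwise.[]      = refl
    ⊟-⊞ (l Pointwise.∷ p) = cong₂ Vec._∷_ (ℕ.m+[n∸m]≡n l) (⊟-⊞ p)

    ≤-⊞ : ∀ {m} (α β : Vec ℕ m) → Pointwise ℕ._≤_ α (Vec.zipWith ℕ._+_ α β)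
    ≤-⊞ Vec.[] Vec.[] = Pointwise.[]
    ≤-⊞ (a Vec.∷ α) (b Vec.∷ β) = ℕ.m≤m+n a b Pointwise.∷ ≤-⊞ α β

    term-term : ∀ c β d γ f α → term c β (term d γ f) α ≈ term (c * d) (β ⊞ γ) f α
    term-term c β d γ f α with β ≤ᵉ? α
    ... | no β≰α with (β ⊞ γ) ≤ᵉ? α
    ...   | yes le = contradiction (⊞-≤ˡ le) β≰α
    ...   | no  _  = ≈-refl
    term-term c β d γ f α | yes β≤α with γ ≤ᵉ? (α ⊟ β) | (β ⊞ γ) ≤ᵉ? α
    ... | yes _  | yes _  = trans (sym (*-assoc c d _)) (reflexive (cong (λ δ → c * d * f δ) (⊟-⊟ α β γ)))
    ... | no  _  | no _   = zeroʳ c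
    ... | yes le | no ¬le = contradiction (⊞-≤ β≤α le) ¬le
    ... | no ¬le | yes le = contradiction (⊞-≤ʳ le) ¬le

    term-comm : ∀ c β d γ f α → term c β (term d γ f) α ≈ term d γ (term c β f) α
    term-comm c β d γ f α = begin
      term c β (term d γ f) α      ≈⟨ term-term c β d γ f α ⟩
      term (c * d) (β ⊞ γ) f α     ≡⟨ cong (λ δ → term (c * d) δ f α) (⊞-comm β γ) ⟩
      term (c * d) (γ ⊞ β) f α     ≈⟨ coefficient-cong (γ ⊞ β) ⟩
      term (d * c) (γ ⊞ β) f α     ≈⟨ term-term d γ c β f α ⟨
      term d γ (term c β f) α      ∎
      where
      coefficient-cong : ∀ δ → term (c * d) δ f α ≈ term (d * c) δ f α
      coefficient-cong δ with δ ≤ᵉ? α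
      ... | yes _ = *-congʳ (*-comm c d)
      ... | no  _ = ≈-refl

    ⊛-cong : ∀ p {f g : Series} → (∀ α → f α ≈ g α) → ∀ α → (p ⊛ f) α ≈ (p ⊛ g) α
    ⊛-cong []            f≈g α = ≈-refl
    ⊛-cong ((c , β) ∷ p) f≈g α = +-cong (term-cong c β f≈g α) (⊛-cong p f≈g α)

    ⊛-term : ∀ p d γ f α → (p ⊛ term d γ f) α ≈ term d γ (p ⊛ f) α
    ⊛-term []            d γ f α = sym (term-0 d γ α)
    ⊛-term ((c , β) ∷ p) d γ f α = trans
      (+-cong (term-comm c β d γ f α) (⊛-term p d γ f α))
      (sym (term-+ d γ (term c β f) (p ⊛ f) α))

    ⊛-0 : ∀ p α → (p ⊛ (λ _ → 0#)) α ≈ 0#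
    ⊛-0 []            α = ≈-refl
    ⊛-0 ((c , β) ∷ p) α = trans (+-cong (term-0 c β α) (⊛-0 p α)) (+-identityʳ 0#)

    +-medial : ∀ a b c d → (a + b) + (c + d) ≈ (a + c) + (b + d)
    +-medial = solveₛ 4 (λ a b c d → (a :+ b) :+ (c :+ d) := (a :+ c) :+ (b :+ d)) ≈-refl

    ⊛-+ : ∀ p (f g : Series) α → (p ⊛ (λ γ → f γ + g γ)) α ≈ (p ⊛ f) α + (p ⊛ g) α
    ⊛-+ []            f g α = sym (+-identityʳ 0#)
    ⊛-+ ((c , β) ∷ p) f g α = trans (+-cong (term-+ c β f g α) (⊛-+ p f g α)) (+-medial _ _ _ _)

    ⊛-comm : ∀ p r f α → (p ⊛ (r ⊛ f)) α ≈ (r ⊛ (p ⊛ f)) α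
    ⊛-comm p []            f α = ⊛-0 p α
    ⊛-comm p ((d , γ) ∷ r) f α = trans
      (⊛-+ p (term d γ f) (r ⊛ f) α)
      (+-cong (⊛-term p d γ f α) (⊛-comm p r f α))

    shift : Carrier → Exponent → Polynomial → Polynomial
    shift c β = map (λ (d , γ) → c * d , β ⊞ γ)

    mul : Polynomial → Polynomial → Polynomial
    mul []            r = []
    mul ((c , β) ∷ p) r = shift c β r List.++ mul p r

    coeff-++ : ∀ p r α → coeff (p List.++ r) α ≈ coeff p α + coeff r α
    coeff-++ []            r α = sym (+-identityˡ _)
    coeff-++ ((c , β) ∷ p) r α = trans (+-congˡ (coeff-++ p r α)) (sym (+-assoc _ _ _))

    coeff-shift : ∀ c β r α → coeff (shift c β r) α ≈ term c β (coeff r) α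
    coeff-shift c β []            α = sym (term-0 c β α)
    coeff-shift c β ((d , γ) ∷ r) α = trans
      (+-cong δ-shift (coeff-shift c β r α))
      (sym (term-+ c β (λ δ → if does (γ ≟ᵉ δ) then d else 0#) (coeff r) α))
      where
      δ-shift : (if does ((β ⊞ γ) ≟ᵉ α) then c * d else 0#) ≈
                term c β (λ δ → if does (γ ≟ᵉ δ) then d else 0#) α
      δ-shift with (β ⊞ γ) ≟ᵉ α
      δ-shift | yes refl with β ≤ᵉ? (β ⊞ γ)
      ... | no ¬le = contradiction (≤-⊞ β γ) ¬le
      ... | yes _ with γ ≟ᵉ ((β ⊞ γ) ⊟ β)
      ...   | yes _   = ≈-refl
      ...   | no  γ≢  = contradiction (≡-sym (⊞-⊟ β γ)) γ≢
      δ-shift | no ≢α with β ≤ᵉ? α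
      ... | no _ = ≈-refl
      ... | yes le with γ ≟ᵉ (α ⊟ β)
      ...   | no  _    = sym (zeroʳ c)
      ...   | yes refl = contradiction (⊟-⊞ le) ≢α

    coeff-mul : ∀ p r α → coeff (mul p r) α ≈ (p ⊛ coeff r) α
    coeff-mul []            r α = ≈-refl
    coeff-mul ((c , β) ∷ p) r α = trans
      (coeff-++ (shift c β r) (mul p r) α)
      (+-cong (coeff-shift c β r α) (coeff-mul p r α))

    neg : Polynomial → Polynomial
    neg = map (λ (c , β) → - c , β)

    coeff-neg : ∀ p α → coeff (neg p) α ≈ - coeff p α
    coeff-neg []            α = sym -0#≈0#
    coeff-neg ((c , β) ∷ p) α = trans (+-cong δ-neg (coeff-neg p α)) (⁻¹-∙-comm _ _)
      where
      δ-neg : (if does (β ≟ᵉ α) then - c else 0#) ≈ - (if does (β ≟ᵉ α) then c else 0#)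
      δ-neg with β ≟ᵉ α
      ... | yes _ = ≈-refl
      ... | no  _ = sym -0#≈0#

    others : Exponent → Polynomial → Polynomial
    others β = filter (λ (_ , γ) → ¬? (γ ≟ᵉ β))

    coeff-others-≡ : ∀ β p → coeff (others β p) β ≈ 0#
    coeff-others-≡ β [] = ≈-refl
    coeff-others-≡ β ((d , γ) ∷ p) with γ ≟ᵉ β in eq
    ... | yes _ = coeff-others-≡ β p
    ... | no  _ rewrite eq = trans (+-identityˡ _) (coeff-others-≡ β p)

    coeff-others-≢ : ∀ β p {α} → α ≢ β → coeff (others β p) α ≈ coeff p α
    coeff-others-≢ β []            α≢β = ≈-refl
    coeff-others-≢ β ((d , γ) ∷ p) {α} α≢β with γ ≟ᵉ β
    ... | no  _    = +-congˡ (coeff-others-≢ β p α≢β)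
    ... | yes refl with γ ≟ᵉ α
    ...   | yes refl = contradiction refl α≢β
    ...   | no  _    = trans (coeff-others-≢ β p α≢β) (sym (+-identityˡ _))

    module Eval (w : Fin q → Carrier) where
      ev = eval w

      mono-⊞ : ∀ β γ → monomial w (β ⊞ γ) ≈ monomial w β * monomial w γ
      mono-⊞ β γ = trans
        (product-cong λ e → trans
          (reflexive (cong (w e ^_) (Vec.lookup-zipWith ℕ._+_ e β γ)))
          (^-homo-* (w e) (Vec.lookup β e) (Vec.lookup γ e)))
        (product-distrib (λ e → w e ^ Vec.lookup β e) (λ e → w e ^ Vec.lookup γ e))

      eval-++ : ∀ p r → ev (p List.++ r) ≈ ev p + ev r
      eval-++ []            r = sym (+-identityˡ _)
      eval-++ ((c , β) ∷ p) r = trans (+-congˡ (eval-++ p r)) (sym (+-assoc _ _ _))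

      eval-shift : ∀ c β r → ev (shift c β r) ≈ c * monomial w β * ev r
      eval-shift c β []            = sym (zeroʳ _)
      eval-shift c β ((d , γ) ∷ r) = begin
        c * d * monomial w (β ⊞ γ) + ev (shift c β r)
          ≈⟨ +-cong (*-congˡ (mono-⊞ β γ)) (eval-shift c β r) ⟩
        c * d * (monomial w β * monomial w γ) + c * monomial w β * ev r
          ≈⟨ solveₛ 5 (λ c d x y e → c :* d :* (x :* y) :+ c :* x :* e := c :* x :* (d :* y :+ e)) ≈-refl
               c d (monomial w β) (monomial w γ) (ev r) ⟩
        c * monomial w β * (d * monomial w γ + ev r) ∎

      eval-mul : ∀ p r → ev (mul p r) ≈ ev p * ev r
      eval-mul []            r = sym (zeroˡ _)
      eval-mul ((c , β) ∷ p) r = begin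
        ev (shift c β r List.++ mul p r)          ≈⟨ eval-++ (shift c β r) (mul p r) ⟩
        ev (shift c β r) + ev (mul p r)           ≈⟨ +-cong (eval-shift c β r) (eval-mul p r) ⟩
        c * monomial w β * ev r + ev p * ev r     ≈⟨ distribʳ (ev r) _ _ ⟨
        (c * monomial w β + ev p) * ev r          ∎

      eval-neg : ∀ p → ev (neg p) ≈ - ev p
      eval-neg []            = sym -0#≈0#
      eval-neg ((c , β) ∷ p) = trans
        (+-cong (sym (-‿distribˡ-* c (monomial w β))) (eval-neg p)) (⁻¹-∙-comm _ _)

      eval-split : ∀ β p → ev p ≈ coeff p β * monomial w β + ev (others β p)
      eval-split β [] = sym (trans (+-identityʳ _) (zeroˡ _))
      eval-split β ((d , γ) ∷ p) with γ ≟ᵉ β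
      ... | yes refl = begin
        d * m + ev p                                     ≈⟨ +-congˡ (eval-split β p) ⟩
        d * m + (coeff p β * m + ev (others β p))        ≈⟨ +-assoc _ _ _ ⟨
        d * m + coeff p β * m + ev (others β p)          ≈⟨ +-congʳ (distribʳ m _ _) ⟨
        (d + coeff p β) * m + ev (others β p)            ∎
        where m = monomial w β
      ... | no _ = begin
        d * monomial w γ + ev p
          ≈⟨ +-congˡ (eval-split β p) ⟩
        d * monomial w γ + (coeff p β * m + ev (others β p))
          ≈⟨ solveₛ 3 (λ a b c → a :+ (b :+ c) := b :+ (a :+ c)) ≈-refl _ _ _ ⟩
        coeff p β * m + (d * monomial w γ + ev (others β p))
          ≈⟨ +-congʳ (*-congʳ (+-identityˡ _)) ⟨
        (0# + coeff p β) * m + (d * monomial w γ + ev (others β p)) ∎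
        where m = monomial w β

      others-coeff-0 : ∀ β p → (∀ α → coeff p α ≈ 0#) → ∀ α → coeff (others β p) α ≈ 0#
      others-coeff-0 β p p≈0 α with α ≟ᵉ β
      ... | yes refl = coeff-others-≡ β p
      ... | no  α≢β  = trans (coeff-others-≢ β p α≢β) (p≈0 α)

      others-length : ∀ c β p → length (others β ((c , β) ∷ p)) ℕ.≤ length p
      others-length c β p with β ≟ᵉ β
      ... | yes _  = length-filter (λ (_ , γ) → ¬? (γ ≟ᵉ β)) p
      ... | no  β≢ = contradiction refl β≢

      eval-0 : ∀ m p → length p ℕ.≤ m → (∀ α → coeff p α ≈ 0#) → ev p ≈ 0#
      eval-0 m         []                  _          p≈0 = ≈-refl
      eval-0 (ℕ.suc m) p@((c , β) ∷ p′) (ℕ.s≤s le) p≈0 = begin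
        ev p                                         ≈⟨ eval-split β p ⟩
        coeff p β * monomial w β + ev (others β p)
          ≈⟨ +-cong (trans (*-congʳ (p≈0 β)) (zeroˡ _))
                    (eval-0 m (others β p) (ℕ.≤-trans (others-length c β p′) le) (others-coeff-0 β p p≈0)) ⟩
        0# + 0#                                      ≈⟨ +-identityʳ 0# ⟩
        0#                                           ∎

      eval-cong : ∀ p r → (∀ α → coeff p α ≈ coeff r α) → ev p ≈ ev r
      eval-cong p r p≈r = x∙y⁻¹≈ε⇒x≈y _ _ (begin
        ev p - ev r               ≈⟨ +-congˡ (eval-neg r) ⟨
        ev p + ev (neg r)         ≈⟨ eval-++ p (neg r) ⟨
        ev (p List.++ neg r)      ≈⟨ eval-0 _ (p List.++ neg r) ℕ.≤-refl difference ⟩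
        0#                        ∎)
        where
        difference : ∀ α → coeff (p List.++ neg r) α ≈ 0#
        difference α = begin
          coeff (p List.++ neg r) α       ≈⟨ coeff-++ p (neg r) α ⟩
          coeff p α + coeff (neg r) α     ≈⟨ +-cong (p≈r α) (coeff-neg r α) ⟩
          coeff r α - coeff r α           ≈⟨ -‿inverseʳ _ ⟩
          0#                              ∎

    cancel : ∀ {x y z} → ¬ (z ≈ 0#) → x * z ≈ y * z → x ≈ y
    cancel {x} {y} {z} z≉0 eq = begin
      x             ≈⟨ *-identityʳ x ⟨
      x * 1#        ≈⟨ *-congˡ zi≈1 ⟨
      x * (z * i)   ≈⟨ *-assoc x z i ⟨
      x * z * i     ≈⟨ *-congʳ eq ⟩
      y * z * i     ≈⟨ *-assoc y z i ⟩
      y * (z * i)   ≈⟨ *-congˡ zi≈1 ⟩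
      y * 1#        ≈⟨ *-identityʳ y ⟩
      y             ∎
      where
      i = proj₁ (inverse z z≉0)
      zi≈1 = proj₂ (inverse z z≉0)

  SumsTo-unique : ∀ {w f x y} → SumsTo w f x → SumsTo w f y → x ≈ y
  SumsTo-unique {w} {f} {x} {y} A B = cancel B.den-nonzero (cancel A.den-nonzero (begin
    x * ev B.den * ev A.den     ≈⟨ solveₛ 3 (λ x b a → x :* b :* a := b :* (x :* a)) ≈-refl x (ev B.den) (ev A.den) ⟩
    ev B.den * (x * ev A.den)   ≈⟨ *-congˡ A.value ⟩
    ev B.den * ev A.num         ≈⟨ eval-mul B.den A.num ⟨
    ev (mul B.den A.num)        ≈⟨ eval-cong (mul B.den A.num) (mul A.den B.num) same ⟩
    ev (mul A.den B.num)        ≈⟨ eval-mul A.den B.num ⟩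
    ev A.den * ev B.num         ≈⟨ *-congˡ B.value ⟨
    ev A.den * (y * ev B.den)   ≈⟨ solveₛ 3 (λ y b a → a :* (y :* b) := y :* b :* a) ≈-refl y (ev B.den) (ev A.den) ⟩
    y * ev B.den * ev A.den     ∎))
    where
    module A = SumsTo A
    module B = SumsTo B
    open Eval w
    same : ∀ α → coeff (mul B.den A.num) α ≈ coeff (mul A.den B.num) α
    same α = begin
      coeff (mul B.den A.num) α     ≈⟨ coeff-mul B.den A.num α ⟩
      (B.den ⊛ coeff A.num) α       ≈⟨ ⊛-cong B.den A.expansion α ⟨
      (B.den ⊛ (A.den ⊛ f)) α       ≈⟨ ⊛-comm B.den A.den f α ⟩
      (A.den ⊛ (B.den ⊛ f)) α       ≈⟨ ⊛-cong A.den B.expansion α ⟩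
      (A.den ⊛ coeff B.num) α       ≈⟨ coeff-mul A.den B.num α ⟨
      coeff (mul A.den B.num) α     ∎

module Plane {c ℓ₁ ℓ₂} (K : OrderedField c ℓ₁ ℓ₂) where
  open OrderedField K

  infixl 6 _⊹_ _⊖_
  infixr 7 _•_
  infix  4 _≋_

  record Vec² : Set c where
    constructor ⟨_,_⟩
    field x y : Carrier

  _≋_ : Rel Vec² ℓ₁
  ⟨ a , b ⟩ ≋ ⟨ c , d ⟩ = a ≈ c × b ≈ d

  _⊹_ _⊖_ : Vec² → Vec² → Vec²
  ⟨ a , b ⟩ ⊹ ⟨ c , d ⟩ = ⟨ a + c , b + d ⟩
  ⟨ a , b ⟩ ⊖ ⟨ c , d ⟩ = ⟨ a - c , b - d ⟩

  _•_ : Carrier → Vec² → Vec²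
  t • ⟨ a , b ⟩ = ⟨ t * a , t * b ⟩

  det : Vec² → Vec² → Carrier
  det ⟨ a , b ⟩ ⟨ c , d ⟩ = a * d - b * c

  s : Vec² → Vec² → ℤ
  s u v = sgn (det u v)

  -- X lies on the closed segment from p to q.
  OnSegment : Vec² → Vec² → Vec² → Set _
  OnSegment p q X = ∃[ t ] 0# ≤ t × t ≤ 1# × X ≋ p ⊹ t • (q ⊖ p)

  -- X lies on the ray from b in direction 𝔩, the starting point b excluded.
  OnRay : Vec² → Vec² → Vec² → Set _
  OnRay b 𝔩 X = ∃[ t ] 0# < t × X ≋ b ⊹ t • 𝔩

  -- For linearly independent v and v′ at an angle less than π: m points strictly inside that angle.
  -- The predicate is empty when v and v′ are parallel.
  InAngle : Vec² → Vec² → Vec² → Set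
  InAngle v v′ m = s v v′ ≢ 0ℤ × s v m ≡ s v v′ × s m v′ ≡ s v v′

  inAngle? : ∀ v v′ → Decidable (InAngle v v′)
  inAngle? v v′ m = ¬? (s v v′ ℤ.≟ 0ℤ) ×-dec (s v m ℤ.≟ s v v′) ×-dec (s m v′ ℤ.≟ s v v′)

  -- A ray and a segment which are not parallel meet in at most one point. (A gauge direction is
  -- never parallel to an edge, so the first condition only serves decidability.)
  RayCrosses : Vec² → Vec² → Vec² → Vec² → Set _
  RayCrosses b 𝔩 p q = ¬ (det 𝔩 (q ⊖ p) ≈ 0#) × ∃[ X ] OnRay b 𝔩 X × OnSegment p q X

  private
    open import Relation.Binary.Reasoning.Setoid setoid
    open RingProperties ring using (x[y-z]≈xy-xz; [y-z]x≈yx-zx)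
    open AbelianGroupProperties +-abelianGroup using (⁻¹-∙-comm; //-rightDividesʳ)
    open SemiringSolver commutativeSemiring using (_:+_; _:*_; _:=_) renaming (solve to solveₛ)

    ≤-resp : ∀ {x x′ y y′} → x ≈ x′ → y ≈ y′ → x ≤ y → x′ ≤ y′
    ≤-resp x≈ y≈ (inj₁ x<y) = inj₁ (<-respʳ-≈ y≈ (<-respˡ-≈ x≈ x<y))
    ≤-resp x≈ y≈ (inj₂ x≈y) = inj₂ (trans (sym x≈) (trans x≈y y≈))

    _≤?_ : ∀ x y → Dec (x ≤ y)
    x ≤? y = (x <? y) ⊎-dec (x ≟ y)

    +-swap : ∀ {a b c d} → a + b ≈ c + d → a - c ≈ d - b
    +-swap {a} {b} {c} {d} eq = begin
      a - c                 ≈⟨ +-congʳ (//-rightDividesʳ b a) ⟨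
      (a + b - b) - c       ≈⟨ +-congʳ (+-congʳ eq) ⟩
      (c + d - b) - c       ≈⟨ solveₛ 4 (λ c d b′ c′ → ((c :+ d) :+ b′) :+ c′ := (d :+ b′) :+ (c :+ c′)) ≈-refl c d (- b) (- c) ⟩
      (d - b) + (c - c)     ≈⟨ +-congˡ (-‿inverseʳ c) ⟩
      (d - b) + 0#          ≈⟨ +-identityʳ _ ⟩
      d - b                 ∎

    module Cramer (l₁ l₂ r₁ r₂ d₁ d₂ : Carrier) where
      D = det ⟨ l₁ , l₂ ⟩ ⟨ d₁ , d₂ ⟩

      det-t : ∀ {t u} → t * l₁ ≈ r₁ + u * d₁ → t * l₂ ≈ r₂ + u * d₂ →
              t * D ≈ det ⟨ r₁ , r₂ ⟩ ⟨ d₁ , d₂ ⟩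
      det-t {t} {u} e₁ e₂ = trans (x[y-z]≈xy-xz t _ _) (+-swap (begin
        t * (l₁ * d₂) + r₂ * d₁        ≈⟨ +-congʳ (*-assoc _ _ _) ⟨
        t * l₁ * d₂ + r₂ * d₁          ≈⟨ +-congʳ (*-congʳ e₁) ⟩
        (r₁ + u * d₁) * d₂ + r₂ * d₁   ≈⟨ solveₛ 5 (λ r₁ r₂ u d₁ d₂ → (r₁ :+ u :* d₁) :* d₂ :+ r₂ :* d₁ := (r₂ :+ u :* d₂) :* d₁ :+ r₁ :* d₂) ≈-refl r₁ r₂ u d₁ d₂ ⟩
        (r₂ + u * d₂) * d₁ + r₁ * d₂   ≈⟨ +-congʳ (*-congʳ e₂) ⟨
        t * l₂ * d₁ + r₁ * d₂          ≈⟨ +-congʳ (*-assoc _ _ _) ⟩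
        t * (l₂ * d₁) + r₁ * d₂        ∎))

      det-u : ∀ {t u} → t * l₁ ≈ r₁ + u * d₁ → t * l₂ ≈ r₂ + u * d₂ →
              u * D ≈ det ⟨ r₁ , r₂ ⟩ ⟨ l₁ , l₂ ⟩
      det-u {t} {u} e₁ e₂ = trans (x[y-z]≈xy-xz u _ _) (+-swap (begin
        u * (l₁ * d₂) + r₂ * l₁    ≈⟨ solveₛ 4 (λ l u d r → u :* (l :* d) :+ r :* l := (r :+ u :* d) :* l) ≈-refl l₁ u d₂ r₂ ⟩
        (r₂ + u * d₂) * l₁         ≈⟨ *-congʳ e₂ ⟨
        t * l₂ * l₁                ≈⟨ solveₛ 3 (λ t x y → t :* x :* y := t :* y :* x) ≈-refl t l₂ l₁ ⟩
        t * l₁ * l₂                ≈⟨ *-congʳ e₁ ⟩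
        (r₁ + u * d₁) * l₂         ≈⟨ solveₛ 4 (λ l u d r → (r :+ u :* d) :* l := u :* (l :* d) :+ r :* l) ≈-refl l₂ u d₁ r₁ ⟩
        u * (l₂ * d₁) + r₁ * l₂    ∎))

      -- det r d · l = det l d · r + det r l · d, one coordinate at a time
      plücker₁ : det ⟨ r₁ , r₂ ⟩ ⟨ d₁ , d₂ ⟩ * l₁ ≈ r₁ * D + det ⟨ r₁ , r₂ ⟩ ⟨ l₁ , l₂ ⟩ * d₁
      plücker₁ = begin
        (r₁ * d₂ - r₂ * d₁) * l₁                                            ≈⟨ [y-z]x≈yx-zx l₁ _ _ ⟩
        r₁ * d₂ * l₁ - r₂ * d₁ * l₁                                         ≈⟨ +-swap (solveₛ 6 (λ r₁ r₂ d₁ d₂ l₁ l₂ → r₁ :* d₂ :* l₁ :+ (r₁ :* (l₂ :* d₁) :+ r₂ :* l₁ :* d₁) := r₂ :* d₁ :* l₁ :+ (r₁ :* (l₁ :* d₂) :+ r₁ :* l₂ :* d₁)) ≈-refl r₁ r₂ d₁ d₂ l₁ l₂) ⟩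
        (r₁ * (l₁ * d₂) + r₁ * l₂ * d₁) - (r₁ * (l₂ * d₁) + r₂ * l₁ * d₁)   ≈⟨ +-congˡ (⁻¹-∙-comm _ _) ⟨
        (r₁ * (l₁ * d₂) + r₁ * l₂ * d₁) + (- (r₁ * (l₂ * d₁)) - r₂ * l₁ * d₁) ≈⟨ solveₛ 4 (λ a b c d → (a :+ b) :+ (c :+ d) := (a :+ c) :+ (b :+ d)) ≈-refl _ _ _ _ ⟩
        (r₁ * (l₁ * d₂) - r₁ * (l₂ * d₁)) + (r₁ * l₂ * d₁ - r₂ * l₁ * d₁)   ≈⟨ +-cong (x[y-z]≈xy-xz r₁ _ _) ([y-z]x≈yx-zx d₁ _ _) ⟨
        r₁ * D + det ⟨ r₁ , r₂ ⟩ ⟨ l₁ , l₂ ⟩ * d₁                           ∎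

      plücker₂ : det ⟨ r₁ , r₂ ⟩ ⟨ d₁ , d₂ ⟩ * l₂ ≈ r₂ * D + det ⟨ r₁ , r₂ ⟩ ⟨ l₁ , l₂ ⟩ * d₂
      plücker₂ = begin
        (r₁ * d₂ - r₂ * d₁) * l₂                                            ≈⟨ [y-z]x≈yx-zx l₂ _ _ ⟩
        r₁ * d₂ * l₂ - r₂ * d₁ * l₂                                         ≈⟨ +-swap (solveₛ 6 (λ r₁ r₂ d₁ d₂ l₁ l₂ → r₁ :* d₂ :* l₂ :+ (r₂ :* (l₂ :* d₁) :+ r₂ :* l₁ :* d₂) := r₂ :* d₁ :* l₂ :+ (r₂ :* (l₁ :* d₂) :+ r₁ :* l₂ :* d₂)) ≈-refl r₁ r₂ d₁ d₂ l₁ l₂) ⟩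
        (r₂ * (l₁ * d₂) + r₁ * l₂ * d₂) - (r₂ * (l₂ * d₁) + r₂ * l₁ * d₂)   ≈⟨ +-congˡ (⁻¹-∙-comm _ _) ⟨
        (r₂ * (l₁ * d₂) + r₁ * l₂ * d₂) + (- (r₂ * (l₂ * d₁)) - r₂ * l₁ * d₂) ≈⟨ solveₛ 4 (λ a b c d → (a :+ b) :+ (c :+ d) := (a :+ c) :+ (b :+ d)) ≈-refl _ _ _ _ ⟩
        (r₂ * (l₁ * d₂) - r₂ * (l₂ * d₁)) + (r₁ * l₂ * d₂ - r₂ * l₁ * d₂)   ≈⟨ +-cong (x[y-z]≈xy-xz r₂ _ _) ([y-z]x≈yx-zx d₂ _ _) ⟨
        r₂ * D + det ⟨ r₁ , r₂ ⟩ ⟨ l₁ , l₂ ⟩ * d₂                           ∎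

    -- Given b + t l ≈ p + u d, isolate t l.
    isolate : ∀ {X b p tl ud} → X ≈ b + tl → X ≈ p + ud → tl ≈ (p - b) + ud
    isolate {X} {b} {p} {tl} {ud} e₁ e₂ = begin
      tl                 ≈⟨ \\-leftDividesʳ′ ⟩
      - b + (b + tl)     ≈⟨ +-congˡ (trans (sym e₁) e₂) ⟩
      - b + (p + ud)     ≈⟨ solveₛ 3 (λ b p u → b :+ (p :+ u) := (p :+ b) :+ u) ≈-refl (- b) p ud ⟩
      (p - b) + ud       ∎
      where
      \\-leftDividesʳ′ : tl ≈ - b + (b + tl)
      \\-leftDividesʳ′ = sym (trans (sym (+-assoc _ _ _)) (trans (+-congʳ (-‿inverseˡ b)) (+-identityˡ tl)))

    unisolate : ∀ {b p tl ud} → tl ≈ (p - b) + ud → b + tl ≈ p + ud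
    unisolate {b} {p} {tl} {ud} e = begin
      b + tl               ≈⟨ +-congˡ e ⟩
      b + ((p - b) + ud)   ≈⟨ solveₛ 4 (λ b b′ p u → b :+ ((p :+ b′) :+ u) := (b :+ b′) :+ (p :+ u)) ≈-refl b (- b) p ud ⟩
      (b - b) + (p + ud)   ≈⟨ +-congʳ (-‿inverseʳ b) ⟩
      0# + (p + ud)        ≈⟨ +-identityˡ _ ⟩
      p + ud               ∎

  rayCrosses? : ∀ b 𝔩 p q → Dec (RayCrosses b 𝔩 p q)
  rayCrosses? b 𝔩 p q with det 𝔩 (q ⊖ p) ≟ 0#
  ... | yes D≈0 = no λ (D≉0 , _) → D≉0 D≈0
  rayCrosses? b@(⟨ b₁ , b₂ ⟩) 𝔩@(⟨ l₁ , l₂ ⟩) p@(⟨ p₁ , p₂ ⟩) q@(⟨ q₁ , q₂ ⟩) | no D≉0 =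
    map′ to from ((0# <? t₀) ×-dec (0# ≤? u₀) ×-dec (u₀ ≤? 1#))
    where
    open Cramer l₁ l₂ (p₁ - b₁) (p₂ - b₂) (q₁ - p₁) (q₂ - p₂)
    i  = proj₁ (inverse D D≉0)
    t₀ = det (p ⊖ b) (q ⊖ p) * i
    u₀ = det (p ⊖ b) 𝔩 * i

    Di≈1 : D * i ≈ 1#
    Di≈1 = proj₂ (inverse D D≉0)

    scale : ∀ {x l r y d} → x * l ≈ r * D + y * d → (x * i) * l ≈ r + (y * i) * d
    scale {x} {l} {r} {y} {d} e = begin
      x * i * l               ≈⟨ solveₛ 3 (λ x i l → x :* i :* l := x :* l :* i) ≈-refl x i l ⟩
      x * l * i               ≈⟨ *-congʳ e ⟩
      (r * D + y * d) * i     ≈⟨ solveₛ 5 (λ r D y d i → (r :* D :+ y :* d) :* i := r :* (D :* i) :+ y :* i :* d) ≈-refl r D y d i ⟩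
      r * (D * i) + y * i * d ≈⟨ +-congʳ (trans (*-congˡ Di≈1) (*-identityʳ r)) ⟩
      r + y * i * d           ∎

    unscale : ∀ {t x} → t * D ≈ x → t ≈ x * i
    unscale {t} {x} e = begin
      t             ≈⟨ *-identityʳ t ⟨
      t * 1#        ≈⟨ *-congˡ Di≈1 ⟨
      t * (D * i)   ≈⟨ *-assoc t D i ⟨
      t * D * i     ≈⟨ *-congʳ e ⟩
      x * i         ∎

    to : 0# < t₀ × 0# ≤ u₀ × u₀ ≤ 1# → RayCrosses b 𝔩 p q
    to (0<t , 0≤u , u≤1) =
      D≉0 , b ⊹ t₀ • 𝔩 , (t₀ , 0<t , ≈-refl , ≈-refl) ,
      (u₀ , 0≤u , u≤1 , unisolate (scale plücker₁) , unisolate (scale plücker₂))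

    from : RayCrosses b 𝔩 p q → 0# < t₀ × 0# ≤ u₀ × u₀ ≤ 1#
    from (_ , ⟨ _ , _ ⟩ , (t , 0<t , x₁ , x₂) , (u , 0≤u , u≤1 , y₁ , y₂)) =
      <-respʳ-≈ (unscale (det-t e₁ e₂)) 0<t ,
      ≤-resp ≈-refl u≈u₀ 0≤u , ≤-resp u≈u₀ ≈-refl u≤1
      where
      e₁ = isolate x₁ y₁
      e₂ = isolate x₂ y₂
      u≈u₀ = unscale (det-u e₁ e₂)

module Networks {c ℓ₁ ℓ₂} (K : OrderedField c ℓ₁ ℓ₂) where
  open OrderedField K public using (Carrier; _≈_; _*_; -_; 1#; _^_)
  open OrderedField K using (_+_; _-_; 0#; _<_; _≤_; sum)
  open Plane K
  open FormalSeries K using (Series; _≟ᵉ_; SumsTo)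

  -- A convex disk with a straight boundary interval lies on one side of the line spanned by the
  -- interval, and a finite straight-line drawing in it is the same thing as one in that half plane.
  -- Clockwise labelling puts the interior to the right of the direction from b₁ to bₙ.
  record Drawing {k n} (G : PlabicGraph k n) : Set (c ⊔ ℓ₁ ⊔ ℓ₂) where
    open PlabicGraph G
    field
      origin axis : Vec²
      coordinate  : Fin n → Carrier
      interior    : Fin #internal → Vec²

    position : Vertex → Vec²
    position = [ (λ i → origin ⊹ coordinate i • axis) , interior ]′

    vector : Edge → Vec²
    vector e = position (target e) ⊖ position (source e)

    OnEdge : Edge → Vec² → Set _
    OnEdge e = OnSegment (position (source e)) (position (target e))

    EndPoint : Edge → Vertex → Set
    EndPoint e v = source e ≡ v ⊎ target e ≡ v

    field
      clockwise : ∀ {i j} → i Fin.< j → coordinate i < coordinate j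
      inside    : ∀ v → s axis (interior v ⊖ origin) ≡ -1ℤ
      distinct  : ∀ {u v} → position u ≋ position v → u ≡ v
      no-loops  : ∀ e → source e ≢ target e
      -- Every vertex has an incident edge, so this also keeps vertices off all other edges.
      planar    : ∀ {e f X} → e ≢ f → OnEdge e X → OnEdge f X →
                  ∃[ v ] X ≋ position v × EndPoint e v × EndPoint f v

  record PlabicNetwork (k n : ℕ) : Set (c ⊔ ℓ₁ ⊔ ℓ₂) where
    field
      graph   : PlabicGraph k n
      drawing : Drawing graph
    open PlabicGraph graph public
    open Drawing drawing public
    field
      weight          : Edge → Carrier
      weight-positive : ∀ e → 0# < weight e

  Matrix : ℕ → ℕ → Set c
  Matrix k n = Fin k → Fin n → Carrier

  identity : ∀ {n} → Matrix n n
  identity i j = if does (i Fin.≟ j) then 1# else 0#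

  _≋ᴹ_ : ∀ {k n} → Rel (Matrix k n) ℓ₁
  A ≋ᴹ B = ∀ r j → A r j ≈ B r j

  _·_ : ∀ {k m n} → Matrix k m → Matrix m n → Matrix k n
  (A · B) r j = sum (λ i → A r i * B i j)

  -- A and B represent the same point [A] = [B] of the Grassmannian.
  RowEquivalent : ∀ {k n} → Rel (Matrix k n) _
  RowEquivalent A B = ∃₂ λ g h → (g · h) ≋ᴹ identity × (h · g) ≋ᴹ identity × B ≋ᴹ (g · A)

  module _ {k n : ℕ} (N : PlabicNetwork k n) where
    open PlabicNetwork N

    -- R is the generalized reduced row echelon form of [A] with pivot set I.
    EchelonForm : Matrix k n → Matrix k n → Set _
    EchelonForm A R = RowEquivalent A R × (∀ r r′ → R r (pivot r′) ≈ identity r r′)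

    -- The sum of (-1)^(sign P) w(P) over the paths P satisfying Q, as a formal power series in the
    -- weights: a path with monomial α has as many edges as the degree of α.
    signedSum : ∀ {ℓ} {Q : Pred (List Edge) ℓ} → Decidable Q → (List Edge → ℕ) → Series #edges
    signedSum Q? sign α =
      List.foldr _+_ 0# (map (λ P → (- 1#) ^ sign P)
        (filter (λ P → Q? P ×-dec (_≟ᵉ_ #edges (multiplicity P) α)) (edgeWords (Vec.sum α))))

    _HasSum_ : Series #edges → Carrier → Set _
    f HasSum x = SumsTo #edges weight f x

    Represents : Matrix k n → Set _
    Represents A = ∃[ R ] EchelonForm A R ×
      (∀ r j → (∀ r′ → pivot r′ ≢ j) →
        ∃[ x ] signedSum (pathFromBoundary? (pivot r) j) windTop HasSum x × R r j ≈ (- 1#) ^ σ r j * x)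

    record GaugeDirection : Set (c ⊔ ℓ₁ ⊔ ℓ₂) where
      field
        direction    : Vec²
        inward       : s axis direction ≡ -1ℤ
        not-parallel : ∀ e {u v} → source e ≡ internal u → target e ≡ internal v →
                       s (vector e) direction ≢ 0ℤ
        generic      : ∀ i v → ¬ OnRay (position (boundary i)) direction (interior v)

    open GaugeDirection

    wind : GaugeDirection → Edge → Edge → ℤ
    wind 𝔩 e f =
      if does ((s u v ℤ.≟ s u l) ×-dec (s u v ℤ.≟ s l v)) then s u v else 0ℤ
      where
      u = vector e
      v = vector f
      l = direction 𝔩

    int : GaugeDirection → Edge → ℕ
    int 𝔩 e = count λ r →
      rayCrosses? (position (boundary (pivot r))) (direction 𝔩) (position (source e)) (position (target e))

    windPath : GaugeDirection → List Edge → ℤ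
    windPath 𝔩 []           = 0ℤ
    windPath 𝔩 (e ∷ [])     = 0ℤ
    windPath 𝔩 (e ∷ f ∷ es) = wind 𝔩 e f ℤ.+ windPath 𝔩 (f ∷ es)

    intPath : GaugeDirection → List Edge → ℕ
    intPath 𝔩 P = ListAction.sum (map (int 𝔩) P)

    -- E_e = x. By SumsTo-unique there is at most one such x.
    IsEdgeVector : GaugeDirection → Edge → (Fin n → Carrier) → Set _
    IsEdgeVector 𝔩 e x = ∀ j →
      signedSum (pathFromEdge? e j) (λ P → ∣ windPath 𝔩 P ℤ.+ ℤ.+ intPath 𝔩 P ∣) HasSum x j

    -- Both gauge directions point into the half plane, so the rotation through inward directions
    -- sweeps the angle less than π between them, whose sides contain neither edge directions nor
    -- directions from a source to an internal vertex.
    par : GaugeDirection → GaugeDirection → Edge → ℕ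
    par 𝔩 𝔩′ e = if does (inAngle? (direction 𝔩) (direction 𝔩′) (vector e)) then 1 else 0

    -- The ray from a source b passes V when its direction is that of V - b.
    cr : GaugeDirection → GaugeDirection → Vertex → ℕ
    cr 𝔩 𝔩′ V = count λ r →
      inAngle? (direction 𝔩) (direction 𝔩′) (position V ⊖ position (boundary (pivot r)))

    row-minus-basis : Matrix k n → Fin k → Fin n → Carrier
    row-minus-basis R r j = R r j - identity (pivot r) j

{-# OPTIONS --safe #-}
module Submission where

-- Everything is a parity statement about single walks. A turn contributes to the winding index, and an edge
-- meets a gauge ray, exactly when a segment between two vectors crosses the ray in direction 𝔩 from the
-- origin: the segment between consecutive edge vectors, respectively between the two ends of the edge seen
-- from the boundary source.
--
-- For (2), the crossings of a segment with two such rays differ by the membership of its ends in the angle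
-- between the rays (a Plücker relation), and these differences telescope along the walk.
--
-- For (1), let the walk be simple. The secant vectors between its points form a triangle of parameters which
-- the drawing keeps away from the origin, so Hopf's argument equates modulo 2 the turns of the walk with the
-- crossings of its own gauge ray; the rays of the sources strictly between the two ends are crossed an odd
-- number of times, the others an even number of times. The same argument shows that a simple cycle turns
-- through 𝔩 an odd number of times, while it crosses every gauge ray an even number of times. Hence erasing
-- a loop, at a vertex with a single incoming or a single outgoing edge, changes the parity of wind + int by
-- one.

open import Defs
open import Algebra.Bundles using (CommutativeRing)
import Algebra.Properties.AbelianGroup as AbelianGroupProperties
import Algebra.Properties.CommutativeMonoid.Sum as MonoidSum
import Algebra.Properties.Ring as RingProperties
import Algebra.Properties.Semiring.Mult as Multiples
import Algebra.Properties.Semiring.Sum as SemiringSum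
import Algebra.Solver.Ring as RingSolver
import Algebra.Solver.Ring.AlmostCommutativeRing as ACR
open import Data.Bool using (Bool; true; false; not; _∧_; _∨_; _xor_; if_then_else_)
import Data.Bool.Properties as Bool
open import Data.Bool.Solver using (module xor-∧-Solver)
open import Data.Empty using (⊥; ⊥-elim)
open import Data.Fin using (Fin)
import Data.Fin as Fin
import Data.Fin.Properties as Fin
open import Data.Integer as ℤ using (ℤ; +_; -[1+_]; ∣_∣; 0ℤ; 1ℤ; -1ℤ)
import Data.Integer.Properties as ℤ
open import Data.List as List using (List; []; _∷_; _++_; _ʳ++_; length; filter; foldr; map; allFin; tabulate; dropWhile; initLast; _∷ʳ′_)
import Data.List.Properties as List
import Data.List.Membership.DecPropositional as DecMembership
open import Data.List.Membership.Propositional using (_∈_)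
open import Data.List.Membership.Propositional.Properties using (∈-filter⁺; ∈-allFin)
open import Data.List.Relation.Unary.All as All using (All; []; _∷_)
import Data.List.Relation.Unary.All.Properties as All
open import Data.List.Relation.Unary.AllPairs using ([]; _∷_)
open import Data.List.Relation.Unary.Any using (here; there)
open import Data.List.Relation.Unary.Linked using ([-]; _∷_)
open import Data.List.Relation.Unary.Unique.Propositional using (Unique)
open import Data.Maybe using (Maybe; just; nothing)
open import Data.Maybe.Properties using (just-injective)
open import Data.Nat as ℕ using (ℕ; zero; suc)
import Data.Nat.Properties as ℕ
open import Data.Product using (_×_; _,_; ∃-syntax; ∃₂; proj₁; proj₂)
open import Data.Sum using (_⊎_; inj₁; inj₂)
open import Data.Sum.Properties using (inj₁-injective)
import Data.Vec as Vec
import Data.Vec.Properties as Vec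
open import Function using (_∘_; id; mk⇔; module Equivalence)
open import Level using (_⊔_)
open import Relation.Binary using (IsStrictTotalOrder; tri<; tri≈; tri>)
open import Relation.Binary.PropositionalEquality as ≡ using (_≡_; _≢_; cong; cong₂)
open import Relation.Nullary using (¬_; Dec; yes; no; does; contradiction)
open import Relation.Nullary.Decidable using (¬?; _×-dec_; _⊎-dec_; _→-dec_; dec-true; dec-false; does-⇔; from-yes; map′)
open import Relation.Unary using (Pred; Decidable)

-- The obstacle is that secants are not generic. The gauge conditions keep 𝔩 off the edges and off
-- the lines from boundary vertices to other vertices, while a secant between two internal vertices
-- may well be parallel to 𝔩. The half-open side `Left` puts every nonzero vector into one of two
-- opposite halves, and with it the crossing parity is additive over every triangle that misses the
-- origin, with no genericity assumption. Hopf's homotopy thus becomes a finite sum: the triangle of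
-- secants is cut into cells, one for each pair of edges. Disjointness of the two edges keeps a cell
-- off the origin, and only consecutive edges need a separate argument. Loop erasure rewires a
-- vertex, and turns lost and gained there need not match at a general vertex. They do here because
-- two passages through a vertex with a single incoming or a single outgoing edge share an edge. The
-- source of a walk lies at the start of its own ray, so the crossings of this ray are not
-- determined by the sides of the two ends. This is why they have to be matched with the turns.

module IntegerSolver {c ℓ} (R : CommutativeRing c ℓ) where
  open CommutativeRing R
  open Multiples semiring using (×-homo-+; ×1-homo-*) renaming (_×_ to _×ₙ_)
  open RingProperties ring using (-0#≈0#; -‿distribˡ-*; -‿distribʳ-*; -‿involutive)
  open AbelianGroupProperties +-abelianGroup using (⁻¹-∙-comm)
  open import Relation.Binary.Reasoning.Setoid setoid

  -- Integer coefficients let the solver cancel opposite terms, as every determinant identity below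
  -- requires.
  ι : ℤ → Carrier
  ι (+ n)    = n ×ₙ 1#
  ι -[1+ n ] = - (suc n ×ₙ 1#)

  ι-⊖ : ∀ m n → ι (m ℤ.⊖ n) ≈ m ×ₙ 1# - n ×ₙ 1#
  ι-⊖ m zero = sym (trans (+-congˡ -0#≈0#) (+-identityʳ _))
  ι-⊖ zero (suc n) = sym (+-identityˡ _)
  ι-⊖ (suc m) (suc n) = begin
    ι (suc m ℤ.⊖ suc n)               ≡⟨ cong ι (ℤ.[1+m]⊖[1+n]≡m⊖n m n) ⟩
    ι (m ℤ.⊖ n)                       ≈⟨ ι-⊖ m n ⟩
    x - y                           ≈⟨ +-congˡ (+-identityˡ _) ⟨
    x + (0# - y)                    ≈⟨ +-congˡ (+-congʳ (-‿inverseʳ 1#)) ⟨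
    x + ((1# - 1#) - y)             ≈⟨ +-congˡ (+-assoc 1# _ _) ⟩
    x + (1# + (- 1# - y))           ≈⟨ +-assoc x 1# _ ⟨
    (x + 1#) + (- 1# - y)           ≈⟨ +-cong (+-comm x 1#) (⁻¹-∙-comm 1# y) ⟩
    (1# + x) - (1# + y)             ∎
    where
    x = m ×ₙ 1#
    y = n ×ₙ 1#

  ι-neg : ∀ i → ι (ℤ.- i) ≈ - ι i
  ι-neg (+ zero)  = sym -0#≈0#
  ι-neg (+ suc n) = refl
  ι-neg -[1+ n ]  = sym (-‿involutive _)

  ι-+ : ∀ i j → ι (i ℤ.+ j) ≈ ι i + ι j
  ι-+ (+ m)    (+ n)    = ×-homo-+ 1# m n
  ι-+ (+ m)    -[1+ n ] = ι-⊖ m (suc n)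
  ι-+ -[1+ m ] (+ n)    = trans (ι-⊖ n (suc m)) (+-comm _ _)
  ι-+ -[1+ m ] -[1+ n ] = begin
    - (suc (suc (m ℕ.+ n)) ×ₙ 1#)       ≡⟨ cong (λ k → - (suc k ×ₙ 1#)) (ℕ.+-suc m n) ⟨
    - ((suc m ℕ.+ suc n) ×ₙ 1#)         ≈⟨ -‿cong (×-homo-+ 1# (suc m) (suc n)) ⟩
    - (suc m ×ₙ 1# + suc n ×ₙ 1#)        ≈⟨ ⁻¹-∙-comm _ _ ⟨
    - (suc m ×ₙ 1#) - suc n ×ₙ 1#        ∎

  ι-*⁺ : ∀ m n → ι (+ m ℤ.* + n) ≈ ι (+ m) * ι (+ n)
  ι-*⁺ m n = trans (reflexive (cong ι (≡.sym (ℤ.pos-* m n)))) (×1-homo-* m n)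

  ι-*ʳ : ∀ m j → ι (+ m ℤ.* j) ≈ ι (+ m) * ι j
  ι-*ʳ m (+ n)    = ι-*⁺ m n
  ι-*ʳ m -[1+ n ] = begin
    ι (+ m ℤ.* ℤ.- (+ suc n))     ≡⟨ cong ι (ℤ.neg-distribʳ-* (+ m) (+ suc n)) ⟨
    ι (ℤ.- (+ m ℤ.* + suc n))     ≈⟨ ι-neg (+ m ℤ.* + suc n) ⟩
    - ι (+ m ℤ.* + suc n)         ≈⟨ -‿cong (ι-*⁺ m (suc n)) ⟩
    - (ι (+ m) * ι (+ suc n))     ≈⟨ -‿distribʳ-* _ _ ⟩
    ι (+ m) * - ι (+ suc n)       ∎

  ι-* : ∀ i j → ι (i ℤ.* j) ≈ ι i * ι j
  ι-* (+ m)    j = ι-*ʳ m j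
  ι-* -[1+ m ] j = begin
    ι (ℤ.- (+ suc m) ℤ.* j)     ≡⟨ cong ι (ℤ.neg-distribˡ-* (+ suc m) j) ⟨
    ι (ℤ.- (+ suc m ℤ.* j))     ≈⟨ ι-neg (+ suc m ℤ.* j) ⟩
    - ι (+ suc m ℤ.* j)         ≈⟨ -‿cong (ι-*ʳ (suc m) j) ⟩
    - (ι (+ suc m) * ι j)       ≈⟨ -‿distribˡ-* _ _ ⟩
    - ι (+ suc m) * ι j         ∎

  ι-≟ : ∀ i j → Maybe (ι i ≈ ι j)
  ι-≟ i j with i ℤ.≟ j
  ... | yes ≡.refl = just refl
  ... | no  _      = nothing

  ι-homomorphism : ℤ.+-*-rawRing ACR.-Raw-AlmostCommutative⟶ ACR.fromCommutativeRing R
  ι-homomorphism = record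
    { ⟦_⟧    = ι
    ; +-homo = ι-+
    ; *-homo = ι-*
    ; -‿homo = ι-neg
    ; 0-homo = refl
    ; 1-homo = +-identityʳ 1#
    }

  open RingSolver ℤ.+-*-rawRing (ACR.fromCommutativeRing R) ι-homomorphism ι-≟ public using (solve; _:=_; con; _:+_; _:*_; _:-_; :-_)

-- Signs in an ordered field

module OrderedFieldProperties {c ℓ₁ ℓ₂} (K : OrderedField c ℓ₁ ℓ₂) where
  open OrderedField K
  open IntegerSolver commutativeRing public
  open RingProperties ring public using (-0#≈0#; -‿involutive)
  private module < = IsStrictTotalOrder isStrictTotalOrder

  abstract
    positive? : ∀ x → Dec (0# < x)
    positive? x = 0# <? x

  -≈0 : ∀ {x} → x ≈ 0# → - x ≈ 0#
  -≈0 x≈0 = trans (-‿cong x≈0) -0#≈0#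

  -≈0⁻¹ : ∀ {x} → - x ≈ 0# → x ≈ 0#
  -≈0⁻¹ {x} h = trans (sym (-‿involutive x)) (-≈0 h)

  <-irrefl : ∀ {x y} → x ≈ y → ¬ (x < y)
  <-irrefl = <.irrefl

  <-trans : ∀ {x y z} → x < y → y < z → x < z
  <-trans = <.trans

  pos-resp : ∀ {x y} → x ≈ y → 0# < x → 0# < y
  pos-resp = <-respʳ-≈

  pos⇒≉0 : ∀ {x} → 0# < x → ¬ (x ≈ 0#)
  pos⇒≉0 0<x x≈0 = <-irrefl (sym x≈0) 0<x

  x<y⇒0<y-x : ∀ {x y} → x < y → 0# < y - x
  x<y⇒0<y-x {x} {y} x<y = <-respʳ-≈ (+-comm (- x) y) (<-respˡ-≈ (-‿inverseˡ x) (+-monoʳ-< (- x) x<y))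

  0<y-x⇒x<y : ∀ {x y} → 0# < y - x → x < y
  0<y-x⇒x<y {x} {y} p =
    <-respʳ-≈ (solve 2 (λ x y → x :+ (y :- x) := y) ≈-refl x y) (<-respˡ-≈ (+-identityʳ x) (+-monoʳ-< x p))

  neg⇒pos : ∀ {x} → x < 0# → 0# < - x
  neg⇒pos {x} x<0 = <-respʳ-≈ (+-identityˡ (- x)) (x<y⇒0<y-x x<0)

  pos⇒neg : ∀ {x} → 0# < - x → x < 0#
  pos⇒neg {x} p = 0<y-x⇒x<y (<-respʳ-≈ (sym (+-identityˡ (- x))) p)

  -- Negativity is recorded as positivity of the negative, so that one predicate carries all sign
  -- arithmetic.
  data Signed (x : Carrier) : Set (ℓ₁ ⊔ ℓ₂) where
    negative : 0# < - x → Signed x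
    null     : x ≈ 0# → Signed x
    positive : 0# < x → Signed x

  signed : ∀ x → Signed x
  signed x with compare x 0#
  ... | tri< x<0 _ _ = negative (neg⇒pos x<0)
  ... | tri≈ _ x≈0 _ = null x≈0
  ... | tri> _ _ 0<x = positive 0<x

  pos-+ : ∀ {x y} → 0# < x → 0# < y → 0# < x + y
  pos-+ {x} {y} p q = <-trans p (<-respˡ-≈ (+-identityʳ x) (+-monoʳ-< x q))

  pos-+-nonneg : ∀ {x y} → 0# < x → 0# ≤ y → 0# < x + y
  pos-+-nonneg p (inj₁ q)   = pos-+ p q
  pos-+-nonneg p (inj₂ 0≈y) = pos-resp (trans (sym (+-identityʳ _)) (+-congˡ 0≈y)) p

  nonneg-+-pos : ∀ {x y} → 0# ≤ x → 0# < y → 0# < x + y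
  nonneg-+-pos p q = pos-resp (+-comm _ _) (pos-+-nonneg q p)

  nonneg-+ : ∀ {x y} → 0# ≤ x → 0# ≤ y → 0# ≤ x + y
  nonneg-+ (inj₁ p)   q = inj₁ (pos-+-nonneg p q)
  nonneg-+ (inj₂ 0≈x) (inj₁ q)   = inj₁ (nonneg-+-pos (inj₂ 0≈x) q)
  nonneg-+ (inj₂ 0≈x) (inj₂ 0≈y) = inj₂ (trans (sym (+-identityʳ 0#)) (+-cong 0≈x 0≈y))

  nonneg-* : ∀ {x y} → 0# ≤ x → 0# ≤ y → 0# ≤ x * y
  nonneg-* (inj₁ p)   (inj₁ q)   = inj₁ (*-pos p q)
  nonneg-* (inj₂ 0≈x) _          = inj₂ (trans (sym (zeroˡ _)) (*-congʳ 0≈x))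
  nonneg-* (inj₁ _)   (inj₂ 0≈y) = inj₂ (trans (sym (zeroʳ _)) (*-congˡ 0≈y))

  nonneg-resp : ∀ {x y} → x ≈ y → 0# ≤ x → 0# ≤ y
  nonneg-resp x≈y (inj₁ p) = inj₁ (pos-resp x≈y p)
  nonneg-resp x≈y (inj₂ p) = inj₂ (trans p x≈y)

  ≮⇒nonneg : ∀ {x} → ¬ (0# < - x) → 0# ≤ x
  ≮⇒nonneg {x} ¬neg with signed x
  ... | negative q = contradiction q ¬neg
  ... | null q     = inj₂ (sym q)
  ... | positive q = inj₁ q

  ≯⇒nonpos : ∀ {x} → ¬ (0# < x) → 0# ≤ - x
  ≯⇒nonpos {x} ¬p = ≮⇒nonneg λ q → ¬p (pos-resp (-‿involutive x) q)

  pos-≁-neg : ∀ {x} → 0# < x → ¬ (0# < - x)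
  pos-≁-neg {x} p q = <-irrefl ≈-refl (pos-resp (-‿inverseʳ x) (pos-+ p q))

  nonneg-≁-neg : ∀ {x} → 0# ≤ x → ¬ (0# < - x)
  nonneg-≁-neg (inj₁ p) q = pos-≁-neg p q
  nonneg-≁-neg {x} (inj₂ 0≈x) q = <-irrefl ≈-refl (pos-resp (-≈0 (sym 0≈x)) q)

  0≤-zero : 0# ≤ 0#
  0≤-zero = inj₂ ≈-refl

  0<1 : 0# < 1#
  0<1 with signed 1#
  ... | negative p = pos-resp (trans (solve 1 (λ x → (:- x) :* (:- x) := x :* x) ≈-refl 1#) (*-identityˡ 1#)) (*-pos p p)
  ... | null p     = contradiction p 1≉0
  ... | positive p = p

  pos-cancelˡ : ∀ {k x} → 0# < k → 0# < k * x → 0# < x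
  pos-cancelˡ {k} {x} 0<k 0<kx with signed x
  ... | positive p = p
  ... | null p     = contradiction (trans (*-congˡ p) (zeroʳ k)) (pos⇒≉0 0<kx)
  ... | negative p =
    contradiction (pos-resp (solve 2 (λ k x → k :* (:- x) := :- (k :* x)) ≈-refl k x) (*-pos 0<k p)) (pos-≁-neg 0<kx)

  ≉0-* : ∀ {x y} → ¬ (x ≈ 0#) → x * y ≈ 0# → y ≈ 0#
  ≉0-* {x} {y} x≉0 xy≈0 = let (i , xi≈1) = inverse x x≉0 in begin
    y             ≈⟨ *-identityˡ y ⟨
    1# * y        ≈⟨ *-congʳ xi≈1 ⟨
    x * i * y     ≈⟨ solve 3 (λ x i y → x :* i :* y := i :* (x :* y)) ≈-refl x i y ⟩
    i * (x * y)   ≈⟨ *-congˡ xy≈0 ⟩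
    i * 0#        ≈⟨ zeroʳ i ⟩
    0#            ∎
    where open import Relation.Binary.Reasoning.Setoid setoid

  pos-inverse : ∀ {x} → 0# < x → ∃[ i ] x * i ≈ 1# × 0# < i
  pos-inverse {x} 0<x = let (i , xi≈1) = inverse x (pos⇒≉0 0<x) in
    i , xi≈1 , pos-cancelˡ 0<x (pos-resp (sym xi≈1) 0<1)

  sgn-pos : ∀ {x} → 0# < x → sgn x ≡ 1ℤ
  sgn-pos {x} p with compare x 0#
  ... | tri< _ _ ¬p = contradiction p ¬p
  ... | tri≈ _ _ ¬p = contradiction p ¬p
  ... | tri> _ _ _  = ≡.refl

  sgn-zero : ∀ {x} → x ≈ 0# → sgn x ≡ 0ℤ
  sgn-zero {x} p with compare x 0#
  ... | tri< _ ¬p _ = contradiction p ¬p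
  ... | tri≈ _ _ _  = ≡.refl
  ... | tri> _ ¬p _ = contradiction p ¬p

  sgn-neg : ∀ {x} → 0# < - x → sgn x ≡ -1ℤ
  sgn-neg {x} p with compare x 0#
  ... | tri< _ _ _  = ≡.refl
  ... | tri≈ ¬p _ _ = contradiction (pos⇒neg p) ¬p
  ... | tri> ¬p _ _ = contradiction (pos⇒neg p) ¬p

  sgn⁻-neg : ∀ {x} → sgn x ≡ -1ℤ → 0# < - x
  sgn⁻-neg {x} eq with compare x 0#
  ... | tri< p _ _ = neg⇒pos p

  sgn⁻-pos : ∀ {x} → sgn x ≡ 1ℤ → 0# < x
  sgn⁻-pos {x} eq with compare x 0#
  ... | tri> _ _ p = p

  isPositive : Carrier → Bool
  isPositive x = does (positive? x)

  isPositive-cong : ∀ {x y} → x ≈ y → isPositive x ≡ isPositive y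
  isPositive-cong {x} {y} x≈y = does-⇔ (mk⇔ (pos-resp x≈y) (pos-resp (sym x≈y))) (positive? x) (positive? y)

-- Determinants, and convex hulls that miss the origin

module PlaneProperties {c ℓ₁ ℓ₂} (K : OrderedField c ℓ₁ ℓ₂) where
  open OrderedField K
  open OrderedFieldProperties K
  open Plane K public
  open Vec²

  𝟎 : Vec²
  𝟎 = ⟨ 0# , 0# ⟩

  neg : Vec² → Vec²
  neg u = ⟨ - x u , - y u ⟩

  ≋-refl : ∀ {u} → u ≋ u
  ≋-refl = ≈-refl , ≈-refl

  ≋-sym : ∀ {u v} → u ≋ v → v ≋ u
  ≋-sym (p , q) = sym p , sym q

  ≋-trans : ∀ {u v w} → u ≋ v → v ≋ w → u ≋ w
  ≋-trans (p , q) (p′ , q′) = trans p p′ , trans q q′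

  ⊖-≋𝟎 : ∀ {u v} → u ≋ v → u ⊖ v ≋ 𝟎
  ⊖-≋𝟎 (p , q) = trans (+-congʳ p) (-‿inverseʳ _) , trans (+-congʳ q) (-‿inverseʳ _)

  𝟎-⊖ : ∀ {u v} → u ⊖ v ≋ 𝟎 → u ≋ v
  𝟎-⊖ (p , q) = e p , e q
    where
    e : ∀ {a b} → a - b ≈ 0# → a ≈ b
    e {a} {b} h = trans (solve 2 (λ a b → a := (a :- b) :+ b) ≈-refl a b) (trans (+-congʳ h) (+-identityˡ b))

  neg-⊖ : ∀ u v → neg (u ⊖ v) ≋ v ⊖ u
  neg-⊖ u v = e , e
    where
    e : ∀ {a b} → - (a - b) ≈ b - a
    e {a} {b} = solve 2 (λ a b → :- (a :- b) := b :- a) ≈-refl a b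

  ⊖-⊹ : ∀ u v w → (v ⊖ u) ⊹ (w ⊖ v) ≋ w ⊖ u
  ⊖-⊹ u v w = e , e
    where
    e : ∀ {a b c} → (b - a) + (c - b) ≈ c - a
    e {a} {b} {c} = solve 3 (λ a b c → (b :- a) :+ (c :- b) := c :- a) ≈-refl a b c

  det-cong : ∀ {u u′ v v′} → u ≋ u′ → v ≋ v′ → det u v ≈ det u′ v′
  det-cong (p , q) (p′ , q′) = +-cong (*-cong p q′) (-‿cong (*-cong q p′))

  det-swap : ∀ u v → det u v ≈ - det v u
  det-swap u v = solve 4 (λ a b c d → a :* d :- b :* c := :- (c :* b :- d :* a)) ≈-refl (x u) (y u) (x v) (y v)

  det-⊹ : ∀ u v w → det u (v ⊹ w) ≈ det u v + det u w
  det-⊹ u v w = solve 6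
    (λ a b c d e f → a :* (d :+ f) :- b :* (c :+ e) := (a :* d :- b :* c) :+ (a :* f :- b :* e))
    ≈-refl (x u) (y u) (x v) (y v) (x w) (y w)

  det-⊖ : ∀ u v w → det u (v ⊖ w) ≈ det u v - det u w
  det-⊖ u v w = solve 6
    (λ a b c d e f → a :* (d :- f) :- b :* (c :- e) := (a :* d :- b :* c) :- (a :* f :- b :* e))
    ≈-refl (x u) (y u) (x v) (y v) (x w) (y w)

  det-• : ∀ k u v → det u (k • v) ≈ k * det u v
  det-• k u v = solve 5
    (λ k a b c d → a :* (k :* d) :- b :* (k :* c) := k :* (a :* d :- b :* c))
    ≈-refl k (x u) (y u) (x v) (y v)

  det-neg : ∀ u v → det u (neg v) ≈ - det u v
  det-neg u v = solve 4 (λ a b c d → a :* (:- d) :- b :* (:- c) := :- (a :* d :- b :* c)) ≈-refl (x u) (y u) (x v) (y v)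

  det-neg-neg : ∀ u v → det (neg u) (neg v) ≈ det u v
  det-neg-neg u v = solve 4 (λ a b c d → (:- a) :* (:- d) :- (:- b) :* (:- c) := (a :* d :- b :* c)) ≈-refl (x u) (y u) (x v) (y v)

  det-self : ∀ u → det u u ≈ 0#
  det-self u = solve 2 (λ a b → a :* b :- b :* a := con 0ℤ) ≈-refl (x u) (y u)

  -- The linear dependence of three plane vectors. Many of the sign arguments below read off the
  -- signs of its three coefficients.
  cramer : ∀ u v w → det v w • u ⊹ det w u • v ⊹ det u v • w ≋ 𝟎
  cramer u v w =
    solve 6 (λ a b c d e f → (c :* f :- d :* e) :* a :+ (e :* b :- f :* a) :* c :+ (a :* d :- b :* c) :* e := con 0ℤ)
      ≈-refl (x u) (y u) (x v) (y v) (x w) (y w) ,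
    solve 6 (λ a b c d e f → (c :* f :- d :* e) :* b :+ (e :* b :- f :* a) :* d :+ (a :* d :- b :* c) :* f := con 0ℤ)
      ≈-refl (x u) (y u) (x v) (y v) (x w) (y w)

  -- The convex hull of the given vectors does not contain the origin.
  Apart₂ : Vec² → Vec² → Set _
  Apart₂ u v = ∀ a b → 0# ≤ a → 0# ≤ b → 0# < a + b → ¬ (a • u ⊹ b • v ≋ 𝟎)

  Apart₃ : Vec² → Vec² → Vec² → Set _
  Apart₃ u v w = ∀ a b c → 0# ≤ a → 0# ≤ b → 0# ≤ c → 0# < a + b + c → ¬ (a • u ⊹ b • v ⊹ c • w ≋ 𝟎)

  Disjoint : Vec² → Vec² → Vec² → Vec² → Set _
  Disjoint p q r s = ∀ X → OnSegment p q X → ¬ OnSegment r s X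

  Apart₂-swap : ∀ {u v} → Apart₂ u v → Apart₂ v u
  Apart₂-swap apart a b 0≤a 0≤b 0<a+b (p , q) =
    apart b a 0≤b 0≤a (pos-resp (+-comm a b) 0<a+b) (trans (+-comm _ _) p , trans (+-comm _ _) q)

  Apart₃-swap : ∀ {u v w} → Apart₃ u v w → Apart₃ u w v
  Apart₃-swap {u} {v} {w} apart a b c 0≤a 0≤b 0≤c 0<a+b+c (p , q) =
    apart a c b 0≤a 0≤c 0≤b (pos-resp (swap a b c) 0<a+b+c)
      (trans (swap _ _ _) p , trans (swap _ _ _) q)
    where
    swap : ∀ a b c → a + b + c ≈ a + c + b
    swap = solve 3 (λ a b c → a :+ b :+ c := a :+ c :+ b) ≈-refl

  Apart₃-rotate : ∀ {u v w} → Apart₃ u v w → Apart₃ v w u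
  Apart₃-rotate {u} {v} {w} apart a b c 0≤a 0≤b 0≤c 0<a+b+c (p , q) =
    apart c a b 0≤c 0≤a 0≤b (pos-resp (swap a b c) 0<a+b+c)
      (trans (sym (swap _ _ _)) p , trans (sym (swap _ _ _)) q)
    where
    swap : ∀ a b c → a + b + c ≈ c + a + b
    swap = solve 3 (λ a b c → a :+ b :+ c := c :+ a :+ b) ≈-refl

  Apart₂⇒≉𝟎 : ∀ {u v} → Apart₂ u v → ¬ (u ≋ 𝟎)
  Apart₂⇒≉𝟎 {u} {v} apart (p , q) = apart 1# 0# (inj₁ 0<1) 0≤-zero (pos-resp (sym (+-identityʳ 1#)) 0<1)
    (e p , e q)
    where
    e : ∀ {z w} → z ≈ 0# → 1# * z + 0# * w ≈ 0#
    e {z} {w} z≈0 = trans (+-cong (trans (*-identityˡ z) z≈0) (zeroˡ w)) (+-identityʳ 0#)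

  -- Regrouping turns a combination of `u`, `u ⊹ v` and `v` into one of `u` and `v` with
  -- coefficients `a + b` and `b + c`.
  Apart₂-sum : ∀ {u v} → Apart₂ u v → Apart₃ u (u ⊹ v) v
  Apart₂-sum {u} {v} apart a b c 0≤a 0≤b 0≤c 0<a+b+c (z , z′) =
    apart (a + b) (b + c) (nonneg-+ 0≤a 0≤b) (nonneg-+ 0≤b 0≤c)
      (pos-resp (solve 3 (λ a b c → (a :+ b :+ c) :+ b := (a :+ b) :+ (b :+ c)) ≈-refl a b c) (pos-+-nonneg 0<a+b+c 0≤b))
      (e z , e z′)
    where
    e : ∀ {p q} → a * p + b * (p + q) + c * q ≈ 0# → (a + b) * p + (b + c) * q ≈ 0#
    e {p} {q} z = trans (solve 5 (λ a b c p q → (a :+ b) :* p :+ (b :+ c) :* q := a :* p :+ b :* (p :+ q) :+ c :* q) ≈-refl a b c p q) z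

  Apart₃-resp : ∀ {u u′ v v′ w w′} → u ≋ u′ → v ≋ v′ → w ≋ w′ → Apart₃ u v w → Apart₃ u′ v′ w′
  Apart₃-resp (p , q) (p′ , q′) (p″ , q″) apart a b c 0≤a 0≤b 0≤c 0<a+b+c (z , z′) =
    apart a b c 0≤a 0≤b 0≤c 0<a+b+c
      ( trans (+-cong (+-cong (*-congˡ p) (*-congˡ p′)) (*-congˡ p″)) z
      , trans (+-cong (+-cong (*-congˡ q) (*-congˡ q′)) (*-congˡ q″)) z′)

  private
    x≤1 : ∀ {s t} → s + t ≈ 1# → 0# ≤ s → t ≤ 1#
    x≤1 {s} {t} e (inj₁ 0<s) = inj₁ (0<y-x⇒x<y (pos-resp (trans (solve 2 (λ s t → s := s :+ t :- t) ≈-refl s t) (+-congʳ e)) 0<s))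
    x≤1 {s} {t} e (inj₂ 0≈s) = inj₂ (trans (trans (sym (+-identityˡ t)) (+-congʳ 0≈s)) e)

    combine : ∀ {i a b c p q r s} → (a + b + c) * i ≈ 1# →
              a * (r - p) + b * (s - p) + c * (s - q) ≈ 0# →
              p + (i * c) * (q - p) ≈ r + (i * (b + c)) * (s - r)
    combine {i} {a} {b} {c} {p} {q} {r} {s} ni z = begin
      p + (i * c) * (q - p)               ≈⟨ +-congʳ (*-identityˡ p) ⟨
      1# * p + (i * c) * (q - p)          ≈⟨ +-congʳ (*-congʳ ni) ⟨
      n * i * p + (i * c) * (q - p)
        ≈⟨ solve 8 (λ i a b c p q r s → (a :+ b :+ c) :* i :* p :+ (i :* c) :* (q :- p) :=
             ((a :+ b :+ c) :* i :* r :+ (i :* (b :+ c)) :* (s :- r)) :- i :* (a :* (r :- p) :+ b :* (s :- p) :+ c :* (s :- q)))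
             ≈-refl i a b c p q r s ⟩
      (n * i * r + (i * (b + c)) * (s - r)) - i * (a * (r - p) + b * (s - p) + c * (s - q))
        ≈⟨ +-cong (+-congʳ (trans (*-congʳ ni) (*-identityˡ r))) (-‿cong (trans (*-congˡ z) (zeroʳ i))) ⟩
      (r + (i * (b + c)) * (s - r)) - 0#
        ≈⟨ solve 1 (λ x → x :- con 0ℤ := x) ≈-refl _ ⟩
      r + (i * (b + c)) * (s - r)         ∎
      where
      n = a + b + c
      open import Relation.Binary.Reasoning.Setoid setoid

  Disjoint-swap : ∀ {p q r s} → Disjoint p q r s → Disjoint r s p q
  Disjoint-swap d X on on′ = d X on′ on

  -- Divided by its total weight, a vanishing combination reads `(a + b) p + c q = a r + (b + c) s`:
  -- a point common to both segments.
  Disjoint⇒Apart₃ : ∀ {p q r s} → Disjoint p q r s → Apart₃ (r ⊖ p) (s ⊖ p) (s ⊖ q)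
  Disjoint⇒Apart₃ {p} {q} {r} {s} disjoint a b c 0≤a 0≤b 0≤c 0<n (z , z′) =
    let (i , ni≈1 , 0<i) = pos-inverse 0<n
        0≤i = inj₁ 0<i
        ic+i[a+b] : i * (a + b) + i * c ≈ 1#
        ic+i[a+b] = trans (solve 4 (λ i a b c → i :* (a :+ b) :+ i :* c := (a :+ b :+ c) :* i) ≈-refl i a b c) ni≈1
        ia+i[b+c] : i * a + i * (b + c) ≈ 1#
        ia+i[b+c] = trans (solve 4 (λ i a b c → i :* a :+ i :* (b :+ c) := (a :+ b :+ c) :* i) ≈-refl i a b c) ni≈1
    in disjoint (p ⊹ (i * c) • (q ⊖ p))
      (i * c , nonneg-* 0≤i 0≤c , x≤1 ic+i[a+b] (nonneg-* 0≤i (nonneg-+ 0≤a 0≤b)) , ≋-refl)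
      (i * (b + c) , nonneg-* 0≤i (nonneg-+ 0≤b 0≤c) , x≤1 ia+i[b+c] (nonneg-* 0≤i 0≤a) ,
        combine ni≈1 z , combine ni≈1 z′)

  Off⇒Apart₂ : ∀ {b p q} → ¬ OnSegment p q b → Apart₂ (p ⊖ b) (q ⊖ b)
  Off⇒Apart₂ {o} {p} {q} off a b 0≤a 0≤b 0<n (z , z′) =
    let (i , ni≈1 , 0<i) = pos-inverse 0<n
        ia+ib = trans (solve 3 (λ i a b → i :* a :+ i :* b := (a :+ b) :* i) ≈-refl i a b) ni≈1
    in off (i * b , nonneg-* (inj₁ 0<i) 0≤b , x≤1 ia+ib (nonneg-* (inj₁ 0<i) 0≤a) , e ni≈1 z , e ni≈1 z′)
    where
    open import Relation.Binary.Reasoning.Setoid setoid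
    e : ∀ {i o p q} → (a + b) * i ≈ 1# → a * (p - o) + b * (q - o) ≈ 0# → o ≈ p + i * b * (q - p)
    e {i} {o} {p} {q} ni z = begin
      o                    ≈⟨ *-identityˡ o ⟨
      1# * o               ≈⟨ *-congʳ ni ⟨
      (a + b) * i * o      ≈⟨ solve 6 (λ a b i o p q → (a :+ b) :* i :* o := ((a :+ b) :* i :* p :+ i :* b :* (q :- p)) :- i :* (a :* (p :- o) :+ b :* (q :- o))) ≈-refl a b i o p q ⟩
      ((a + b) * i * p + i * b * (q - p)) - i * (a * (p - o) + b * (q - o))
        ≈⟨ +-cong (+-congʳ (trans (*-congʳ ni) (*-identityˡ p))) (-‿cong (trans (*-congˡ z) (zeroʳ i))) ⟩
      (p + i * b * (q - p)) - 0#   ≈⟨ solve 1 (λ x → x :- con 0ℤ := x) ≈-refl _ ⟩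
      p + i * b * (q - p)  ∎

  Disjoint⇒Apart₃′ : ∀ {p q r s} → Disjoint p q r s → Apart₃ (p ⊖ r) (p ⊖ s) (q ⊖ s)
  Disjoint⇒Apart₃′ {p} {q} {r} {s} disjoint a b c 0≤a 0≤b 0≤c 0<n (z , z′) =
    Disjoint⇒Apart₃ disjoint a b c 0≤a 0≤b 0≤c 0<n (e z , e z′)
    where
    e : ∀ {p q r s} → a * (p - r) + b * (p - s) + c * (q - s) ≈ 0# → a * (r - p) + b * (s - p) + c * (s - q) ≈ 0#
    e {p} {q} {r} {s} h = trans
      (solve 7 (λ a b c p q r s → a :* (r :- p) :+ b :* (s :- p) :+ c :* (s :- q) := :- (a :* (p :- r) :+ b :* (p :- s) :+ c :* (q :- s))) ≈-refl a b c p q r s)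
      (-≈0 h)

-- Crossings of a segment with a ray from the origin

module RayCrossings {c ℓ₁ ℓ₂} (K : OrderedField c ℓ₁ ℓ₂) (axis l : Plane.Vec² K)
  (inward : OrderedField._<_ K (OrderedField.0# K) (OrderedField.-_ K (Plane.det K axis l))) where
  open OrderedField K
  open OrderedFieldProperties K
  open PlaneProperties K
  open Vec²

  -- The left side of l, where det axis decides on the line spanned by l. This tie-break makes it one of
  -- the two halves of the nonzero vectors exchanged by negation.
  Left : Vec² → Set _
  Left u = 0# < det l u ⊎ (det l u ≈ 0# × 0# < det axis u)

  abstract
    left? : ∀ u → Dec (Left u)
    left? u = (0# <? det l u) ⊎-dec ((det l u ≟ 0#) ×-dec (0# <? det axis u))

  left : Vec² → Bool
  left u = does (left? u)

  -- The origin is added for those terms of a combination whose coefficient may vanish.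
  Left≥ : Vec² → Set _
  Left≥ u = Left u ⊎ u ≋ 𝟎

  Left-resp : ∀ {u v} → u ≋ v → Left u → Left v
  Left-resp u≋v (inj₁ p)       = inj₁ (pos-resp (det-cong ≋-refl u≋v) p)
  Left-resp u≋v (inj₂ (p , q)) =
    inj₂ (trans (sym (det-cong ≋-refl u≋v)) p , pos-resp (det-cong ≋-refl u≋v) q)

  left-cong : ∀ {u v} → u ≋ v → left u ≡ left v
  left-cong {u} {v} u≋v = does-⇔ (mk⇔ (Left-resp u≋v) (Left-resp (≋-sym u≋v))) (left? u) (left? v)

  det-𝟎 : ∀ t {u} → u ≋ 𝟎 → det t u ≈ 0#
  det-𝟎 t u≋𝟎 = trans (det-cong (≋-refl {t}) u≋𝟎) (solve 2 (λ a b → a :* con 0ℤ :- b :* con 0ℤ := con 0ℤ) ≈-refl (x t) (y t))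

  ¬Left-𝟎 : ∀ {u} → u ≋ 𝟎 → ¬ Left u
  ¬Left-𝟎 u≋𝟎 (inj₁ p)       = pos⇒≉0 p (det-𝟎 l u≋𝟎)
  ¬Left-𝟎 u≋𝟎 (inj₂ (_ , p)) = pos⇒≉0 p (det-𝟎 axis u≋𝟎)

  Left-⊹ : ∀ {u v} → Left u → Left≥ v → Left (u ⊹ v)
  Left-⊹ {u} {v} p (inj₂ (v₁ , v₂)) =
    Left-resp (sym (trans (+-congˡ v₁) (+-identityʳ _)) , sym (trans (+-congˡ v₂) (+-identityʳ _))) p
  Left-⊹ {u} {v} (inj₁ p) (inj₁ (inj₁ q)) = inj₁ (pos-resp (sym (det-⊹ l u v)) (pos-+ p q))
  Left-⊹ {u} {v} (inj₁ p) (inj₁ (inj₂ (q , _))) =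
    inj₁ (pos-resp (sym (det-⊹ l u v)) (pos-+-nonneg p (inj₂ (sym q))))
  Left-⊹ {u} {v} (inj₂ (p , _)) (inj₁ (inj₁ q)) =
    inj₁ (pos-resp (sym (det-⊹ l u v)) (nonneg-+-pos (inj₂ (sym p)) q))
  Left-⊹ {u} {v} (inj₂ (p , p′)) (inj₁ (inj₂ (q , q′))) =
    inj₂ (trans (det-⊹ l u v) (trans (+-cong p q) (+-identityʳ 0#)) , pos-resp (sym (det-⊹ axis u v)) (pos-+ p′ q′))

  Left-• : ∀ {k u} → 0# < k → Left u → Left (k • u)
  Left-• {k} {u} 0<k (inj₁ p)       = inj₁ (pos-resp (sym (det-• k l u)) (*-pos 0<k p))
  Left-• {k} {u} 0<k (inj₂ (p , q)) =
    inj₂ (trans (det-• k l u) (trans (*-congˡ p) (zeroʳ k)) , pos-resp (sym (det-• k axis u)) (*-pos 0<k q))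

  Left≥-• : ∀ {k u} → 0# ≤ k → Left≥ u → Left≥ (k • u)
  Left≥-• (inj₁ 0<k) (inj₁ p)       = inj₁ (Left-• 0<k p)
  Left≥-• (inj₁ 0<k) (inj₂ (p , q)) = inj₂ (trans (*-congˡ p) (zeroʳ _) , trans (*-congˡ q) (zeroʳ _))
  Left≥-• (inj₂ 0≈k) _ =
    inj₂ (trans (*-congʳ (sym 0≈k)) (zeroˡ _) , trans (*-congʳ (sym 0≈k)) (zeroˡ _))

  ¬Left-both : ∀ {u} → Left u → ¬ Left (neg u)
  ¬Left-both {u} p q = ¬Left-𝟎 (-‿inverseʳ _ , -‿inverseʳ _) (Left-⊹ p (inj₁ q))

  neg-Left≥ : ∀ {u} → ¬ Left u → Left≥ (neg u)
  neg-Left≥ {u} ¬p with signed (det l u)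
  ... | positive q = contradiction (inj₁ q) ¬p
  ... | negative q = inj₁ (inj₁ (pos-resp (sym (det-neg l u)) q))
  ... | null q with signed (det axis u)
  ...   | positive r = contradiction (inj₂ (q , r)) ¬p
  ...   | negative r = inj₁ (inj₂ (trans (det-neg l u) (-≈0 q) , pos-resp (sym (det-neg axis u)) r))
  -- `axis` and `l` are linearly independent by `inward`, so a vector parallel to both is zero.
  ...   | null r = inj₂ (e (proj₁ (cramer u axis l)) , e (proj₂ (cramer u axis l)))
    where
    e : ∀ {p q′ r′} → det axis l * p + det l u * q′ + det u axis * r′ ≈ 0# → - p ≈ 0#
    e {p} {q′} {r′} z = -≈0 (≉0-* (λ d≈0 → pos⇒≉0 inward (-≈0 d≈0)) (begin
      det axis l * p                                       ≈⟨ solve 3 (λ a b c → a := a :+ con 0ℤ :* b :+ (:- con 0ℤ) :* c) ≈-refl (det axis l * p) q′ r′ ⟩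
      det axis l * p + 0# * q′ + - 0# * r′                 ≈⟨ +-cong (+-congˡ (*-congʳ q)) (*-congʳ (trans (det-swap u axis) (-‿cong r))) ⟨
      det axis l * p + det l u * q′ + det u axis * r′      ≈⟨ z ⟩
      0#                                                   ∎))
      where
      open import Relation.Binary.Reasoning.Setoid setoid

  left-neg : ∀ {u} → ¬ (u ≋ 𝟎) → left (neg u) ≡ not (left u)
  left-neg {u} u≉𝟎 with left? u
  ... | yes p = dec-false (left? (neg u)) (¬Left-both p)
  ... | no ¬p with neg-Left≥ ¬p
  ...   | inj₁ q       = dec-true (left? (neg u)) q
  ...   | inj₂ (q , r) = contradiction (-≈0⁻¹ q , -≈0⁻¹ r) u≉𝟎

  left-generic : ∀ {u} → ¬ (det l u ≈ 0#) → left u ≡ isPositive (det l u)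
  left-generic {u} ≉0 = does-⇔ (mk⇔ (λ { (inj₁ p) → p ; (inj₂ (p , _)) → contradiction p ≉0 }) inj₁) (left? u) (positive? (det l u))

  0≤-detˡ : ∀ {u} → Left u → 0# ≤ det l u
  0≤-detˡ (inj₁ p)       = inj₁ p
  0≤-detˡ (inj₂ (p , _)) = inj₂ (sym p)

  detˡ-≤0 : ∀ {u} → ¬ Left u → 0# ≤ - det l u
  detˡ-≤0 ¬p = ≯⇒nonpos (λ p → ¬p (inj₁ p))

  -- Whether the segment from u to v crosses the ray in direction l from the origin; a vector on the ray
  -- itself counts according to its side.
  crosses : Vec² → Vec² → Bool
  crosses u v = if left u then not (left v) ∧ isPositive (det v u) else left v ∧ isPositive (det u v)

  crosses-cong : ∀ {u u′ v v′} → u ≋ u′ → v ≋ v′ → crosses u v ≡ crosses u′ v′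
  crosses-cong {u} {u′} {v} {v′} p q
    rewrite left-cong p | left-cong q | isPositive-cong (det-cong p q) | isPositive-cong (det-cong q p) = ≡.refl

  crosses-sym : ∀ u v → crosses u v ≡ crosses v u
  crosses-sym u v with left u | left v
  ... | true  | true  = ≡.refl
  ... | true  | false = ≡.refl
  ... | false | true  = ≡.refl
  ... | false | false = ≡.refl

  crosses-same-side : ∀ {u v} → left u ≡ left v → crosses u v ≡ false
  crosses-same-side {u} {v} same with left u | left v
  crosses-same-side ≡.refl | true  | true  = ≡.refl
  crosses-same-side ≡.refl | false | false = ≡.refl

  crosses-𝟎ˡ : ∀ {u v} → u ≋ 𝟎 → crosses u v ≡ false
  crosses-𝟎ˡ {u} {v} u≋𝟎
    rewrite dec-false (left? u) (¬Left-𝟎 u≋𝟎)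
          | dec-false (positive? (det u v)) (λ p → pos⇒≉0 p (trans (det-swap u v) (-≈0 (det-𝟎 v u≋𝟎))))
    = Bool.∧-zeroʳ (left v)

  crosses-𝟎ʳ : ∀ {u v} → v ≋ 𝟎 → crosses u v ≡ false
  crosses-𝟎ʳ {u} {v} v≋𝟎 = ≡.trans (crosses-sym u v) (crosses-𝟎ˡ v≋𝟎)

  module _ {u v} (apart : Apart₂ u v) where
    -- Parallel nonzero vectors on opposite sides are negative multiples of each other, so a
    -- nonnegative combination of them vanishes. Its coefficients are values of `det l`, or of
    -- `det axis` when both vectors lie on the line of `l`.
    antiparallel-absurd : det u v ≈ 0# → ¬ Left u → ¬ Left v
    antiparallel-absurd d≈0 ¬p q with neg-Left≥ ¬p
    ... | inj₂ (z , z′) = Apart₂⇒≉𝟎 apart (-≈0⁻¹ z , -≈0⁻¹ z′)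
    ... | inj₁ r = go r q
      where
      -- The coefficients are the values of the linear functional det t at v and -u.
      opposite : ∀ t → 0# ≤ - det t u → 0# ≤ det t v → 0# < det t v + - det t u → ⊥
      opposite t 0≤-tu 0≤tv 0<sum = apart (det t v) (- det t u) 0≤tv 0≤-tu 0<sum
        (e (proj₁ (cramer t u v)) , e (proj₂ (cramer t u v)))
        where
        open import Relation.Binary.Reasoning.Setoid setoid
        e : ∀ {p q r} → det u v * p + det v t * q + det t u * r ≈ 0# → det t v * q + - det t u * r ≈ 0#
        e {p} {q} {r} z = begin
          det t v * q + - det t u * r
            ≈⟨ +-congʳ (*-congʳ (det-swap t v)) ⟩
          - det v t * q + - det t u * r
            ≈⟨ solve 6 (λ d a b p q r → (:- a) :* q :+ (:- b) :* r := d :* p :- (d :* p :+ a :* q :+ b :* r)) ≈-refl (det u v) (det v t) (det t u) p q r ⟩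
          det u v * p - (det u v * p + det v t * q + det t u * r)
            ≈⟨ +-cong (trans (*-congʳ d≈0) (zeroˡ p)) (-‿cong z) ⟩
          0# - 0#   ≈⟨ -‿inverseʳ 0# ⟩
          0#        ∎
      go : Left (neg u) → Left v → ⊥
      go _ (inj₁ s) = opposite l (detˡ-≤0 ¬p) (inj₁ s) (pos-+-nonneg s (detˡ-≤0 ¬p))
      go (inj₁ r) s@(inj₂ _) = opposite l (inj₁ r′) (0≤-detˡ s) (nonneg-+-pos (0≤-detˡ s) r′)
        where r′ = pos-resp (det-neg l u) r
      go (inj₂ (_ , r)) (inj₂ (_ , s)) = opposite axis (inj₁ r′) (inj₁ s) (pos-+ s r′)
        where r′ = pos-resp (det-neg axis u) r

  parallel-sides : ∀ {u v} → Apart₂ u v → det u v ≈ 0# → left u ≡ left v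
  parallel-sides {u} {v} apart d≈0 with left? u | left? v
  ... | yes _ | yes _ = ≡.refl
  ... | no  _ | no  _ = ≡.refl
  ... | no ¬p | yes q = contradiction q (antiparallel-absurd apart d≈0 ¬p)
  ... | yes p | no ¬q = contradiction p (antiparallel-absurd (Apart₂-swap apart)
    (trans (det-swap v u) (-≈0 d≈0)) ¬q)

  private
    isolate : ∀ u v w → (- det v w) • neg u ⊹ det w u • v ⊹ det u v • w ≋ 𝟎
    isolate u v w = e (proj₁ (cramer u v w)) , e (proj₂ (cramer u v w))
      where
      e : ∀ {p q r} → det v w * p + det w u * q + det u v * r ≈ 0# → (- det v w) * - p + det w u * q + det u v * r ≈ 0#
      e {p} {q} {r} z = trans (solve 6 (λ a b c p q r → (:- a) :* (:- p) :+ b :* q :+ c :* r := a :* p :+ b :* q :+ c :* r) ≈-refl _ _ _ p q r) z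

    -- Otherwise the Cramer relation either has only nonnegative coefficients, against `apart`, or,
    -- rewritten with the negative of `u`, becomes a vanishing sum of left vectors.
    same-sign : ∀ {u v w} → Apart₃ u v w → ¬ Left u → Left v → Left w → 0# < det u v → 0# < det u w
    same-sign {u} {v} {w} apart ¬u v′ w′ 0<uv with positive? (det u w)
    ... | yes p = p
    ... | no ¬p = ⊥-elim (go (positive? (- det v w)))
      where
      0≤wu : 0# ≤ det w u
      0≤wu = nonneg-resp (sym (det-swap w u)) (≯⇒nonpos ¬p)
      go : Dec (0# < - det v w) → ⊥
      go (no ¬q) = apart (det v w) (det w u) (det u v) (≮⇒nonneg ¬q) 0≤wu (inj₁ 0<uv)
        (nonneg-+-pos (nonneg-+ (≮⇒nonneg ¬q) 0≤wu) 0<uv) (cramer u v w)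
      go (yes q) = ¬Left-𝟎 (≋-trans (swap _ _ _ , swap _ _ _) (isolate u v w))
        (Left-⊹ (Left-⊹ (Left-• 0<uv w′) (Left≥-• 0≤wu (inj₁ v′))) (Left≥-• (inj₁ q) (neg-Left≥ ¬u)))
        where
        swap : ∀ a b c → c + b + a ≈ a + b + c
        swap = solve 3 (λ a b c → c :+ b :+ a := a :+ b :+ c) ≈-refl

    same-sign′ : ∀ {u v w} → Apart₃ u v w → Left u → ¬ Left v → ¬ Left w → 0# < det v u → 0# < det w u
    same-sign′ {u} {v} {w} apart u′ ¬v ¬w 0<vu with positive? (det w u)
    ... | yes p = p
    ... | no ¬p = ⊥-elim (go (positive? (- det w v)))
      where
      0≤uw : 0# ≤ det u w
      0≤uw = nonneg-resp (sym (det-swap u w)) (≯⇒nonpos ¬p)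
      go : Dec (0# < - det w v) → ⊥
      go (no ¬q) = Apart₃-swap apart (det w v) (det v u) (det u w) (≮⇒nonneg ¬q) (inj₁ 0<vu) 0≤uw
        (pos-+-nonneg (nonneg-+-pos (≮⇒nonneg ¬q) 0<vu) 0≤uw) (cramer u w v)
      go (yes q) = ¬Left-𝟎 (e (proj₁ (cramer u w v)) , e (proj₂ (cramer u w v)))
        (Left-⊹ (Left-⊹ (Left-• q u′) (Left≥-• (inj₁ 0<vu) (neg-Left≥ ¬w))) (Left≥-• 0≤uw (neg-Left≥ ¬v)))
        where
        e : ∀ {p q r} → det w v * p + det v u * q + det u w * r ≈ 0# →
            (- det w v) * p + det v u * - q + det u w * - r ≈ 0#
        e {p} {q} {r} z = trans
          (solve 6 (λ a b c p q r → (:- a) :* p :+ b :* (:- q) :+ c :* (:- r) := :- (a :* p :+ b :* q :+ c :* r)) ≈-refl _ _ _ p q r)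
          (-≈0 z)

  -- Moving the end of a segment within one side can change the crossing only by sweeping over the
  -- origin, which `apart` excludes.
  crosses-from : ∀ {u v w} → Apart₃ u v w → left v ≡ left w → crosses u v ≡ crosses u w
  crosses-from {u} {v} {w} apart same with left? u | left? v | left? w
  ... | yes u′ | yes v′ | yes w′ = ≡.refl
  ... | no ¬u  | no ¬v  | no ¬w  = ≡.refl
  ... | yes u′ | no ¬v  | no ¬w  = does-⇔
    (mk⇔ (same-sign′ apart u′ ¬v ¬w) (same-sign′ (Apart₃-swap apart) u′ ¬w ¬v)) (positive? (det v u)) (positive? (det w u))
  ... | no ¬u  | yes v′ | yes w′ = does-⇔
    (mk⇔ (same-sign apart ¬u v′ w′) (same-sign (Apart₃-swap apart) ¬u w′ v′)) (positive? (det u v)) (positive? (det u w))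

  -- Two of the three corners lie on the same side. The edge joining them does not cross, and the
  -- other two edges agree by `crosses-from`. Corners on the line of `l` are allowed, which makes
  -- this usable for arbitrary secants.
  crosses-triangle : ∀ {u v w} → Apart₃ u v w → crosses u v xor crosses v w ≡ crosses u w
  crosses-triangle {u} {v} {w} apart with left u Bool.≟ left v | left v Bool.≟ left w
  ... | yes p | _     = begin
    crosses u v xor crosses v w ≡⟨ cong (_xor crosses v w) (crosses-same-side p) ⟩
    crosses v w                 ≡⟨ crosses-sym v w ⟩
    crosses w v                 ≡⟨ crosses-from (Apart₃-rotate (Apart₃-rotate apart)) p ⟨
    crosses w u                 ≡⟨ crosses-sym w u ⟩
    crosses u w                 ∎
    where open ≡.≡-Reasoning
  ... | no _  | yes p = begin
    crosses u v xor crosses v w ≡⟨ cong (crosses u v xor_) (crosses-same-side p) ⟩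
    crosses u v xor false       ≡⟨ Bool.xor-identityʳ _ ⟩
    crosses u v                 ≡⟨ crosses-from apart p ⟩
    crosses u w                 ∎
    where open ≡.≡-Reasoning
  ... | no ≢₁ | no ≢₂ = begin
    crosses u v xor crosses v w ≡⟨ cong (_xor crosses v w) (crosses-sym u v) ⟩
    crosses v u xor crosses v w ≡⟨ cong (_xor crosses v w) (crosses-from (Apart₃-swap (Apart₃-rotate apart)) u≡w) ⟩
    crosses v w xor crosses v w ≡⟨ Bool.xor-same (crosses v w) ⟩
    false                       ≡⟨ crosses-same-side u≡w ⟨
    crosses u w                 ∎
    where
    open ≡.≡-Reasoning
    u≡w : left u ≡ left w
    u≡w = ≡.trans (Bool.¬-not ≢₁) (≡.sym (Bool.¬-not (λ e → ≢₂ (≡.sym e))))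

  -- The negated segment meets the ray when the original one meets the opposite ray. Both together
  -- count the crossings with the whole line, which depend on the sides alone.
  crosses-opposite : ∀ {u v} → Apart₂ u v → crosses u v xor crosses (neg u) (neg v) ≡ left u xor left v
  crosses-opposite {u} {v} apart
    rewrite left-neg (Apart₂⇒≉𝟎 apart) | left-neg (Apart₂⇒≉𝟎 (Apart₂-swap apart))
          | isPositive-cong (det-neg-neg u v) | isPositive-cong (det-neg-neg v u)
    with left? u | left? v
  ... | yes _ | yes _ = ≡.refl
  ... | no  _ | no  _ = ≡.refl
  ... | yes p | no ¬q = exactly-one
    where
    exactly-one : does (positive? (det v u)) xor does (positive? (det u v)) ≡ true
    exactly-one with signed (det u v)
    ... | negative z = cong₂ _xor_ (dec-true (positive? _) (pos-resp (sym (det-swap v u)) z)) (dec-false (positive? _) (λ z′ → pos-≁-neg z′ z))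
    ... | null z = contradiction p (antiparallel-absurd (Apart₂-swap apart) (trans (det-swap v u) (-≈0 z)) ¬q)
    ... | positive z = cong₂ _xor_ (dec-false (positive? _) (λ z′ → pos-≁-neg z (pos-resp (det-swap v u) z′))) (dec-true (positive? _) z)
  ... | no ¬p | yes q = exactly-one
    where
    exactly-one : does (positive? (det u v)) xor does (positive? (det v u)) ≡ true
    exactly-one with signed (det u v)
    ... | negative z = cong₂ _xor_ (dec-false (positive? _) (λ z′ → pos-≁-neg z′ z)) (dec-true (positive? _) (pos-resp (sym (det-swap v u)) z))
    ... | null z = contradiction q (antiparallel-absurd apart z ¬p)
    ... | positive z = cong₂ _xor_ (dec-true (positive? _) z) (dec-false (positive? _) (λ z′ → pos-≁-neg z (pos-resp (det-swap v u) z′)))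

-- Makes closed statements about Booleans decidable, so that conditional identities are proved by
-- truth table.
∀ᵇ? : ∀ {p} {P : Pred Bool p} → Decidable P → Dec (∀ b → P b)
∀ᵇ? P? = map′ (λ (t , f) → λ { true → t ; false → f }) (λ h → h true , h false) (P? true ×-dec P? false)

odd : ℕ → Bool
odd zero    = false
odd (suc n) = not (odd n)

-- Half planes bounded by the axis, and turns as crossings

module RayProperties {c ℓ₁ ℓ₂} (K : OrderedField c ℓ₁ ℓ₂) (axis l : Plane.Vec² K)
  (inward : OrderedField._<_ K (OrderedField.0# K) (OrderedField.-_ K (Plane.det K axis l))) where
  open OrderedField K
  open OrderedFieldProperties K
  open PlaneProperties K
  open Vec²
  open RayCrossings K axis l inward public
  open import Relation.Binary.Reasoning.Setoid setoid

  private
    -- A Plücker relation. The sign of `det u v`, which tells the ray from its opposite, follows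
    -- from the positions relative to `l` and `axis`.
    axis-relation : ∀ u v → - det axis l * det u v ≈ - (det l v * det axis u + - det l u * det axis v)
    axis-relation u v = solve 8
      (λ a b c d e f g h →
        (:- (a :* d :- b :* c)) :* (e :* h :- f :* g) :=
          :- ((c :* h :- d :* g) :* (a :* f :- b :* e) :+ (:- (c :* f :- d :* e)) :* (a :* h :- b :* g)))
      ≈-refl (x axis) (y axis) (x l) (y l) (x u) (y u) (x v) (y v)

    outward-not-positive : ∀ {u v} → ¬ Left u → Left v → 0# ≤ det axis u → 0# ≤ det axis v → ¬ (0# < det u v)
    outward-not-positive {u} {v} ¬p q 0≤u 0≤v r = nonneg-≁-neg
      (nonneg-+ (nonneg-* (0≤-detˡ q) 0≤u) (nonneg-* (detˡ-≤0 ¬p) 0≤v))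
      (pos-resp (axis-relation u v) (*-pos inward r))

    inward-positive : ∀ {u v} → Apart₂ u v → ¬ Left u → Left v → 0# ≤ - det axis u → 0# ≤ - det axis v → 0# < det u v
    inward-positive {u} {v} apart ¬p q u≤0 v≤0 with signed (det u v)
    ... | positive r = r
    ... | null r     = contradiction q (antiparallel-absurd apart r ¬p)
    ... | negative r = ⊥-elim (nonneg-≁-neg
      (nonneg-+ (nonneg-* (0≤-detˡ q) u≤0) (nonneg-* (detˡ-≤0 ¬p) v≤0))
      (pos-resp (trans (solve 2 (λ p q → p :* (:- q) := :- (p :* q)) ≈-refl _ _)
                (trans (-‿cong (axis-relation u v))
                (solve 4 (λ a b c d → :- (:- (a :* b :+ c :* d)) := :- (a :* (:- b) :+ c :* (:- d))) ≈-refl _ _ _ _)))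
        (*-pos inward r)))

  -- The ray points into the inward half plane, so a segment in the closed outward one can only meet
  -- the opposite ray.
  crosses-outward : ∀ {u v} → 0# ≤ det axis u → 0# ≤ det axis v → crosses u v ≡ false
  crosses-outward {u} {v} 0≤u 0≤v with left? u | left? v
  ... | yes _ | yes _ = ≡.refl
  ... | no _  | no _  = ≡.refl
  ... | no ¬p | yes q = dec-false (positive? (det u v)) (outward-not-positive ¬p q 0≤u 0≤v)
  ... | yes p | no ¬q = dec-false (positive? (det v u)) (outward-not-positive ¬q p 0≤v 0≤u)

  -- Within the closed inward half plane the line of `l` can only be crossed on the ray, so the
  -- sides of the ends decide.
  crosses-inward : ∀ {u v} → Apart₂ u v → 0# ≤ - det axis u → 0# ≤ - det axis v → crosses u v ≡ left u xor left v
  crosses-inward {u} {v} apart u≤0 v≤0 with left? u | left? v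
  ... | yes _ | yes _ = ≡.refl
  ... | no _  | no _  = ≡.refl
  ... | no ¬p | yes q = dec-true (positive? (det u v)) (inward-positive apart ¬p q u≤0 v≤0)
  ... | yes p | no ¬q = dec-true (positive? (det v u)) (inward-positive (Apart₂-swap apart) ¬q p v≤0 u≤0)

  private
    -- The `if` of `wind` with its three signs as variables, so that known signs can be substituted.
    turn : ℤ → ℤ → ℤ → ℤ
    turn i j k = if does ((i ℤ.≟ j) ×-dec (i ℤ.≟ k)) then i else 0ℤ

    turn-cong : ∀ {i i′ j j′ k k′} → i ≡ i′ → j ≡ j′ → k ≡ k′ → odd ∣ turn i j k ∣ ≡ odd ∣ turn i′ j′ k′ ∣
    turn-cong ≡.refl ≡.refl ≡.refl = ≡.refl

    sgn-swap-pos : ∀ {u v} → 0# < det u v → s v u ≡ -1ℤ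
    sgn-swap-pos {u} {v} p = sgn-neg (pos-resp (det-swap u v) p)

    sgn-swap-neg : ∀ {u v} → 0# < - det u v → s v u ≡ 1ℤ
    sgn-swap-neg {u} {v} p = sgn-pos (pos-resp (sym (det-swap v u)) p)

  -- On the same side of the line, `s u l` and `s l v` are opposite and the turn is zero. On
  -- different sides they agree, and comparison with `s u v` decides between the ray and its
  -- opposite.
  turn-crosses : ∀ {u v} → ¬ (det l u ≈ 0#) → ¬ (det l v ≈ 0#) → odd ∣ turn (s u v) (s u l) (s l v) ∣ ≡ crosses u v
  turn-crosses {u} {v} u≉0 v≉0 rewrite left-generic u≉0 | left-generic v≉0
    with signed (det l u) | signed (det l v)
  ... | null p     | _          = contradiction p u≉0
  ... | negative _ | null q     = contradiction q v≉0
  ... | positive _ | null q     = contradiction q v≉0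
  ... | negative p | negative q
    rewrite dec-false (positive? (det l u)) (λ r → pos-≁-neg r p) | dec-false (positive? (det l v)) (λ r → pos-≁-neg r q)
    = ≡.trans (turn-cong {s u v} ≡.refl (sgn-swap-neg p) (sgn-neg q)) (turn-mixed (s u v))
    where
    turn-mixed : ∀ i → odd ∣ turn i 1ℤ -1ℤ ∣ ≡ false
    turn-mixed i with i ℤ.≟ 1ℤ | i ℤ.≟ -1ℤ
    ... | yes ≡.refl | no _ = ≡.refl
    ... | no _ | yes _ = ≡.refl
    ... | no _ | no _ = ≡.refl
  ... | positive p | positive q
    rewrite dec-true (positive? (det l u)) p | dec-true (positive? (det l v)) q
    = ≡.trans (turn-cong {s u v} ≡.refl (sgn-swap-pos p) (sgn-pos q)) (turn-mixed (s u v))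
    where
    turn-mixed : ∀ i → odd ∣ turn i -1ℤ 1ℤ ∣ ≡ false
    turn-mixed i with i ℤ.≟ -1ℤ | i ℤ.≟ 1ℤ
    ... | yes ≡.refl | no _ = ≡.refl
    ... | no _ | yes _ = ≡.refl
    ... | no _ | no _ = ≡.refl
  ... | negative p | positive q
    rewrite dec-false (positive? (det l u)) (λ r → pos-≁-neg r p) | dec-true (positive? (det l v)) q
    = go (signed (det u v))
    where
    go : Signed (det u v) → odd ∣ turn (s u v) (s u l) (s l v) ∣ ≡ does (positive? (det u v))
    go (negative r) = ≡.trans (turn-cong (sgn-neg r) (sgn-swap-neg p) (sgn-pos q)) (≡.sym (dec-false (positive? _) λ r′ → pos-≁-neg r′ r))
    go (null r)     = ≡.trans (turn-cong (sgn-zero r) (sgn-swap-neg p) (sgn-pos q)) (≡.sym (dec-false (positive? _) λ r′ → pos⇒≉0 r′ r))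
    go (positive r) = ≡.trans (turn-cong (sgn-pos r) (sgn-swap-neg p) (sgn-pos q)) (≡.sym (dec-true (positive? _) r))
  ... | positive p | negative q
    rewrite dec-true (positive? (det l u)) p | dec-false (positive? (det l v)) (λ r → pos-≁-neg r q)
    = go (signed (det v u))
    where
    go : Signed (det v u) → odd ∣ turn (s u v) (s u l) (s l v) ∣ ≡ does (positive? (det v u))
    go (negative r) = ≡.trans (turn-cong (sgn-swap-neg r) (sgn-swap-pos p) (sgn-neg q)) (≡.sym (dec-false (positive? _) λ r′ → pos-≁-neg r′ r))
    go (null r)     = ≡.trans (turn-cong (sgn-zero (trans (det-swap u v) (-≈0 r))) (sgn-swap-pos p) (sgn-neg q)) (≡.sym (dec-false (positive? _) λ r′ → pos⇒≉0 r′ r))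
    go (positive r) = ≡.trans (turn-cong (sgn-swap-pos r) (sgn-swap-pos p) (sgn-neg q)) (≡.sym (dec-true (positive? _) r))

-- Gauge rays meeting an edge, as crossings seen from the source

module RayMeetsSegment {c ℓ₁ ℓ₂} (K : OrderedField c ℓ₁ ℓ₂) (axis l : Plane.Vec² K)
  (inward : OrderedField._<_ K (OrderedField.0# K) (OrderedField.-_ K (Plane.det K axis l))) where
  open OrderedField K
  open OrderedFieldProperties K
  open PlaneProperties K
  open Vec²
  open RayCrossings K axis l inward
  open import Relation.Binary.Reasoning.Setoid setoid

  module _ (b p q : Vec²) where
    private
      u v : Vec²
      u = p ⊖ b
      v = q ⊖ b

    private
      -- A common point exhibits `t • l` as a convex combination of `u` and `v`. It is stated for
      -- every functional `det z`, because the cases below test it with `l`, `u`, `v` and `axis`.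
      convex : ∀ {X} → OnRay b l X → OnSegment p q X →
               ∃[ t ] ∃[ w ] 0# < t × 0# ≤ w × 0# ≤ 1# - w × (∀ z → t * det z l ≈ (1# - w) * det z u + w * det z v)
      convex {X} (t , 0<t , X₁ , X₂) (w , 0≤w , w≤1 , Y₁ , Y₂) = t , w , 0<t , 0≤w , 0≤1-w w≤1 , functional
        where
        0≤1-w : w ≤ 1# → 0# ≤ 1# - w
        0≤1-w (inj₁ w<1) = inj₁ (x<y⇒0<y-x w<1)
        0≤1-w (inj₂ w≈1) = inj₂ (sym (trans (+-congʳ (sym w≈1)) (-‿inverseʳ w)))
        e : ∀ {X b p q l} → X ≈ b + t * l → X ≈ p + w * (q - p) → t * l ≈ (1# - w) * (p - b) + w * (q - b)
        e {X} {b} {p} {q} {l} h h′ = begin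
          t * l                           ≈⟨ solve 2 (λ b tl → tl := (b :+ tl) :- b) ≈-refl b (t * l) ⟩
          (b + t * l) - b                 ≈⟨ +-congʳ (trans (sym h) h′) ⟩
          (p + w * (q - p)) - b           ≈⟨ solve 4 (λ b p q w → (p :+ w :* (q :- p)) :- b := (p :- b) :- w :* (p :- b) :+ w :* (q :- b)) ≈-refl b p q w ⟩
          (p - b) - w * (p - b) + w * (q - b)
            ≈⟨ +-congʳ (+-congʳ (*-identityˡ _)) ⟨
          1# * (p - b) - w * (p - b) + w * (q - b)
            ≈⟨ solve 4 (λ o w u v → o :* u :- w :* u :+ v := (o :- w) :* u :+ v) ≈-refl 1# w (p - b) (w * (q - b)) ⟩
          (1# - w) * (p - b) + w * (q - b) ∎
        functional : ∀ z → t * det z l ≈ (1# - w) * det z u + w * det z v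
        functional z = begin
          t * det z l           ≈⟨ det-• t z l ⟨
          det z (t • l)         ≈⟨ det-cong ≋-refl (e X₁ Y₁ , e X₂ Y₂) ⟩
          det z ((1# - w) • u ⊹ w • v) ≈⟨ det-⊹ z ((1# - w) • u) (w • v) ⟩
          det z ((1# - w) • u) + det z (w • v) ≈⟨ +-cong (det-• (1# - w) z u) (det-• w z v) ⟩
          (1# - w) * det z u + w * det z v ∎

      convex-pos : ∀ {w a b} → 0# ≤ w → 0# ≤ 1# - w → 0# < a → 0# < b → 0# < (1# - w) * a + w * b
      convex-pos (inj₁ 0<w) 0≤w′ 0<a 0<b = nonneg-+-pos (nonneg-* 0≤w′ (inj₁ 0<a)) (*-pos 0<w 0<b)
      convex-pos {w} {a} (inj₂ 0≈w) 0≤w′ 0<a 0<b = pos-resp (begin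
        a                      ≈⟨ *-identityˡ a ⟨
        1# * a                 ≈⟨ solve 3 (λ o a b → o :* a := (o :- con 0ℤ) :* a :+ con 0ℤ :* b) ≈-refl 1# a _ ⟩
        (1# - 0#) * a + 0# * _ ≈⟨ +-cong (*-congʳ (+-congˡ (-‿cong 0≈w))) (*-congʳ 0≈w) ⟩
        (1# - w) * a + w * _   ∎) 0<a

      nonneg-cancelˡ : ∀ {k z} → 0# ≤ k → 0# < k * z → 0# < z
      nonneg-cancelˡ (inj₁ 0<k) p = pos-cancelˡ 0<k p
      nonneg-cancelˡ (inj₂ 0≈k) p = contradiction (trans (*-congʳ (sym 0≈k)) (zeroˡ _)) (pos⇒≉0 p)

      -- Dividing the relation by `α + β` makes its right side a convex combination, that is, a
      -- point of the segment seen from `b`.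
      meet : ∀ {α β γ} → 0# < α → 0# < β → 0# < γ → γ • l ≋ β • u ⊹ α • v →
             ∃[ X ] OnRay b l X × OnSegment p q X
      meet {α} {β} {γ} 0<α 0<β 0<γ (e₁ , e₂) =
        let (i , ni≈1 , 0<i) = pos-inverse (pos-+ 0<α 0<β) in
        b ⊹ (γ * i) • l ,
        (γ * i , *-pos 0<γ 0<i , ≋-refl) ,
        (α * i , inj₁ (*-pos 0<α 0<i) ,
          inj₁ (0<y-x⇒x<y (pos-resp (trans (solve 3 (λ α β i → β :* i := (α :+ β) :* i :- α :* i) ≈-refl α β i) (+-congʳ ni≈1)) (*-pos 0<β 0<i))) ,
          e ni≈1 e₁ , e ni≈1 e₂)
        where
        e : ∀ {i b p q l} → (α + β) * i ≈ 1# → γ * l ≈ β * (p - b) + α * (q - b) → b + γ * i * l ≈ p + α * i * (q - p)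
        e {i} {b} {p} {q} {l} n h = begin
          b + γ * i * l                               ≈⟨ solve 4 (λ b γ i l → b :+ γ :* i :* l := b :+ i :* (γ :* l)) ≈-refl b γ i l ⟩
          b + i * (γ * l)                             ≈⟨ +-congˡ (*-congˡ h) ⟩
          b + i * (β * (p - b) + α * (q - b))
            ≈⟨ solve 6 (λ b i α β p q → b :+ i :* (β :* (p :- b) :+ α :* (q :- b)) := b :+ (α :+ β) :* i :* (p :- b) :+ α :* i :* (q :- p)) ≈-refl b i α β p q ⟩
          b + (α + β) * i * (p - b) + α * i * (q - p) ≈⟨ +-congʳ (+-congˡ (trans (*-congʳ n) (*-identityˡ _))) ⟩
          b + (p - b) + α * i * (q - p)               ≈⟨ +-congʳ (solve 2 (λ b p → b :+ (p :- b) := p) ≈-refl b p) ⟩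
          p + α * i * (q - p)                         ∎

      direction-cramer : det u v • l ≋ det l v • u ⊹ (- det l u) • v
      direction-cramer = e (proj₁ (cramer l u v)) , e (proj₂ (cramer l u v))
        where
        e : ∀ {z z₁ z₂} → det u v * z + det v l * z₁ + det l u * z₂ ≈ 0# → det u v * z ≈ det l v * z₁ + - det l u * z₂
        e {z} {z₁} {z₂} h = begin
          det u v * z                         ≈⟨ solve 6 (λ a b c z z₁ z₂ → a :* z := (a :* z :+ b :* z₁ :+ c :* z₂) :+ ((:- b) :* z₁ :+ (:- c) :* z₂)) ≈-refl (det u v) (det v l) (det l u) z z₁ z₂ ⟩
          (det u v * z + det v l * z₁ + det l u * z₂) + (- det v l * z₁ + - det l u * z₂) ≈⟨ +-cong h (+-congʳ (*-congʳ (sym (det-swap l v)))) ⟩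
          0# + (det l v * z₁ + - det l u * z₂) ≈⟨ +-identityˡ _ ⟩
          det l v * z₁ + - det l u * z₂        ∎

      segment-det : det l (q ⊖ p) ≈ det l v - det l u
      segment-det = solve 8 (λ a b p₁ p₂ q₁ q₂ b₁ b₂ → a :* (q₂ :- p₂) :- b :* (q₁ :- p₁)
          := (a :* (q₂ :- b₂) :- b :* (q₁ :- b₁)) :- (a :* (p₂ :- b₂) :- b :* (p₁ :- b₁)))
        ≈-refl (x l) (y l) (x p) (y p) (x q) (y q) (x b) (y b)

    rayCrosses-crosses : ¬ (det l u ≈ 0#) → ¬ (det l v ≈ 0#) → does (rayCrosses? b l p q) ≡ crosses u v
    rayCrosses-crosses u≉0 v≉0 rewrite left-generic u≉0 | left-generic v≉0
      with signed (det l u) | signed (det l v)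
    ... | null h     | _          = contradiction h u≉0
    ... | negative _ | null h     = contradiction h v≉0
    ... | positive _ | null h     = contradiction h v≉0
    ... | positive h | positive k
      rewrite dec-true (positive? (det l u)) h | dec-true (positive? (det l v)) k
      -- Testing with `l` annihilates the ray and leaves a convex combination of two values of the
      -- same sign.
      = dec-false (rayCrosses? b l p q) λ (_ , X , on , on′) →
          let (t , w , 0<t , 0≤w , 0≤w′ , f) = convex on on′ in
          pos⇒≉0 (convex-pos 0≤w 0≤w′ h k) (trans (sym (f l)) (trans (*-congˡ (det-self l)) (zeroʳ t)))
    ... | negative h | negative k
      rewrite dec-false (positive? (det l u)) (λ r → pos-≁-neg r h) | dec-false (positive? (det l v)) (λ r → pos-≁-neg r k)
      = dec-false (rayCrosses? b l p q) λ (_ , X , on , on′) →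
          let (t , w , 0<t , 0≤w , 0≤w′ , f) = convex on on′ in
          pos⇒≉0 (convex-pos 0≤w 0≤w′ h k) (begin
            (1# - w) * - det l u + w * - det l v   ≈⟨ solve 4 (λ a b c d → a :* (:- b) :+ c :* (:- d) := :- (a :* b :+ c :* d)) ≈-refl (1# - w) (det l u) w (det l v) ⟩
            - ((1# - w) * det l u + w * det l v)   ≈⟨ -‿cong (trans (sym (f l)) (trans (*-congˡ (det-self l)) (zeroʳ t))) ⟩
            - 0#                                   ≈⟨ -0#≈0# ⟩
            0#                                     ∎)
    ... | negative h | positive k
      rewrite dec-false (positive? (det l u)) (λ r → pos-≁-neg r h) | dec-true (positive? (det l v)) k
      = does-⇔ (mk⇔
        (λ (_ , X , on , on′) →
          let (t , w , 0<t , 0≤w , 0≤w′ , f) = convex on on′ in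
          -- Testing with `u` removes its own contribution and leaves the sign of `det u v`.
          nonneg-cancelˡ 0≤w (pos-resp (begin
            t * det u l                            ≈⟨ f u ⟩
            (1# - w) * det u u + w * det u v       ≈⟨ +-congʳ (trans (*-congˡ (det-self u)) (zeroʳ _)) ⟩
            0# + w * det u v                       ≈⟨ +-identityˡ _ ⟩
            w * det u v                            ∎) (*-pos 0<t (pos-resp (sym (det-swap u l)) h))))
        (λ 0<uv → (λ D≈0 → pos⇒≉0 (pos-+ k h) (trans (sym segment-det) D≈0)) ,
          meet h k 0<uv direction-cramer))
        (rayCrosses? b l p q) (positive? (det u v))
    ... | positive h | negative k
      rewrite dec-true (positive? (det l u)) h | dec-false (positive? (det l v)) (λ r → pos-≁-neg r k)
      = does-⇔ (mk⇔
        (λ (_ , X , on , on′) →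
          let (t , w , 0<t , 0≤w , 0≤w′ , f) = convex on on′ in
          nonneg-cancelˡ 0≤w′ (pos-resp (begin
            t * det v l                            ≈⟨ f v ⟩
            (1# - w) * det v u + w * det v v       ≈⟨ +-congˡ (trans (*-congˡ (det-self v)) (zeroʳ _)) ⟩
            (1# - w) * det v u + 0#                ≈⟨ +-identityʳ _ ⟩
            (1# - w) * det v u                     ∎) (*-pos 0<t (pos-resp (sym (det-swap v l)) k))))
        (λ 0<vu → (λ D≈0 → pos⇒≉0 (pos-+ h k) (begin
            det l u - det l v     ≈⟨ solve 2 (λ a b → a :- b := :- (b :- a)) ≈-refl _ _ ⟩
            - (det l v - det l u) ≈⟨ -‿cong (trans (sym segment-det) D≈0) ⟩
            - 0#                  ≈⟨ -0#≈0# ⟩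
            0#                    ∎)) ,
          meet h k 0<vu (flipped direction-cramer)))
        (rayCrosses? b l p q) (positive? (det v u))
      where
      flipped : det u v • l ≋ det l v • u ⊹ (- det l u) • v → det v u • l ≋ (- det l v) • u ⊹ det l u • v
      flipped (h , h′) = e h , e h′
        where
        e : ∀ {z z₁ z₂} → det u v * z ≈ det l v * z₁ + - det l u * z₂ → det v u * z ≈ - det l v * z₁ + det l u * z₂
        e {z} {z₁} {z₂} h = begin
          det v u * z                          ≈⟨ *-congʳ (det-swap v u) ⟩
          - det u v * z                        ≈⟨ solve 2 (λ a z → (:- a) :* z := :- (a :* z)) ≈-refl _ _ ⟩
          - (det u v * z)                      ≈⟨ -‿cong h ⟩
          - (det l v * z₁ + - det l u * z₂)    ≈⟨ solve 4 (λ a b c d → :- (a :* b :+ (:- c) :* d) := (:- a) :* b :+ c :* d) ≈-refl _ _ _ _ ⟩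
          - det l v * z₁ + det l u * z₂        ∎

    -- Along a segment starting at `b` the only candidate is `b` itself, which the ray omits. This
    -- agrees with `crosses-𝟎ˡ`, so an edge at a source fits the general count.
    rayCrosses-start : p ≋ b → does (rayCrosses? b l p q) ≡ false
    rayCrosses-start (h₁ , h₂) = dec-false (rayCrosses? b l p q) λ (D≉0 , X , on , on′) →
      let (t , w , 0<t , 0≤w , 0≤w′ , f) = convex on on′
          u≈0 = λ z → trans (det-cong (≋-refl {z}) (trans (+-congʳ h₁) (-‿inverseʳ _) , trans (+-congʳ h₂) (-‿inverseʳ _)))
                      (solve 2 (λ a b → a :* con 0ℤ :- b :* con 0ℤ := con 0ℤ) ≈-refl (x z) (y z))
          collapse : ∀ z → t * det z l ≈ w * det z v
          collapse z = trans (f z) (trans (+-congʳ (trans (*-congˡ (u≈0 z)) (zeroʳ _))) (+-identityˡ _))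
          lv≉0 = λ (lv≈0 : det l v ≈ 0#) → D≉0 (trans segment-det (trans (+-cong lv≈0 (-‿cong (u≈0 l))) (-‿inverseʳ 0#)))
          w≈0 = ≉0-* lv≉0 (trans (*-comm _ _) (trans (sym (collapse l)) (trans (*-congˡ (det-self l)) (zeroʳ t))))
      in pos⇒≉0 (*-pos 0<t inward) (begin
        t * - det axis l      ≈⟨ solve 2 (λ a b → a :* (:- b) := :- (a :* b)) ≈-refl _ _ ⟩
        - (t * det axis l)    ≈⟨ -‿cong (trans (collapse axis) (trans (*-congʳ w≈0) (zeroˡ _))) ⟩
        - 0#                  ≈⟨ -0#≈0# ⟩
        0#                    ∎)

-- Rotating the ray from one direction to another

module Rotation {c ℓ₁ ℓ₂} (K : OrderedField c ℓ₁ ℓ₂) (axis l l′ : Plane.Vec² K)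
  (inward  : OrderedField._<_ K (OrderedField.0# K) (OrderedField.-_ K (Plane.det K axis l)))
  (inward′ : OrderedField._<_ K (OrderedField.0# K) (OrderedField.-_ K (Plane.det K axis l′))) where
  open OrderedField K
  open OrderedFieldProperties K
  open PlaneProperties K
  open Vec²
  private
    module L  = RayCrossings K axis l inward
    module L′ = RayCrossings K axis l′ inward′

  private
    isPositive-* : ∀ {z w} → ¬ (z ≈ 0#) → ¬ (w ≈ 0#) → isPositive (z * w) ≡ not (isPositive z xor isPositive w)
    isPositive-* {z} {w} z≉0 w≉0 with signed z | signed w
    ... | null h     | _          = contradiction h z≉0
    ... | negative _ | null h     = contradiction h w≉0
    ... | positive _ | null h     = contradiction h w≉0
    ... | positive h | positive k
      rewrite dec-true (positive? z) h | dec-true (positive? w) k = dec-true (positive? _) (*-pos h k)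
    ... | negative h | negative k
      rewrite dec-false (positive? z) (λ r → pos-≁-neg r h) | dec-false (positive? w) (λ r → pos-≁-neg r k) =
      dec-true (positive? _) (pos-resp (solve 2 (λ z w → (:- z) :* (:- w) := z :* w) ≈-refl z w) (*-pos h k))
    ... | positive h | negative k
      rewrite dec-true (positive? z) h | dec-false (positive? w) (λ r → pos-≁-neg r k) =
      dec-false (positive? _) (λ r → pos-≁-neg r (pos-resp (solve 2 (λ z w → z :* (:- w) := :- (z :* w)) ≈-refl z w) (*-pos h k)))
    ... | negative h | positive k
      rewrite dec-false (positive? z) (λ r → pos-≁-neg r h) | dec-true (positive? w) k =
      dec-false (positive? _) (λ r → pos-≁-neg r (pos-resp (solve 2 (λ z w → (:- z) :* w := :- (z :* w)) ≈-refl z w) (*-pos h k)))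

    isPositive-+ : ∀ {z w} → ¬ (z ≈ 0#) → ¬ (w ≈ 0#) → isPositive z ≡ isPositive w → isPositive (z + w) ≡ isPositive z
    isPositive-+ {z} {w} z≉0 w≉0 same with signed z | signed w
    ... | null h     | _          = contradiction h z≉0
    ... | negative _ | null h     = contradiction h w≉0
    ... | positive _ | null h     = contradiction h w≉0
    ... | positive h | positive k rewrite dec-true (positive? z) h = dec-true (positive? _) (pos-+ h k)
    ... | negative h | negative k
      rewrite dec-false (positive? z) (λ r → pos-≁-neg r h) = dec-false (positive? _) λ r →
        pos-≁-neg r (pos-resp (solve 2 (λ z w → :- z :+ :- w := :- (z :+ w)) ≈-refl z w) (pos-+ h k))
    ... | positive h | negative k = contradiction
      (≡.trans (≡.sym (dec-true (positive? z) h)) (≡.trans same (dec-false (positive? w) (λ r → pos-≁-neg r k)))) λ ()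
    ... | negative h | positive k = contradiction
      (≡.trans (≡.sym (dec-true (positive? w) k)) (≡.trans (≡.sym same) (dec-false (positive? z) (λ r → pos-≁-neg r h)))) λ ()

    isPositive-neg : ∀ {z} → ¬ (z ≈ 0#) → isPositive (- z) ≡ not (isPositive z)
    isPositive-neg {z} z≉0 with signed z
    ... | null h     = contradiction h z≉0
    ... | positive h rewrite dec-true (positive? z) h = dec-false (positive? _) (pos-≁-neg h)
    ... | negative h rewrite dec-false (positive? z) (λ r → pos-≁-neg r h) = dec-true (positive? _) h

    *-≉0 : ∀ {z w} → ¬ (z ≈ 0#) → ¬ (w ≈ 0#) → ¬ (z * w ≈ 0#)
    *-≉0 z≉0 w≉0 h = w≉0 (≉0-* z≉0 h)

    sgn-≟ : ∀ {z w} → ¬ (z ≈ 0#) → ¬ (w ≈ 0#) → does (sgn z ℤ.≟ sgn w) ≡ not (isPositive z xor isPositive w)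
    sgn-≟ {z} {w} z≉0 w≉0 with signed z | signed w
    ... | null h     | _          = contradiction h z≉0
    ... | negative _ | null h     = contradiction h w≉0
    ... | positive _ | null h     = contradiction h w≉0
    ... | positive h | positive k
      rewrite dec-true (positive? z) h | dec-true (positive? w) k | sgn-pos h | sgn-pos k = ≡.refl
    ... | negative h | negative k
      rewrite dec-false (positive? z) (λ r → pos-≁-neg r h) | dec-false (positive? w) (λ r → pos-≁-neg r k) | sgn-neg h | sgn-neg k = ≡.refl
    ... | positive h | negative k
      rewrite dec-true (positive? z) h | dec-false (positive? w) (λ r → pos-≁-neg r k) | sgn-pos h | sgn-neg k = ≡.refl
    ... | negative h | positive k
      rewrite dec-false (positive? z) (λ r → pos-≁-neg r h) | dec-true (positive? w) k | sgn-neg h | sgn-pos k = ≡.refl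

    sgn-≢0 : ∀ {z} → ¬ (z ≈ 0#) → sgn z ≢ 0ℤ
    sgn-≢0 {z} z≉0 e with compare z 0#
    sgn-≢0 {z} z≉0 () | tri< _ _ _
    sgn-≢0 {z} z≉0 e  | tri≈ _ h _ = z≉0 h
    sgn-≢0 {z} z≉0 () | tri> _ _ _

  inAngle-formula : ∀ {m} → ¬ (det l l′ ≈ 0#) → ¬ (det l m ≈ 0#) → ¬ (det l′ m ≈ 0#) →
    does (inAngle? l l′ m) ≡ not (isPositive (det l m) xor isPositive (det l l′)) ∧ (isPositive (det l′ m) xor isPositive (det l l′))
  inAngle-formula {m} ll′≉0 lm≉0 l′m≉0 = cong₂ _∧_ (cong not (dec-false (s l l′ ℤ.≟ 0ℤ) (sgn-≢0 ll′≉0)))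
    (cong₂ _∧_ (sgn-≟ lm≉0 ll′≉0) (≡.trans (sgn-≟ ml′≉0 ll′≉0)
      (≡.trans (cong (λ b → not (b xor isPositive (det l l′))) (≡.trans (isPositive-cong (det-swap m l′)) (isPositive-neg l′m≉0)))
        (not-not-xor (isPositive (det l′ m)) (isPositive (det l l′))))))
    where
    ml′≉0 : ¬ (det m l′ ≈ 0#)
    ml′≉0 h = l′m≉0 (-≈0⁻¹ (trans (sym (det-swap m l′)) h))
    not-not-xor : ∀ a b → not (not a xor b) ≡ a xor b
    not-not-xor = from-yes (∀ᵇ? λ a → ∀ᵇ? λ b → not (not a xor b) Bool.≟ a xor b)

  private
    crosses-bool : Bool → Bool → Bool → Bool
    crosses-bool a b p = (a xor b) ∧ (p xor a)

    if-bool : ∀ a b p → (if a then not b ∧ not p else b ∧ p) ≡ crosses-bool a b p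
    if-bool = from-yes (∀ᵇ? λ a → ∀ᵇ? λ b → ∀ᵇ? λ p → (if a then not b ∧ not p else b ∧ p) Bool.≟ crosses-bool a b p)

    angle-bool : Bool → Bool → Bool → Bool
    angle-bool a c q = not (a xor q) ∧ (c xor q)

    if-cong : ∀ {a a′ b b′ p n} → a ≡ a′ → b ≡ b′ → n ≡ not p →
              (if a then not b ∧ n else b ∧ p) ≡ crosses-bool a′ b′ p
    if-cong {a} {b = b} {p = p} ≡.refl ≡.refl ≡.refl = if-bool a b p

    -- `a`, `b` are the sides of `u`, `v` for `l`, and `c`, `d` those for `l′`; `p` and `q` are the
    -- signs of `det u v` and `det l l′`. The hypothesis is what the Plücker relation `relation`
    -- says about signs: two summands of equal sign determine the sign of their sum.
    rotation-bool : ∀ a b c d p q → (not (a xor d) ≡ b xor c → not (p xor q) ≡ not (a xor d)) →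
                    crosses-bool a b p xor crosses-bool c d p ≡ angle-bool a c q xor angle-bool b d q
    rotation-bool = from-yes (∀ᵇ? λ a → ∀ᵇ? λ b → ∀ᵇ? λ c → ∀ᵇ? λ d → ∀ᵇ? λ p → ∀ᵇ? λ q →
      ((not (a xor d) Bool.≟ b xor c) →-dec (not (p xor q) Bool.≟ not (a xor d))) →-dec
      (crosses-bool a b p xor crosses-bool c d p Bool.≟ angle-bool a c q xor angle-bool b d q))

    -- Parallel directions that are both inward are positive multiples of each other.
    sides : ∀ {m} → det l l′ ≈ 0# → isPositive (det l m) ≡ isPositive (det l′ m)
    sides {m} ll′≈0 = does-⇔ (mk⇔ (λ h → pos-cancelˡ inward (pos-resp e (*-pos inward′ h)))
                                  (λ h → pos-cancelˡ inward′ (pos-resp (sym e) (*-pos inward h))))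
                        (positive? (det l m)) (positive? (det l′ m))
      where
      e : - det axis l′ * det l m ≈ - det axis l * det l′ m
      e = trans (solve 8 (λ a b c d e f g h →
                (:- (a :* f :- b :* e)) :* (c :* h :- d :* g) :=
                (:- (a :* d :- b :* c)) :* (e :* h :- f :* g) :+ (:- (c :* f :- d :* e)) :* (a :* h :- b :* g))
              ≈-refl (x axis) (y axis) (x l) (y l) (x l′) (y l′) (x m) (y m))
            (trans (+-congˡ (trans (*-congʳ (-‿cong ll′≈0)) (solve 1 (λ z → (:- con 0ℤ) :* z := con 0ℤ) ≈-refl _))) (+-identityʳ _))

    reversed : ∀ {u v} → ¬ (det u v ≈ 0#) → isPositive (det v u) ≡ not (isPositive (det u v))
    reversed {u} {v} uv≉0 = ≡.trans (isPositive-cong (det-swap v u)) (isPositive-neg uv≉0)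

  module _ {u v} (u≉0 : ¬ (det l u ≈ 0#)) (v≉0 : ¬ (det l v ≈ 0#))
           (u≉0′ : ¬ (det l′ u ≈ 0#)) (v≉0′ : ¬ (det l′ v ≈ 0#)) (apart : Apart₂ u v) where
    private
      formula : ¬ (det u v ≈ 0#) → L.crosses u v ≡ crosses-bool (isPositive (det l u)) (isPositive (det l v)) (isPositive (det u v))
      formula uv≉0 = if-cong (L.left-generic u≉0) (L.left-generic v≉0) (reversed uv≉0)

      formula′ : ¬ (det u v ≈ 0#) → L′.crosses u v ≡ crosses-bool (isPositive (det l′ u)) (isPositive (det l′ v)) (isPositive (det u v))
      formula′ uv≉0 = if-cong (L′.left-generic u≉0′) (L′.left-generic v≉0′) (reversed uv≉0)

      relation : det u v * det l l′ ≈ det l u * det l′ v + - (det l v * det l′ u)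
      relation = solve 8 (λ a b c d e f g h →
          (e :* h :- f :* g) :* (a :* d :- b :* c) :=
          (a :* f :- b :* e) :* (c :* h :- d :* g) :+ (:- ((a :* h :- b :* g) :* (c :* f :- d :* e))))
        ≈-refl (x l) (y l) (x l′) (y l′) (x u) (y u) (x v) (y v)

      constraint : ¬ (det u v ≈ 0#) → ¬ (det l l′ ≈ 0#) →
                   not (isPositive (det l u) xor isPositive (det l′ v)) ≡ isPositive (det l v) xor isPositive (det l′ u) →
                   not (isPositive (det u v) xor isPositive (det l l′)) ≡ not (isPositive (det l u) xor isPositive (det l′ v))
      constraint uv≉0 ll′≉0 same = begin
        not (isPositive (det u v) xor isPositive (det l l′))  ≡⟨ isPositive-* uv≉0 ll′≉0 ⟨
        isPositive (det u v * det l l′)                     ≡⟨ isPositive-cong relation ⟩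
        isPositive (det l u * det l′ v + - (det l v * det l′ u))
          ≡⟨ isPositive-+ (*-≉0 u≉0 v≉0′) (*-≉0 v≉0 u≉0′ ∘ -≈0⁻¹)
               (≡.trans (isPositive-* u≉0 v≉0′) (≡.trans same (≡.sym (≡.trans (isPositive-neg (*-≉0 v≉0 u≉0′))
                 (≡.trans (cong not (isPositive-* v≉0 u≉0′)) (Bool.not-involutive _)))))) ⟩
        isPositive (det l u * det l′ v)                     ≡⟨ isPositive-* u≉0 v≉0′ ⟩
        not (isPositive (det l u) xor isPositive (det l′ v))  ∎
        where open ≡.≡-Reasoning

    crosses-rotation : L.crosses u v xor L′.crosses u v ≡ does (inAngle? l l′ u) xor does (inAngle? l l′ v)
    crosses-rotation = go (det l l′ ≟ 0#) (det u v ≟ 0#)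
      where
      go : Dec (det l l′ ≈ 0#) → Dec (det u v ≈ 0#) → L.crosses u v xor L′.crosses u v ≡ does (inAngle? l l′ u) xor does (inAngle? l l′ v)
      go (yes ll′≈0) _ = ≡.trans (≡.trans (cong (_xor L′.crosses u v) same) (Bool.xor-same (L′.crosses u v)))
                           (≡.sym (cong₂ _xor_ (outside u) (outside v)))
        where
        outside : ∀ m → does (inAngle? l l′ m) ≡ false
        outside m = dec-false (inAngle? l l′ m) λ (≢0 , _) → ≢0 (sgn-zero ll′≈0)
        same : L.crosses u v ≡ L′.crosses u v
        same = cong₂ (λ a b → if a then not b ∧ isPositive (det v u) else b ∧ isPositive (det u v))
          (≡.trans (L.left-generic u≉0) (≡.trans (sides ll′≈0) (≡.sym (L′.left-generic u≉0′))))
          (≡.trans (L.left-generic v≉0) (≡.trans (sides ll′≈0) (≡.sym (L′.left-generic v≉0′))))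
      -- Here `det u v` has no sign, but parallel vectors that are apart point the same way: neither
      -- ray is crossed, and the angle contains both or none.
      go (no ll′≉0) (yes uv≈0) = ≡.trans (cong₂ _xor_ (L.crosses-same-side same) (L′.crosses-same-side same′))
        (≡.sym (≡.trans (cong (_xor does (inAngle? l l′ v)) angle) (Bool.xor-same (does (inAngle? l l′ v)))))
        where
        same  = L.parallel-sides apart uv≈0
        same′ = L′.parallel-sides apart uv≈0
        angle : does (inAngle? l l′ u) ≡ does (inAngle? l l′ v)
        angle = ≡.trans (inAngle-formula ll′≉0 u≉0 u≉0′) (≡.trans
          (cong₂ (λ a c → angle-bool a c (isPositive (det l l′)))
            (≡.trans (≡.sym (L.left-generic u≉0)) (≡.trans same (L.left-generic v≉0)))
            (≡.trans (≡.sym (L′.left-generic u≉0′)) (≡.trans same′ (L′.left-generic v≉0′))))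
          (≡.sym (inAngle-formula ll′≉0 v≉0 v≉0′)))
      go (no ll′≉0) (no uv≉0) = ≡.trans (cong₂ _xor_ (formula uv≉0) (formula′ uv≉0)) (≡.trans
        (rotation-bool (isPositive (det l u)) (isPositive (det l v)) (isPositive (det l′ u)) (isPositive (det l′ v))
          (isPositive (det u v)) (isPositive (det l l′)) (constraint uv≉0 ll′≉0))
        (≡.sym (cong₂ _xor_ (inAngle-formula ll′≉0 u≉0 u≉0′) (inAngle-formula ll′≉0 v≉0 v≉0′))))

  private
    angle-relation : ∀ m → - det axis l * det m l′ + - det axis l′ * det l m ≈ det l l′ * - det axis m
    angle-relation m = solve 8 (λ a b c d e f g h →
          (:- (a :* d :- b :* c)) :* (g :* f :- h :* e) :+ (:- (a :* f :- b :* e)) :* (c :* h :- d :* g)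
            := (c :* f :- d :* e) :* (:- (a :* h :- b :* g)))
        ≈-refl (x axis) (y axis) (x l) (y l) (x l′) (y l′) (x m) (y m)

  -- `angle-relation` writes `det l l′` times `- det axis m` as a sum of two terms, both with the
  -- sign of `det l l′`.
  inAngle⇒inward : ∀ {m} → InAngle l l′ m → 0# < - det axis m
  inAngle⇒inward {m} (≢0 , p , q) with signed (det l l′)
  ... | null h = contradiction (sgn-zero h) ≢0
  ... | positive h = pos-cancelˡ h (pos-resp (angle-relation m)
      (pos-+ (*-pos inward (sgn⁻-pos (≡.trans q (sgn-pos h)))) (*-pos inward′ (sgn⁻-pos (≡.trans p (sgn-pos h))))))
  ... | negative h = pos-cancelˡ h (pos-resp (trans
      (solve 4 (λ a b c d → (:- a) :* (:- b) :+ (:- c) :* (:- d) := :- ((:- a) :* b :+ (:- c) :* d)) ≈-refl _ _ _ _)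
      (trans (-‿cong (angle-relation m)) (solve 2 (λ a b → :- (a :* b) := (:- a) :* b) ≈-refl _ _)))
      (pos-+ (*-pos inward (sgn⁻-neg (≡.trans q (sgn-neg h)))) (*-pos inward′ (sgn⁻-neg (≡.trans p (sgn-neg h))))))

-- Counting modulo 2

odd-+ : ∀ m n → odd (m ℕ.+ n) ≡ odd m xor odd n
odd-+ zero    n = ≡.refl
odd-+ (suc m) n = ≡.trans (cong not (odd-+ m n)) (Bool.not-distribˡ-xor (odd m) (odd n))

odd-∣⊖∣ : ∀ m n → odd ∣ m ℤ.⊖ n ∣ ≡ odd m xor odd n
odd-∣⊖∣ m       zero    = ≡.sym (Bool.xor-identityʳ (odd m))
odd-∣⊖∣ zero    (suc n) = ≡.refl
odd-∣⊖∣ (suc m) (suc n) = begin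
  odd ∣ suc m ℤ.⊖ suc n ∣         ≡⟨ cong (odd ∘ ∣_∣) (ℤ.[1+m]⊖[1+n]≡m⊖n m n) ⟩
  odd ∣ m ℤ.⊖ n ∣                 ≡⟨ odd-∣⊖∣ m n ⟩
  odd m xor odd n                 ≡⟨ not-xor-not (odd m) (odd n) ⟨
  not (odd m) xor not (odd n)     ∎
  where
  open ≡.≡-Reasoning
  not-xor-not : ∀ a b → not a xor not b ≡ a xor b
  not-xor-not true  b = ≡.refl
  not-xor-not false b = Bool.not-involutive b

odd-∣+∣ : ∀ i j → odd ∣ i ℤ.+ j ∣ ≡ odd ∣ i ∣ xor odd ∣ j ∣
odd-∣+∣ (+ m)    (+ n)    = odd-+ m n
odd-∣+∣ (+ m)    -[1+ n ] = odd-∣⊖∣ m (suc n)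
odd-∣+∣ -[1+ m ] (+ n)    = ≡.trans (odd-∣⊖∣ n (suc m)) (Bool.xor-comm (odd n) _)
odd-∣+∣ -[1+ m ] -[1+ n ] = ≡.trans (cong (odd ∘ suc) (≡.sym (ℕ.+-suc m n))) (odd-+ (suc m) (suc n))

⨁ : ∀ {a} {A : Set a} → List A → (A → Bool) → Bool
⨁ xs f = foldr (λ x b → f x xor b) false xs

module _ {a} {A : Set a} where
  ⨁-cong : ∀ {xs : List A} {f g} → All (λ x → f x ≡ g x) xs → ⨁ xs f ≡ ⨁ xs g
  ⨁-cong []       = ≡.refl
  ⨁-cong (p ∷ ps) = cong₂ _xor_ p (⨁-cong ps)

  ⨁-false : ∀ {xs : List A} {f} → All (λ x → f x ≡ false) xs → ⨁ xs f ≡ false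
  ⨁-false []       = ≡.refl
  ⨁-false (p ∷ ps) = cong₂ _xor_ p (⨁-false ps)

  ⨁-++ : ∀ (xs ys : List A) f → ⨁ (xs ++ ys) f ≡ ⨁ xs f xor ⨁ ys f
  ⨁-++ []       ys f = ≡.refl
  ⨁-++ (x ∷ xs) ys f = ≡.trans (cong (f x xor_) (⨁-++ xs ys f)) (≡.sym (Bool.xor-assoc (f x) _ _))

  ⨁-ʳ++ : ∀ (xs ys : List A) f → ⨁ (xs List.ʳ++ ys) f ≡ ⨁ xs f xor ⨁ ys f
  ⨁-ʳ++ []       ys f = ≡.refl
  ⨁-ʳ++ (x ∷ xs) ys f = ≡.trans (⨁-ʳ++ xs (x ∷ ys) f)
    (solve 3 (λ a b c → b :+ (a :+ c) := (a :+ b) :+ c) ≡.refl (f x) (⨁ xs f) (⨁ ys f))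
    where open xor-∧-Solver

  ⨁-xor : ∀ (xs : List A) f g → ⨁ xs (λ x → f x xor g x) ≡ ⨁ xs f xor ⨁ xs g
  ⨁-xor []       f g = ≡.refl
  ⨁-xor (x ∷ xs) f g = ≡.trans (cong ((f x xor g x) xor_) (⨁-xor xs f g))
    (solve 4 (λ a b c d → (a :+ b) :+ (c :+ d) := (a :+ c) :+ (b :+ d)) ≡.refl (f x) (g x) (⨁ xs f) (⨁ xs g))
    where open xor-∧-Solver

  odd-length-filter : ∀ {p} {P : Pred A p} (P? : Decidable P) xs → odd (length (filter P? xs)) ≡ ⨁ xs (does ∘ P?)
  odd-length-filter P? [] = ≡.refl
  odd-length-filter P? (x ∷ xs) with P? x
  ... | yes _ = cong not (odd-length-filter P? xs)
  ... | no  _ = odd-length-filter P? xs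

⨁-swap : ∀ {a b} {A : Set a} {B : Set b} (xs : List A) (ys : List B) (f : A → B → Bool) →
         ⨁ xs (λ x → ⨁ ys (f x)) ≡ ⨁ ys (λ y → ⨁ xs (λ x → f x y))
⨁-swap []       ys f = ≡.sym (⨁-false {xs = ys} (All.universal (λ _ → ≡.refl) ys))
⨁-swap (x ∷ xs) ys f = ≡.trans (cong (⨁ ys (f x) xor_) (⨁-swap xs ys f)) (≡.sym (⨁-xor ys (f x) (λ y → ⨁ xs (λ x′ → f x′ y))))

⨁-allFin-single : ∀ {m} (r : Fin m) {f} → (∀ s → s ≢ r → f s ≡ false) → ⨁ (allFin m) f ≡ f r
⨁-allFin-single {suc m} Fin.zero {f} off = ≡.trans (cong (f Fin.zero xor_) (rest (λ i → off (Fin.suc i) λ ()))) (Bool.xor-identityʳ _)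
  where
  rest : ∀ {m} {h : Fin m → Fin (suc _)} → (∀ i → f (h i) ≡ false) → ⨁ (tabulate h) f ≡ false
  rest {zero}  z = ≡.refl
  rest {suc m} z = cong₂ _xor_ (z Fin.zero) (rest (z ∘ Fin.suc))
⨁-allFin-single {suc m} (Fin.suc r) {f} off = ≡.trans (cong (_xor ⨁ (tabulate Fin.suc) f) (off Fin.zero λ ()))
  (≡.trans (reindex id) (⨁-allFin-single r λ s s≢r → off (Fin.suc s) λ { ≡.refl → s≢r ≡.refl }))
  where
  reindex : ∀ {l} (h : Fin l → Fin m) → ⨁ (tabulate (Fin.suc ∘ h)) f ≡ ⨁ (tabulate h) (f ∘ Fin.suc)
  reindex {zero}  h = ≡.refl
  reindex {suc l} h = cong (f (Fin.suc (h Fin.zero)) xor_) (reindex (h ∘ Fin.suc))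

odd-count : ∀ {m p} {P : Pred (Fin m) p} (P? : Decidable P) → odd (count P?) ≡ ⨁ (allFin m) (does ∘ P?)
odd-count P? = odd-length-filter P? (allFin _)

module _ {m p} {P : Pred (Fin m) p} (P? : Decidable P) where
  private
    listed : ∀ {x} → P x → x ∈ filter P? (allFin m)
    listed px = ∈-filter⁺ P? (∈-allFin _) px

  count-positive : ∀ {x} → P x → 1 ℕ.≤ count P?
  count-positive px with filter P? (allFin m) | listed px
  ... | _ ∷ _ | _ = ℕ.s≤s ℕ.z≤n

  count-unique : count P? ℕ.≤ 1 → ∀ {x y} → P x → P y → x ≡ y
  count-unique le px py with filter P? (allFin m) | listed px | listed py
  ... | _ ∷ []    | here ≡.refl | here ≡.refl = ≡.refl
  ... | _ ∷ _ ∷ _ | _ | _ = contradiction le λ { (ℕ.s≤s ()) }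

-- Edges at boundary, white and black vertices

module GraphProperties {k n} (G : PlabicGraph k n) where
  open PlabicGraph G

  private
    out : ∀ v → Decidable (λ e → source e ≡ v)
    out v e = source e ≟ᵛ v

    into : ∀ v → Decidable (λ e → target e ≡ v)
    into v e = target e ≟ᵛ v

  -- An incoming and an outgoing edge would give the vertex degree two.
  boundary-impassable : ∀ {i e f} → target e ≡ boundary i → source f ≢ boundary i
  boundary-impassable {i} te sf = ℕ.<-irrefl (≡.sym (boundary-degree i))
    (ℕ.+-mono-≤ (count-positive (out (boundary i)) sf) (count-positive (into (boundary i)) te))

  boundary-source-unique : ∀ {i e f} → source e ≡ boundary i → source f ≡ boundary i → e ≡ f
  boundary-source-unique {i} = count-unique (out (boundary i))
    (ℕ.≤-trans (ℕ.m≤m+n _ _) (ℕ.≤-reflexive (boundary-degree i)))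

  pivot-edge : ∀ r → ∃[ e ] source e ≡ boundary (pivot r)
  pivot-edge r = Equivalence.to (pivot-source (pivot r)) (r , ≡.refl)

  target≢pivot : ∀ {r} e → target e ≢ boundary (pivot r)
  target≢pivot {r} e te = boundary-impassable te (proj₂ (pivot-edge r))

  -- At a white vertex the incoming edges `a` and `d` coincide, at a black one the outgoing edges
  -- `b` and `c`. This is what makes rewiring harmless in `turn-exchange`.
  passages : ∀ {a b c d} → target a ≡ source b → target a ≡ source c → target d ≡ source b → a ≡ d ⊎ b ≡ c
  passages {a} {b} {c} {d} ab ac db with target a in eq
  ... | boundary i = contradiction (≡.sym ab) (boundary-impassable {e = a} eq)
  ... | internal v with colour v in col
  ...   | white = inj₁ (count-unique (into (internal v)) (ℕ.≤-reflexive (white-indegree v col)) eq (≡.trans db (≡.sym ab)))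
  ...   | black = inj₂ (count-unique (out (internal v)) (ℕ.≤-reflexive (black-outdegree v col)) (≡.sym ab) (≡.sym ac))

-- Consequences of planarity and of the half plane

module NetworkGeometry {c ℓ₁ ℓ₂} (K : OrderedField c ℓ₁ ℓ₂) {k n : ℕ} (N : Networks.PlabicNetwork K k n) where
  open OrderedField K
  open OrderedFieldProperties K
  open PlaneProperties K public
  open Networks K using (module PlabicNetwork; GaugeDirection; module GaugeDirection)
  open PlabicNetwork N public
  open GraphProperties graph public
  open Vec²

  source≢target : ∀ e → ¬ (position (target e) ≋ position (source e))
  source≢target e h = no-loops e (≡.sym (distinct h))

  private
    start-on : ∀ p q → OnSegment p q p
    start-on p q = 0# , 0≤-zero , inj₁ 0<1 , e , e
      where
      e : ∀ {z w} → z ≈ z + 0# * w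
      e = sym (trans (+-congˡ (zeroˡ _)) (+-identityʳ _))

    end-on : ∀ p q → OnSegment p q q
    end-on p q = 1# , inj₁ 0<1 , inj₂ ≈-refl , e , e
      where
      e : ∀ {z w} → w ≈ z + 1# * (w - z)
      e {z} {w} = sym (trans (+-congˡ (*-identityˡ _)) (solve 2 (λ z w → z :+ (w :- z) := w) ≈-refl z w))

    vanishing : ∀ {t p q} → ¬ (q ≋ p) → t • (q ⊖ p) ≋ 𝟎 → t ≈ 0#
    vanishing {t} {p} {q} q≉p (h , h′) with t ≟ 0#
    ... | yes t≈0 = t≈0
    ... | no t≉0  = contradiction (𝟎-⊖ (≉0-* t≉0 h , ≉0-* t≉0 h′)) q≉p

    at-start : ∀ {t p q X} → ¬ (q ≋ p) → X ≋ p → X ≋ p ⊹ t • (q ⊖ p) → t ≈ 0#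
    at-start q≉p (a , a′) (h , h′) = vanishing q≉p (e a h , e a′ h′)
      where
      e : ∀ {p X z} → X ≈ p → X ≈ p + z → z ≈ 0#
      e {p} {X} {z} a h = trans (solve 2 (λ p z → z := (p :+ z) :- p) ≈-refl p z)
        (trans (+-congʳ (trans (sym h) a)) (-‿inverseʳ p))

    at-end : ∀ {t p q X} → ¬ (q ≋ p) → X ≋ q → X ≋ p ⊹ t • (q ⊖ p) → 1# - t ≈ 0#
    at-end {t} q≉p (a , a′) (h , h′) = vanishing q≉p (e a h , e a′ h′)
      where
      e : ∀ {p q X} → X ≈ q → X ≈ p + t * (q - p) → (1# - t) * (q - p) ≈ 0#
      e {p} {q} {X} a h = trans (solve 4 (λ o p q t → (o :- t) :* (q :- p) := o :* (q :- p) :- t :* (q :- p)) ≈-refl 1# p q t)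
        (trans (+-congʳ (*-identityˡ _)) (trans (solve 3 (λ p q z → (q :- p) :- z := q :- (p :+ z)) ≈-refl p q (t * (q - p)))
        (trans (+-congˡ (-‿cong (trans (sym h) a))) (-‿inverseʳ q))))

  endpoint-on : ∀ {g v} → EndPoint g v → OnEdge g (position v)
  endpoint-on (inj₁ ≡.refl) = start-on _ _
  endpoint-on (inj₂ ≡.refl) = end-on _ _

  -- `planar` compares edges only, so some edge `g` ending at `v` is needed to bring the vertex in.
  off-edge : ∀ {v f} g → EndPoint g v → ¬ EndPoint f v → ¬ OnEdge f (position v)
  off-edge {v} {f} g end ¬end on =
    let (w , v≋w , _ , end′) = planar (λ { ≡.refl → ¬end end }) (endpoint-on {g} end) on in
    ¬end (≡.subst (EndPoint f) (≡.sym (distinct v≋w)) end′)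

  disjoint-edges : ∀ {e f} → ¬ EndPoint f (source e) → ¬ EndPoint f (target e) →
                   Disjoint (position (source e)) (position (target e)) (position (source f)) (position (target f))
  disjoint-edges {e} {f} ¬s ¬t X on on′ = shared (planar (λ { ≡.refl → ¬s (inj₁ ≡.refl) }) on on′)
    where
    shared : ¬ (∃[ v ] X ≋ position v × EndPoint e v × EndPoint f v)
    shared (_ , _ , inj₁ ≡.refl , end) = ¬s end
    shared (_ , _ , inj₂ ≡.refl , end) = ¬t end

  -- A vanishing combination would mean that `f` runs back over `e`, against planarity.
  consecutive-apart : ∀ {e f} → target e ≡ source f → Apart₂ (vector e) (vector f)
  consecutive-apart {e} {f} te≡sf a b 0≤a 0≤b 0<n (h , h′) = 1≉0 (begin
      1#              ≈⟨ solve 2 (λ o t → o := (o :- t) :+ t) ≈-refl 1# t ⟩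
      (1# - t) + t    ≈⟨ +-cong (proj₂ ends) (proj₁ ends) ⟩
      0# + 0#         ≈⟨ +-identityʳ 0# ⟩
      0#              ∎)
    where
    open import Relation.Binary.Reasoning.Setoid setoid
    i = proj₁ (pos-inverse 0<n)
    ni≈1 = proj₁ (proj₂ (pos-inverse 0<n))
    0<i = proj₂ (proj₂ (pos-inverse 0<n))
    -- Both edges reach `X` at the same parameter `b / (a + b)`: the point on `e` lies as far before
    -- the common vertex as `f` runs back from it.
    t = i * b
    P = position (source e)
    Q = position (target e)
    R = position (target f)
    X = P ⊹ t • (Q ⊖ P)
    0≤t : 0# ≤ t
    0≤t = nonneg-* (inj₁ 0<i) 0≤b
    1-t : i * a ≈ 1# - t
    1-t = trans (solve 3 (λ i a b → i :* a := (a :+ b) :* i :- i :* b) ≈-refl i a b) (+-congʳ ni≈1)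
    t≤1 : t ≤ 1#
    t≤1 = below (nonneg-resp 1-t (nonneg-* (inj₁ 0<i) 0≤a))
      where
      below : 0# ≤ 1# - t → t ≤ 1#
      below (inj₁ p) = inj₁ (0<y-x⇒x<y p)
      below (inj₂ p) = inj₂ (trans (solve 2 (λ o t → t := o :- (o :- t)) ≈-refl 1# t) (trans (+-congˡ (-‿cong (sym p))) (solve 1 (λ o → o :- con 0ℤ := o) ≈-refl 1#)))
    meet : ∀ {p q s r} → q ≈ s → a * (q - p) + b * (r - s) ≈ 0# → p + t * (q - p) ≈ s + t * (r - s)
    meet {p} {q} {s} {r} q≈s h = begin
      p + t * (q - p)
        ≈⟨ solve 5 (λ p q s r t → p :+ t :* (q :- p) := (p :- q) :+ q :+ t :* (q :- p)) ≈-refl p q s r t ⟩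
      (p - q) + q + t * (q - p)
        ≈⟨ +-congʳ (+-congʳ (*-identityˡ _)) ⟨
      1# * (p - q) + q + t * (q - p)
        ≈⟨ +-congʳ (+-congʳ (*-congʳ ni≈1)) ⟨
      (a + b) * i * (p - q) + q + i * b * (q - p)
        ≈⟨ solve 7 (λ i a b p q s r → (a :+ b) :* i :* (p :- q) :+ q :+ i :* b :* (q :- p) := (q :+ i :* b :* (r :- s)) :- i :* (a :* (q :- p) :+ b :* (r :- s))) ≈-refl i a b p q s r ⟩
      (q + t * (r - s)) - i * (a * (q - p) + b * (r - s))
        ≈⟨ +-cong (+-congʳ q≈s) (-‿cong (trans (*-congˡ h) (zeroʳ i))) ⟩
      (s + t * (r - s)) - 0#      ≈⟨ solve 1 (λ z → z :- con 0ℤ := z) ≈-refl _ ⟩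
      s + t * (r - s)             ∎
    Q≋ : Q ≋ position (source f)
    Q≋ = ≡.subst (λ v → Q ≋ position v) te≡sf ≋-refl
    on-f : X ≋ position (source f) ⊹ t • (R ⊖ position (source f))
    on-f = meet (proj₁ Q≋) h , meet (proj₂ Q≋) h′
    e≢f : e ≢ f
    e≢f ≡.refl = no-loops e (≡.sym te≡sf)
    -- Planarity makes `X` an end of both edges. Either it is the common vertex, or `f` returns to
    -- the source of `e`; each forces `t` to be 0 and 1 at once.
    ends : t ≈ 0# × 1# - t ≈ 0#
    ends = meets (planar e≢f (t , 0≤t , t≤1 , ≋-refl) (t , 0≤t , t≤1 , on-f))
      where
      meets : ∃[ v ] X ≋ position v × EndPoint e v × EndPoint f v → t ≈ 0# × 1# - t ≈ 0#
      meets (v , X≋v , inj₂ ≡.refl , _) =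
        at-start (source≢target f) (≋-trans X≋v Q≋) on-f , at-end (source≢target e) X≋v ≋-refl
      meets (v , X≋v , inj₁ ≡.refl , inj₂ tf) =
        at-start (source≢target e) X≋v ≋-refl , at-end (source≢target f) (≋-trans X≋v (≡.subst (λ w → position v ≋ position w) (≡.sym tf) ≋-refl)) on-f
      meets (v , X≋v , inj₁ ≡.refl , inj₁ sf) = contradiction (≡.trans (≡.sym sf) (≡.sym te≡sf)) (no-loops e)

  -- Two straight edges joining the same vertices back and forth have opposite vectors. Hence a loop
  -- to be erased has at least three edges.
  no-digons : ∀ {e f} → target e ≡ source f → target f ≢ source e
  no-digons {e} {f} ef fe = consecutive-apart {e} {f} ef 1# 1# (inj₁ 0<1) (inj₁ 0<1) (pos-+ 0<1 0<1)
    (z (proj₁ p) (proj₁ q) , z (proj₂ p) (proj₂ q))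
    where
    p = ≡.subst (λ v → position (target e) ≋ position v) ef ≋-refl
    q = ≡.subst (λ v → position (target f) ≋ position v) fe ≋-refl
    z : ∀ {a b c d} → b ≈ c → d ≈ a → 1# * (b - a) + 1# * (d - c) ≈ 0#
    z {a} {b} {c} {d} b≈c d≈a = trans (+-cong (*-congˡ (+-cong b≈c (-‿cong (sym d≈a)))) ≈-refl)
      (solve 3 (λ o c d → o :* (c :- d) :+ o :* (d :- c) := con 0ℤ) ≈-refl 1# c d)

  private
    base : Fin n → Vec²
    base i = position (boundary i)

    axis-internal : ∀ i v → det axis (interior v ⊖ base i) ≈ det axis (interior v ⊖ origin)
    axis-internal i v = solve 7 (λ a b o₁ o₂ v₁ v₂ t →
        a :* (v₂ :- (o₂ :+ t :* b)) :- b :* (v₁ :- (o₁ :+ t :* a)) := a :* (v₂ :- o₂) :- b :* (v₁ :- o₁))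
      ≈-refl (x axis) (y axis) (x origin) (y origin) (x (interior v)) (y (interior v)) (coordinate i)

    base-difference : ∀ i j → base j ⊖ base i ≋ (coordinate j - coordinate i) • axis
    base-difference i j = e , e
      where
      e : ∀ {o a t u} → (o + t * a) - (o + u * a) ≈ (t - u) * a
      e {o} {a} {t} {u} = solve 4 (λ o a t u → (o :+ t :* a) :- (o :+ u :* a) := (t :- u) :* a) ≈-refl o a t u

    axis-boundary : ∀ i j → det axis (base j ⊖ base i) ≈ 0#
    axis-boundary i j = trans (det-cong ≋-refl (base-difference i j)) (trans (det-• _ axis axis) (trans (*-congˡ (det-self axis)) (zeroʳ _)))

  axis-interior : ∀ i v → 0# < - det axis (interior v ⊖ base i)
  axis-interior i v = pos-resp (-‿cong (sym (axis-internal i v))) (sgn⁻-neg (inside v))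

  from-boundary : ∀ i v → 0# ≤ - det axis (position v ⊖ position (boundary i))
  from-boundary i (internal v) = inj₁ (axis-interior i v)
  from-boundary i (boundary j) = inj₂ (sym (-≈0 (axis-boundary i j)))

  to-boundary : ∀ i v → 0# ≤ det axis (position (boundary i) ⊖ position v)
  to-boundary i v = nonneg-resp (trans (-‿cong (det-⊖ axis (position v) (base i)))
    (trans (solve 2 (λ p q → :- (p :- q) := q :- p) ≈-refl _ _) (sym (det-⊖ axis (base i) (position v)))))
    (from-boundary i v)

  coordinate-injective : ∀ {i j} → i ≢ j → ¬ (coordinate i - coordinate j ≈ 0#)
  coordinate-injective {i} {j} i≢j h with Fin.<-cmp i j
  ... | tri≈ _ i≡j _ = i≢j i≡j
  ... | tri< i<j _ _ = pos⇒≉0 (x<y⇒0<y-x (clockwise i<j)) (trans (solve 2 (λ p q → p :- q := :- (q :- p)) ≈-refl _ _) (-≈0 h))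
  ... | tri> _ _ j<i = pos⇒≉0 (x<y⇒0<y-x (clockwise j<i)) h

  module Gauge (𝔩 : GaugeDirection N) where
    open GaugeDirection 𝔩 using () renaming (direction to l; inward to inwardₛ; not-parallel to not-parallelₛ; generic to genericₛ)

    inward : 0# < - det axis l
    inward = sgn⁻-neg inwardₛ

    open RayProperties K axis l inward public
    open RayMeetsSegment K axis l inward public

    0<det-l-axis : 0# < det l axis
    0<det-l-axis = pos-resp (sym (det-swap l axis)) inward

    det-boundary : ∀ i j → det l (position (boundary j) ⊖ position (boundary i)) ≈ (coordinate j - coordinate i) * det l axis
    det-boundary i j = trans (det-cong ≋-refl (base-difference i j)) (det-• _ l axis)

    -- The gauge condition excludes only the ray, but an internal vertex on the line through
    -- `boundary i` lies on the ray, being on the inward side. Boundary vertices differ along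
    -- `axis`, which is not parallel to `l`.
    vertex-generic : ∀ {i} v → v ≢ boundary i → ¬ (det l (position v ⊖ position (boundary i)) ≈ 0#)
    vertex-generic {i} (boundary j) v≢i h = coordinate-injective (λ { ≡.refl → v≢i ≡.refl })
      (≉0-* (pos⇒≉0 0<det-l-axis) (trans (*-comm _ _) (trans (sym (det-boundary i j)) h)))
    vertex-generic {i} (internal v) v≢i h =
      genericₛ i v (t , *-pos (axis-interior i v) 0<j , e (proj₁ (cramer u axis l)) , e (proj₂ (cramer u axis l)))
      where
      open import Relation.Binary.Reasoning.Setoid setoid
      u : Vec²
      u = interior v ⊖ base i
      inv : ∃[ j ] - det axis l * j ≈ 1# × 0# < j
      inv = pos-inverse inward
      j = proj₁ inv
      0<j = proj₂ (proj₂ inv)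
      -- The position on the ray is the quotient of `det axis u` and `det axis l`.
      t : Carrier
      t = - det axis u * j
      e : ∀ {p q b a} → det axis l * (p - b) + det l u * a + det u axis * q ≈ 0# → p ≈ b + t * q
      e {p} {q} {b} {a} z = begin
        p                                      ≈⟨ solve 2 (λ p b → p := b :+ (p :- b)) ≈-refl p b ⟩
        b + (p - b)                            ≈⟨ +-congˡ (*-identityˡ _) ⟨
        b + 1# * (p - b)                       ≈⟨ +-congˡ (*-congʳ (proj₁ (proj₂ inv))) ⟨
        b + - det axis l * j * (p - b)
          ≈⟨ solve 8 (λ al lu ua p q b a j → b :+ (:- al) :* j :* (p :- b) := (b :+ ua :* j :* q) :+ lu :* a :* j :- j :* (al :* (p :- b) :+ lu :* a :+ ua :* q)) ≈-refl (det axis l) (det l u) (det u axis) p q b a j ⟩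
        (b + det u axis * j * q) + det l u * a * j - j * (det axis l * (p - b) + det l u * a + det u axis * q)
          ≈⟨ +-cong (+-cong (+-congˡ (*-congʳ (*-congʳ (det-swap u axis)))) (*-congʳ (*-congʳ h))) (-‿cong (*-congˡ z)) ⟩
        (b + t * q) + 0# * a * j - j * 0#
          ≈⟨ solve 3 (λ z a j → z :+ con 0ℤ :* a :* j :- j :* con 0ℤ := z) ≈-refl (b + t * q) a j ⟩
        b + t * q                              ∎

module Paths {k n} (G : PlabicGraph k n) where
  open PlabicGraph G

  data Path : Vertex → List Edge → Vertex → Set where
    []  : ∀ {v} → Path v [] v
    _∷_ : ∀ e {es w} → Path (target e) es w → Path (source e) (e ∷ es) w

  never-revisited : ∀ {i v es w} → Path v es w → (∀ e → target e ≢ boundary i) → v ≢ boundary i → All (λ e → source e ≢ boundary i) es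
  never-revisited []      ¬target v≢i = []
  never-revisited (e ∷ p) ¬target v≢i = v≢i ∷ never-revisited p ¬target (¬target e)

  path-sum : ∀ {v es w} (h : Vertex → Bool) → Path v es w → ⨁ es (λ e → h (source e) xor h (target e)) ≡ h v xor h w
  path-sum h []      = ≡.sym (Bool.xor-same (h _))
  path-sum h (e ∷ p) = ≡.trans (cong ((h (source e) xor h (target e)) xor_) (path-sum h p))
    (solve 3 (λ a b c → (a :+ b) :+ (b :+ c) := a :+ c) ≡.refl (h (source e)) (h (target e)) (h _))
    where open xor-∧-Solver

-- The sign of a walk as a sum of crossing parities

module GaugeParity {c ℓ₁ ℓ₂} (K : OrderedField c ℓ₁ ℓ₂) {k n : ℕ} (N : Networks.PlabicNetwork K k n)
  (𝔩 : Networks.GaugeDirection K N) where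
  open OrderedField K using (Carrier; _≈_; 0#; -_; trans; sym; -‿cong; ≈-refl)
  open OrderedFieldProperties K
  open NetworkGeometry K N
  open Gauge 𝔩 public
  open Networks K using (wind; int; windPath; intPath; module GaugeDirection)
  open GaugeDirection 𝔩 using () renaming (direction to l; not-parallel to not-parallelₛ)
  open Paths graph

  -- The gauge condition `not-parallel` covers edges between internal vertices; an edge with a
  -- boundary end is covered by `vertex-generic` at that end.
  edge-generic : ∀ e → ¬ (det l (vector e) ≈ 0#)
  edge-generic e = go (source e) (target e) ≡.refl ≡.refl
    where
    go : ∀ v w → source e ≡ v → target e ≡ w → ¬ (det l (vector e) ≈ 0#)
    go (boundary i) w se te h =
      vertex-generic (target e) (λ te≡i → no-loops e (≡.trans se (≡.sym te≡i)))
        (≡.subst (λ v → det l (position (target e) ⊖ position v) ≈ 0#) se h)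
    go (internal v) (boundary j) se te h =
      vertex-generic {j} (source e) (λ se≡j → no-loops e (≡.trans se≡j (≡.sym te)))
        (trans (det-⊖ l (position (source e)) (position (boundary j)))
          (trans (solve 2 (λ p q → p :- q := :- (q :- p)) ≈-refl _ _)
            (-≈0 (trans (sym (det-⊖ l (position (boundary j)) (position (source e))))
              (≡.subst (λ v → det l (position v ⊖ position (source e)) ≈ 0#) te h)))))
    go (internal v) (internal w) se te h =
      not-parallelₛ e se te (sgn-zero (trans (det-swap (vector e) l) (-≈0 h)))

  turn : Edge → Edge → Bool
  turn e f = crosses (vector e) (vector f)

  ray : Fin k → Edge → Bool
  ray r e = crosses (position (source e) ⊖ position (boundary (pivot r))) (position (target e) ⊖ position (boundary (pivot r)))

  turns : List Edge → Bool
  turns []           = false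
  turns (e ∷ [])     = false
  turns (e ∷ f ∷ es) = turn e f xor turns (f ∷ es)

  rays : List Edge → Bool
  rays es = ⨁ (allFin k) (λ r → ⨁ es (ray r))

  odd-wind : ∀ es → odd ∣ windPath N 𝔩 es ∣ ≡ turns es
  odd-wind []           = ≡.refl
  odd-wind (e ∷ [])     = ≡.refl
  odd-wind (e ∷ f ∷ es) = ≡.trans (odd-∣+∣ (wind N 𝔩 e f) (windPath N 𝔩 (f ∷ es)))
    (cong₂ _xor_ (turn-crosses {vector e} {vector f} (edge-generic e) (edge-generic f)) (odd-wind (f ∷ es)))

  odd-int : ∀ e → odd (int N 𝔩 e) ≡ ⨁ (allFin k) (λ r → ray r e)
  odd-int e = ≡.trans (odd-count (λ r → rayCrosses? (position (boundary (pivot r))) l (position (source e)) (position (target e))))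
    (⨁-cong (All.universal crossing (allFin k)))
    where
    crossing : ∀ r → does (rayCrosses? (position (boundary (pivot r))) l (position (source e)) (position (target e))) ≡ ray r e
    crossing r with source e ≟ᵛ boundary (pivot r)
    ... | no se≢ = rayCrosses-crosses _ _ _ (vertex-generic (source e) se≢) (vertex-generic (target e) (target≢pivot e))
    ... | yes se≡ = ≡.trans (rayCrosses-start _ _ (position (target e)) starts) (≡.sym (crosses-𝟎ˡ (⊖-≋𝟎 starts)))
      where
      starts : position (source e) ≋ position (boundary (pivot r))
      starts = ≡.subst (λ v → position (source e) ≋ position v) se≡ ≋-refl

  -- The sums over edges and over rays are exchanged, because each ray is later followed along the
  -- whole walk.
  odd-intPath : ∀ es → odd (intPath N 𝔩 es) ≡ rays es
  odd-intPath es = ≡.trans (by-edges es) (⨁-swap es (allFin k) (λ e r → ray r e))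
    where
    by-edges : ∀ es → odd (intPath N 𝔩 es) ≡ ⨁ es (λ e → ⨁ (allFin k) (λ r → ray r e))
    by-edges []       = ≡.refl
    by-edges (e ∷ es) = ≡.trans (odd-+ (int N 𝔩 e) _) (cong₂ _xor_ (odd-int e) (by-edges es))

  odd-sign : ∀ es → odd ∣ windPath N 𝔩 es ℤ.+ + intPath N 𝔩 es ∣ ≡ turns es xor rays es
  odd-sign es = ≡.trans (odd-∣+∣ (windPath N 𝔩 es) (+ intPath N 𝔩 es)) (cong₂ _xor_ (odd-wind es) (odd-intPath es))

-- Dependence of the sign on the gauge direction

module GaugeChange {c ℓ₁ ℓ₂} (K : OrderedField c ℓ₁ ℓ₂) {k n : ℕ} (N : Networks.PlabicNetwork K k n)
  (𝔩 𝔩′ : Networks.GaugeDirection K N) where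
  open OrderedField K using (0#; -_)
  open OrderedFieldProperties K using (nonneg-≁-neg)
  open NetworkGeometry K N
  open Networks K using (par; cr; module GaugeDirection)
  open GaugeDirection using (direction)
  open Paths graph
  private
    module L  = GaugeParity K N 𝔩
    module L′ = GaugeParity K N 𝔩′
  open Rotation K axis (direction 𝔩) (direction 𝔩′) L.inward L′.inward

  private
    swept : Vec² → Bool
    swept u = does (inAngle? (direction 𝔩) (direction 𝔩′) u)

    passed : Fin k → Vertex → Bool
    passed r v = swept (position v ⊖ position (boundary (pivot r)))

    not-swept : ∀ {u} → OrderedField._≤_ K 0# (det axis u) → swept u ≡ false
    not-swept {u} 0≤u = dec-false (inAngle? (direction 𝔩) (direction 𝔩′) u) λ inside → nonneg-≁-neg 0≤u (inAngle⇒inward inside)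

    turn-change : ∀ {e f} → target e ≡ source f → L.turn e f xor L′.turn e f ≡ swept (vector e) xor swept (vector f)
    turn-change {e} {f} linked = crosses-rotation (L.edge-generic e) (L.edge-generic f) (L′.edge-generic e) (L′.edge-generic f)
      (consecutive-apart {e} {f} linked)

    -- The turns telescope to the first and the last edge vector. The last edge ends on the
    -- boundary, so its vector does not point inwards and lies outside the angle.
    turns-change : ∀ {v e es j} → Path v (e ∷ es) (boundary j) → L.turns (e ∷ es) xor L′.turns (e ∷ es) ≡ swept (vector e)
    turns-change {es = []} (e ∷ p) = ≡.sym (final p)
      where
      final : ∀ {v j} → Path v [] (boundary j) → swept (position v ⊖ position (source e)) ≡ false
      final {j = j} [] = not-swept (to-boundary j (source e))
    turns-change {es = f ∷ es} (e ∷ p) = begin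
      (L.turn e f xor L.turns (f ∷ es)) xor (L′.turn e f xor L′.turns (f ∷ es))
        ≡⟨ solve 4 (λ a b c d → (a :+ b) :+ (c :+ d) := (a :+ c) :+ (b :+ d)) ≡.refl (L.turn e f) (L.turns (f ∷ es)) (L′.turn e f) (L′.turns (f ∷ es)) ⟩
      (L.turn e f xor L′.turn e f) xor (L.turns (f ∷ es) xor L′.turns (f ∷ es))
        ≡⟨ cong₂ _xor_ (turn-change {e} {f} (linked p)) (turns-change p) ⟩
      (swept (vector e) xor swept (vector f)) xor swept (vector f)
        ≡⟨ solve 2 (λ a b → (a :+ b) :+ b := a) ≡.refl (swept (vector e)) (swept (vector f)) ⟩
      swept (vector e) ∎
      where
      open ≡.≡-Reasoning
      open xor-∧-Solver
      linked : ∀ {v w} → Path v (f ∷ es) w → v ≡ source f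
      linked (_ ∷ _) = ≡.refl

    ray-change : ∀ r e → source e ≢ boundary (pivot r) → L.ray r e xor L′.ray r e ≡ passed r (source e) xor passed r (target e)
    ray-change r e se≢ = crosses-rotation
      (L.vertex-generic (source e) se≢) (L.vertex-generic (target e) te≢) (L′.vertex-generic (source e) se≢) (L′.vertex-generic (target e) te≢)
      (Off⇒Apart₂ (off-edge {f = e} (proj₁ (pivot-edge r)) (inj₁ (proj₂ (pivot-edge r))) λ { (inj₁ se) → se≢ se ; (inj₂ te) → te≢ te }))
      where
      te≢ = target≢pivot {r} e

    -- Telescopes to the two ends of the walk. Seen from a source, the final boundary vertex lies
    -- along `axis`, outside the angle. The walk avoids the source itself, so that every direction
    -- involved is generic.
    ray-sum-change : ∀ r {v es j} → Path v es (boundary j) → v ≢ boundary (pivot r) → ⨁ es (L.ray r) xor ⨁ es (L′.ray r) ≡ passed r v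
    ray-sum-change r {v} {es} {j} p v≢ = begin
      ⨁ es (L.ray r) xor ⨁ es (L′.ray r)                         ≡⟨ ⨁-xor es (L.ray r) (L′.ray r) ⟨
      ⨁ es (λ e → L.ray r e xor L′.ray r e)                      ≡⟨ ⨁-cong (All.map (λ {e} → ray-change r e) (never-revisited p target≢pivot v≢)) ⟩
      ⨁ es (λ e → passed r (source e) xor passed r (target e))   ≡⟨ path-sum (passed r) p ⟩
      passed r v xor passed r (boundary j)                        ≡⟨ cong (passed r v xor_) (not-swept (to-boundary j (boundary (pivot r)))) ⟩
      passed r v xor false                                        ≡⟨ Bool.xor-identityʳ (passed r v) ⟩
      passed r v                                                  ∎
      where open ≡.≡-Reasoning

  sign-change : ∀ {e es j} → Path (source e) (e ∷ es) (boundary j) → (∀ r → source e ≢ boundary (pivot r)) →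
    (L.turns (e ∷ es) xor L.rays (e ∷ es)) xor (L′.turns (e ∷ es) xor L′.rays (e ∷ es)) ≡ odd (cr N 𝔩 𝔩′ (source e) ℕ.+ par N 𝔩 𝔩′ e)
  sign-change {e} {es} p ≢pivot = begin
    (L.turns P xor L.rays P) xor (L′.turns P xor L′.rays P)
      ≡⟨ solve 4 (λ a b c d → (a :+ b) :+ (c :+ d) := (b :+ d) :+ (a :+ c)) ≡.refl (L.turns P) (L.rays P) (L′.turns P) (L′.rays P) ⟩
    (L.rays P xor L′.rays P) xor (L.turns P xor L′.turns P)
      ≡⟨ cong₂ _xor_ rays-change (turns-change p) ⟩
    odd (cr N 𝔩 𝔩′ (source e)) xor swept (vector e)
      ≡⟨ cong (odd (cr N 𝔩 𝔩′ (source e)) xor_) (indicator (swept (vector e))) ⟨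
    odd (cr N 𝔩 𝔩′ (source e)) xor odd (par N 𝔩 𝔩′ e)
      ≡⟨ odd-+ (cr N 𝔩 𝔩′ (source e)) (par N 𝔩 𝔩′ e) ⟨
    odd (cr N 𝔩 𝔩′ (source e) ℕ.+ par N 𝔩 𝔩′ e) ∎
    where
    open ≡.≡-Reasoning
    open xor-∧-Solver
    P : List Edge
    P = e ∷ es
    indicator : ∀ b → odd (if b then 1 else 0) ≡ b
    indicator true  = ≡.refl
    indicator false = ≡.refl
    rays-change : L.rays P xor L′.rays P ≡ odd (cr N 𝔩 𝔩′ (source e))
    rays-change = begin
      L.rays P xor L′.rays P
        ≡⟨ ⨁-xor (allFin k) (λ r → ⨁ P (L.ray r)) (λ r → ⨁ P (L′.ray r)) ⟨
      ⨁ (allFin k) (λ r → ⨁ P (L.ray r) xor ⨁ P (L′.ray r))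
        ≡⟨ ⨁-cong (All.universal (λ r → ray-sum-change r p (≢pivot r)) (allFin k)) ⟩
      ⨁ (allFin k) (λ r → passed r (source e))
        ≡⟨ odd-count (λ r → inAngle? (direction 𝔩) (direction 𝔩′) (position (source e) ⊖ position (boundary (pivot r)))) ⟨
      odd (cr N 𝔩 𝔩′ (source e)) ∎

solve-for : ∀ {a c} b → a xor b ≡ c → a ≡ c xor b
solve-for {a} b ≡.refl = solve 2 (λ a b → a := (a :+ b) :+ b) ≡.refl a b
  where open xor-∧-Solver

-- Walks stored in reverse

module Trails {k n} (G : PlabicGraph k n) where
  open PlabicGraph G

  -- Most recent edge first, like the trail of erasedLoops.
  data Trail (u : Vertex) : Vertex → List Edge → Set where
    nil  : ∀ {v} → u ≡ v → Trail u v []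
    snoc : ∀ {v e es} → Trail u (source e) es → target e ≡ v → Trail u v (e ∷ es)

  vertices : Vertex → List Edge → List Vertex
  vertices u es = map target es ++ (u ∷ [])

  all-last : ∀ {p} {P : Vertex → Set p} {u v es} → Trail u v es → All P (vertices u es) → P v
  all-last (nil ≡.refl)    (p ∷ _) = p
  all-last (snoc _ ≡.refl) (p ∷ _) = p

  all-first : ∀ {p} {P : Vertex → Set p} {u} es → All P (vertices u es) → P u
  all-first es ps with All.++⁻ʳ (map target es) ps
  ... | p ∷ _ = p

  all-endpoints : ∀ {p} {P : Vertex → Set p} {u v es} → Trail u v es → All P (vertices u es) → All (λ e → P (source e) × P (target e)) es
  all-endpoints (nil _)    ps       = []
  all-endpoints (snoc t _) (p ∷ ps) = (all-last t ps , p) ∷ all-endpoints t ps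

  trail-sum : ∀ {u v es} (h : Vertex → Bool) → Trail u v es → ⨁ es (λ e → h (source e) xor h (target e)) ≡ h u xor h v
  trail-sum h (nil ≡.refl) = ≡.sym (Bool.xor-same (h _))
  trail-sum {u} {v} {e ∷ es} h (snoc t ≡.refl) = ≡.trans (cong ((h (source e) xor h (target e)) xor_) (trail-sum h t))
    (solve 3 (λ a b c → (a :+ b) :+ (c :+ a) := c :+ b) ≡.refl (h (source e)) (h (target e)) (h u))
    where open xor-∧-Solver

  trail-append : ∀ {u v e es} → Trail (target e) v es → source e ≡ u → Trail u v (es ++ e ∷ [])
  trail-append (nil te≡v)     se≡u = snoc (nil (≡.sym se≡u)) te≡v
  trail-append (snoc t te≡v) se≡u = snoc (trail-append t se≡u) te≡v

  trail-split : ∀ {u v} es {es′} → Trail u v (es ++ es′) → ∃[ w ] Trail w v es × Trail u w es′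
  trail-split []       t             = _ , nil ≡.refl , t
  trail-split (e ∷ es) (snoc t te≡v) = let (w , t₁ , t₂) = trail-split es t in w , snoc t₁ te≡v , t₂

-- Turning of simple trails and simple cycles

module RotationNumber {c ℓ₁ ℓ₂} (K : OrderedField c ℓ₁ ℓ₂) {k n : ℕ} (N : Networks.PlabicNetwork K k n)
  (𝔩 : Networks.GaugeDirection K N) where
  open NetworkGeometry K N
  open GaugeParity K N 𝔩
  open Trails graph

  infixl 6 _↠_
  _↠_ : Vertex → Vertex → Vec²
  u ↠ v = position v ⊖ position u

  -- The secant between `v` and a point running along `e`: it starts at `v` in the fan and ends at
  -- `v` in the cofan. These are the two legs of the triangle of secants.
  fanₑ cofanₑ : Vertex → Edge → Bool
  fanₑ   v e = crosses (v ↠ source e) (v ↠ target e)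
  cofanₑ v e = crosses (source e ↠ v) (target e ↠ v)

  fan cofan : Vertex → List Edge → Bool
  fan   v es = ⨁ es (fanₑ v)
  cofan v es = ⨁ es (cofanₑ v)

  turnsʳ : List Edge → Bool
  turnsʳ []           = false
  turnsʳ (e ∷ [])     = false
  turnsʳ (e ∷ f ∷ es) = turn f e xor turnsʳ (f ∷ es)

  ↠-same : ∀ v → v ↠ v ≋ 𝟎
  ↠-same v = ⊖-≋𝟎 ≋-refl

  ↠-neg : ∀ u v → neg (u ↠ v) ≋ v ↠ u
  ↠-neg u v = neg-⊖ (position v) (position u)

  ↠-+ : ∀ u v w → (u ↠ v) ⊹ (v ↠ w) ≋ u ↠ w
  ↠-+ u v w = ⊖-⊹ (position u) (position v) (position w)

  left-reverse : ∀ {u v} → u ≢ v → left (v ↠ u) ≡ not (left (u ↠ v))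
  left-reverse {u} {v} u≢v = ≡.trans (left-cong (≋-sym (↠-neg u v))) (left-neg (λ z → u≢v (≡.sym (distinct (𝟎-⊖ z)))))

  _Avoids_ : Edge → Vertex → Set
  e Avoids v = ¬ EndPoint e v

  avoids : ∀ {u v es w} → Trail u v es → All (w ≢_) (vertices u es) → All (_Avoids w) es
  avoids t ps = All.map (λ { (s , _) (inj₁ ≡.refl) → s ≡.refl ; (_ , t) (inj₂ ≡.refl) → t ≡.refl }) (all-endpoints t ps)

  incident-apart : ∀ {v} g f → EndPoint g v → f Avoids v → Apart₂ (v ↠ source f) (v ↠ target f)
  incident-apart g f end f-avoids = Off⇒Apart₂ (off-edge {f = f} g end f-avoids)

  -- Secants to `v` are the negatives of those from `v`, so `crosses-opposite` applies.
  fan-cofan : ∀ {v} g f → EndPoint g v → f Avoids v → fanₑ v f xor cofanₑ v f ≡ left (v ↠ source f) xor left (v ↠ target f)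
  fan-cofan {v} g f end f-avoids = ≡.trans
    (cong (fanₑ v f xor_) (crosses-cong (≋-sym (↠-neg v (source f))) (≋-sym (↠-neg v (target f)))))
    (crosses-opposite (incident-apart g f end f-avoids))

  turn-vertices : ∀ {e f u v w} → source e ≡ u → target e ≡ v → source f ≡ v → target f ≡ w → turn e f ≡ crosses (u ↠ v) (v ↠ w)
  turn-vertices se te sf tf = cong₂ crosses (cong₂ _↠_ se te) (cong₂ _↠_ sf tf)

  -- The cell of two edges that are not disjoint. The secant over the corner is the sum of the two
  -- edge vectors, so the cell is a triangle.
  consecutive-triangle : ∀ {e f u v w} → source e ≡ u → target e ≡ v → source f ≡ v → target f ≡ w →
    crosses (u ↠ v) (u ↠ w) xor crosses (u ↠ w) (v ↠ w) ≡ turn e f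
  consecutive-triangle {e} {f} {u} {v} {w} se te sf tf = ≡.trans
    (crosses-triangle (Apart₃-resp ≋-refl (↠-+ u v w) ≋-refl (Apart₂-sum
      (≡.subst₂ Apart₂ (cong₂ _↠_ se te) (cong₂ _↠_ sf tf) (consecutive-apart {e} {f} (≡.trans te (≡.sym sf)))))))
    (≡.sym (turn-vertices {e} {f} se te sf tf))

  private
    exchange : ∀ a b c d → a xor b ≡ c xor d → b xor c ≡ a xor d
    exchange = from-yes (∀ᵇ? λ a → ∀ᵇ? λ b → ∀ᵇ? λ c → ∀ᵇ? λ d → (a xor b Bool.≟ c xor d) →-dec (b xor c Bool.≟ a xor d))

    extend-trail : ∀ F Cp a b d {turn turns Cp′ z b′ Cq} → turn ≡ d xor b → turns ≡ F xor (Cp′ xor Cp) →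
      Cp′ ≡ false → z ≡ false → b′ ≡ b → Cq ≡ (a xor d) xor Cp → turn xor turns ≡ (a xor F) xor (z xor (b′ xor Cq))
    extend-trail F Cp a b d ≡.refl ≡.refl ≡.refl ≡.refl ≡.refl ≡.refl =
      solve 5 (λ F Cp a b d → (d :+ b) :+ (F :+ Cp) := (a :+ F) :+ (b :+ ((a :+ d) :+ Cp))) ≡.refl F Cp a b d
      where open xor-∧-Solver

  -- The row of cells belonging to a fixed edge `e`. The sides shared by neighbouring cells cancel,
  -- and only those at the two ends of the trail remain.
  strip : ∀ {u v es e p q} → source e ≡ p → target e ≡ q → Trail u v es → All (_Avoids p) es → All (_Avoids q) es →
    cofan q es xor cofan p es ≡ crosses (u ↠ q) (u ↠ p) xor crosses (v ↠ q) (v ↠ p)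
  strip {u} {v} {es} {e} ≡.refl ≡.refl t src tgt = begin
    cofan (target e) es xor cofan (source e) es               ≡⟨ ⨁-xor es (cofanₑ (target e)) (cofanₑ (source e)) ⟨
    ⨁ es (λ f → cofanₑ (target e) f xor cofanₑ (source e) f) ≡⟨ ⨁-cong (All.zipWith (λ {f} (p , q) → cell f p q) (src , tgt)) ⟩
    ⨁ es (λ f → h (source f) xor h (target f))               ≡⟨ trail-sum h t ⟩
    h u xor h v                                               ∎
    where
    open ≡.≡-Reasoning
    h : Vertex → Bool
    h w = crosses (w ↠ target e) (w ↠ source e)
    cell : ∀ f → f Avoids source e → f Avoids target e →
           cofanₑ (target e) f xor cofanₑ (source e) f ≡ h (source f) xor h (target f)
    cell f f-avoids-source f-avoids-target = begin
      -- The diagonal from `A` to `D` cuts the cell into two triangles, kept off the origin by the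
      -- disjointness of `e` and `f`.
      crosses B D xor crosses A C
        ≡⟨ exchange (crosses A B) (crosses B D) (crosses A C) (crosses C D) (≡.trans
             (crosses-triangle (Disjoint⇒Apart₃ (Disjoint-swap disjoint)))
             (≡.sym (crosses-triangle (Disjoint⇒Apart₃′ disjoint)))) ⟩
      crosses A B xor crosses C D
        ≡⟨ cong₂ _xor_ (crosses-sym A B) (crosses-sym C D) ⟩
      crosses B A xor crosses D C ∎
      where
      A B C D : Vec²
      A = source f ↠ source e
      B = source f ↠ target e
      C = target f ↠ source e
      D = target f ↠ target e
      disjoint : Disjoint (position (source e)) (position (target e)) (position (source f)) (position (target f))
      disjoint = disjoint-edges {e} {f} f-avoids-source f-avoids-target

  -- Hopf's theorem on turning tangents for a simple path, modulo 2: the secant vectors joining two points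
  -- of the path form a triangle whose interior does not meet the origin, so its hypotenuse, the tangents,
  -- crosses the ray as often as its two legs, the secants from the first and those to the last vertex.
  turning-trail : ∀ {u v es} → Trail u v es → Unique (vertices u es) → turnsʳ es ≡ fan u es xor cofan v es
  turning-trail (nil _) _ = ≡.refl
  turning-trail {u} {v} {e ∷ []} (snoc (nil ≡.refl) ≡.refl) _ = ≡.sym (cong₂ _xor_
    (≡.trans (Bool.xor-identityʳ _) (crosses-𝟎ˡ (↠-same (source e))))
    (≡.trans (Bool.xor-identityʳ _) (crosses-𝟎ʳ (↠-same (target e)))))
  turning-trail {x} {_} {e ∷ f ∷ es} (snoc t@(snoc t′ tf≡p) ≡.refl) ((_ ∷ q≢) ∷ u@(p≢ ∷ _)) =
    extend-trail (fan x (f ∷ es)) (cofan p es) (crosses (x ↠ p) (x ↠ q)) (crosses (r ↠ q) (p ↠ q)) (crosses (r ↠ p) (r ↠ q))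
      -- `f` meets `e` at `p`, so its cell is the corner triangle on `r`, `p`, `q`; `strip` treats
      -- only the earlier edges, which are disjoint from `e`.
      (≡.sym (consecutive-triangle {f} {e} ≡.refl tf≡p ≡.refl ≡.refl))
      (turning-trail t u)
      (crosses-𝟎ʳ (≡.subst (λ v → v ↠ p ≋ 𝟎) (≡.sym tf≡p) (↠-same p)))
      (crosses-𝟎ʳ (↠-same q))
      (cong (λ v → crosses (r ↠ q) (v ↠ q)) tf≡p)
      (solve-for (cofan p es) (≡.trans
        (strip {e = e} ≡.refl ≡.refl t′ (avoids t′ (≡.subst (λ v → All (v ≢_) (vertices x es)) tf≡p p≢)) (avoids t′ q≢))
        (cong₂ _xor_ (crosses-sym (x ↠ q) (x ↠ p)) (crosses-sym (r ↠ q) (r ↠ p)))))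
    where
    p q r : Vertex
    p = source e
    q = target e
    r = source f

  private
    -- Linear algebra over the field with two elements. The value `true` comes from the three
    -- reversed sides `lpq`, `lyp` and `lyq`.
    close-trail : ∀ E G Cc D cq lqp lpy lqr lqy {A B H cp fq lpq lyp lyq te tf ts} →
      lpq ≡ true xor lqp → lyp ≡ true xor lpy → lyq ≡ true xor lqy →
      A ≡ (lqr xor lqp) xor D → B ≡ (lpq xor lpy) xor E → H ≡ (lyp xor lyq) xor G →
      fq ≡ (lqy xor lqr) xor cq → cp ≡ (H xor Cc) xor cq →
      te ≡ E xor G → tf ≡ Cc xor D → ts ≡ (A xor fq) xor (cp xor B) → te xor (tf xor ts) ≡ true
    close-trail E G Cc D cq lqp lpy lqr lqy ≡.refl ≡.refl ≡.refl ≡.refl ≡.refl ≡.refl ≡.refl ≡.refl ≡.refl ≡.refl ≡.refl =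
      solve 9 (λ E G Cc D cq lqp lpy lqr lqy →
        (E :+ G) :+ ((Cc :+ D) :+ ((((lqr :+ lqp) :+ D) :+ ((lqy :+ lqr) :+ cq))
          :+ (((((con true :+ lpy) :+ (con true :+ lqy)) :+ G) :+ Cc) :+ cq :+ (((con true :+ lqp) :+ lpy) :+ E)))) := con true)
        ≡.refl E G Cc D cq lqp lpy lqr lqy
      where open xor-∧-Solver

  -- Without `e` the cycle is a simple trail from `q` to `p`, so its turns form a fan at `q` and a
  -- cofan at `p`. The strip of `e` moves the cofan to `q`, where it differs from the fan by sides,
  -- which telescope. Closing up meets three secants in both directions; these reversals give the
  -- odd total.
  turning-cycle : ∀ {e f g es} → source g ≡ target e → target f ≡ source e → Trail (target g) (source f) es →
    Unique (vertices (target e) (f ∷ es ++ g ∷ [])) → turn e g xor turnsʳ (e ∷ f ∷ es ++ g ∷ []) ≡ true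
  turning-cycle {e} {f} {g} {es} sg≡q tf≡p t u@(p≢ ∷ u′) =
    close-trail (crosses (p ↠ q) (p ↠ y)) (crosses (p ↠ y) (q ↠ y)) (crosses (r ↠ p) (r ↠ q)) (crosses (r ↠ q) (p ↠ q)) (cofan q es)
      (left (q ↠ p)) (left (p ↠ y)) (left (q ↠ r)) (left (q ↠ y))
      {crosses (q ↠ r) (q ↠ p)} {crosses (q ↠ p) (y ↠ p)} {crosses (y ↠ q) (y ↠ p)} {cofan p es} {fan q es}
      (left-reverse q≢p) (left-reverse p≢y) (left-reverse q≢y)
      (solve-for (crosses (r ↠ q) (p ↠ q)) (fan-cofan′ e f (inj₂ ≡.refl) ≡.refl tf≡p (avoiding {f} ≡.refl tf≡p q≢r q≢p)))
      (solve-for′ (crosses (p ↠ q) (p ↠ y)) (fan-cofan′ e g (inj₁ ≡.refl) sg≡q ≡.refl (avoiding {g} sg≡q ≡.refl p≢q p≢y)))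
      (solve-for (crosses (p ↠ y) (q ↠ y)) (≡.trans (cong (_xor crosses (p ↠ y) (q ↠ y)) (crosses-sym (y ↠ q) (y ↠ p)))
        (fan-cofan′ g e (inj₂ ≡.refl) ≡.refl ≡.refl (avoiding {e} ≡.refl ≡.refl y≢p y≢q))))
      (solve-for (cofan q es) (≡.trans (≡.trans (≡.sym (⨁-xor es (fanₑ q) (cofanₑ q)))
        (⨁-cong (All.map (λ {e′} → fan-cofan e e′ (inj₂ ≡.refl)) (avoids t q≢)))) (trail-sum (λ v → left (q ↠ v)) t)))
      (solve-for′ (cofan q es) (≡.trans (strip {e = e} ≡.refl ≡.refl t (avoids t p≢′) (avoids t q≢))
        (cong (crosses (y ↠ q) (y ↠ p) xor_) (crosses-sym (r ↠ q) (r ↠ p)))))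
      (≡.sym (consecutive-triangle {e} {g} ≡.refl ≡.refl sg≡q ≡.refl))
      (≡.sym (consecutive-triangle {f} {e} ≡.refl tf≡p ≡.refl ≡.refl))
      (≡.trans (turning-trail trail u) (cong₂ _xor_ fan-ends cofan-ends))
    where
    p q r y : Vertex
    p = source e
    q = target e
    r = source f
    y = target g
    solve-for′ : ∀ {a c} b → b xor a ≡ c → a ≡ c xor b
    solve-for′ {a} b h = solve-for b (≡.trans (Bool.xor-comm a b) h)
    avoiding : ∀ {e u v w} → source e ≡ u → target e ≡ v → w ≢ u → w ≢ v → e Avoids w
    avoiding ≡.refl ≡.refl w≢u w≢v (inj₁ h) = w≢u (≡.sym h)
    avoiding ≡.refl ≡.refl w≢u w≢v (inj₂ h) = w≢v (≡.sym h)
    fan-cofan′ : ∀ {v u w} g f → EndPoint g v → source f ≡ u → target f ≡ w → f Avoids v →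
      crosses (v ↠ u) (v ↠ w) xor crosses (u ↠ v) (w ↠ v) ≡ left (v ↠ u) xor left (v ↠ w)
    fan-cofan′ g f end ≡.refl ≡.refl f-avoids = fan-cofan g f end f-avoids
    sg-same : q ↠ source g ≋ 𝟎
    sg-same = ≡.subst (λ v → q ↠ v ≋ 𝟎) (≡.sym sg≡q) (↠-same q)
    tf-same : target f ↠ p ≋ 𝟎
    tf-same = ≡.subst (λ v → v ↠ p ≋ 𝟎) (≡.sym tf≡p) (↠-same p)
    fan-ends : fan q (f ∷ es ++ g ∷ []) ≡ crosses (q ↠ r) (q ↠ p) xor fan q es
    fan-ends = cong₂ _xor_ (cong (λ v → crosses (q ↠ r) (q ↠ v)) tf≡p) (begin
      fan q (es ++ g ∷ [])             ≡⟨ ⨁-++ es (g ∷ []) (fanₑ q) ⟩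
      fan q es xor (fanₑ q g xor false) ≡⟨ cong (λ b → fan q es xor (b xor false)) (crosses-𝟎ˡ sg-same) ⟩
      fan q es xor false               ≡⟨ Bool.xor-identityʳ (fan q es) ⟩
      fan q es                         ∎)
      where open ≡.≡-Reasoning
    cofan-ends : cofan p (f ∷ es ++ g ∷ []) ≡ cofan p es xor crosses (q ↠ p) (y ↠ p)
    cofan-ends = begin
      cofanₑ p f xor cofan p (es ++ g ∷ [])      ≡⟨ cong₂ _xor_ (crosses-𝟎ʳ tf-same) (⨁-++ es (g ∷ []) (cofanₑ p)) ⟩
      cofan p es xor (cofanₑ p g xor false)      ≡⟨ cong (cofan p es xor_) (Bool.xor-identityʳ (cofanₑ p g)) ⟩
      cofan p es xor cofanₑ p g                  ≡⟨ cong (λ v → cofan p es xor crosses (v ↠ p) (y ↠ p)) sg≡q ⟩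
      cofan p es xor crosses (q ↠ p) (y ↠ p)     ∎
      where open ≡.≡-Reasoning
    last-two : vertices q (es ++ g ∷ []) ≡ vertices y es ++ q ∷ []
    last-two = cong (_++ q ∷ []) (List.map-++ target es (g ∷ []))
    trail : Trail q p (f ∷ es ++ g ∷ [])
    trail = snoc (trail-append t sg≡q) tf≡p
    p≢′ : All (p ≢_) (vertices y es)
    p≢′ = All.++⁻ˡ (vertices y es) (≡.subst₂ (λ v vs → All (v ≢_) vs) tf≡p last-two p≢)
    p≢q : p ≢ q
    p≢q = no-loops e
    q≢p : q ≢ p
    q≢p = p≢q ∘ ≡.sym
    q≢ : All (q ≢_) (vertices y es)
    q≢ = All.map (λ h h′ → h (≡.sym h′)) (before-last (vertices y es) (≡.subst Unique last-two u′))
      where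
      before-last : ∀ {w} vs → Unique (vs ++ w ∷ []) → All (_≢ w) vs
      before-last []       _        = []
      before-last (v ∷ vs) (h ∷ hs) with All.++⁻ʳ vs h
      ... | v≢w ∷ _ = v≢w ∷ before-last vs hs
    p≢y : p ≢ y
    p≢y = all-first es p≢′
    y≢p : y ≢ p
    y≢p = p≢y ∘ ≡.sym
    q≢y : q ≢ y
    q≢y = all-first es q≢
    y≢q : y ≢ q
    y≢q = q≢y ∘ ≡.sym
    q≢r : q ≢ r
    q≢r = all-last t q≢

-- Loop erasure and the parity of a walk

module TrailCutting {k n} (G : PlabicGraph k n) where
  open PlabicGraph G
  open Trails G

  vertices-++ : ∀ {u} es es′ → vertices u (es ++ es′) ≡ map target es ++ vertices u es′
  vertices-++ {u} es es′ = ≡.trans (cong (_++ u ∷ []) (List.map-++ target es es′)) (List.++-assoc (map target es) (map target es′) (u ∷ []))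

  unique-suffix : ∀ {a} {A : Set a} (xs : List A) {ys} → Unique (xs ++ ys) → Unique ys
  unique-suffix []       h       = h
  unique-suffix (x ∷ xs) (_ ∷ h) = unique-suffix xs h

  unique-prefix : ∀ {a} {A : Set a} (xs : List A) {y ys} → Unique (xs ++ y ∷ ys) → Unique (xs ++ y ∷ [])
  unique-prefix []       h       = [] ∷ []
  unique-prefix (x ∷ xs) {y} {ys} (p ∷ h) with All.++⁻ xs p
  ... | ps , p′ ∷ _ = All.++⁺ ps (p′ ∷ []) ∷ unique-prefix xs h

  -- The trail is cut at its earlier visit to `v`. The last component identifies the `dropWhile` in
  -- `erasedLoops` with the vertices of what remains.
  cut : ∀ {u w v es} → Trail u w es → v ∈ vertices u es →
        ∃₂ λ loop rest → es ≡ loop ++ rest × Trail v w loop × Trail u v rest ×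
          dropWhile (λ x → ¬? (x ≟ᵛ v)) (vertices u es) ≡ vertices u rest
  cut {u} {w} {v} (nil u≡w) (here ≡.refl) with u ≟ᵛ u
  ... | yes _  = [] , [] , ≡.refl , nil u≡w , nil ≡.refl , ≡.refl
  ... | no u≢u = contradiction ≡.refl u≢u
  cut {v = v} {es = e ∷ es} (snoc t te≡w) v∈ with target e ≟ᵛ v
  ... | yes te≡v = [] , e ∷ es , ≡.refl , nil (≡.trans (≡.sym te≡v) te≡w) , snoc t te≡v , ≡.refl
  ... | no te≢v  with v∈
  ...   | here v≡te = contradiction (≡.sym v≡te) te≢v
  ...   | there v∈′ = let (loop , rest , eq , t₁ , t₂ , dropped) = cut t v∈′ in
    e ∷ loop , rest , cong (e ∷_) eq , snoc t₁ te≡w , t₂ , dropped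

module LoopErasure {c ℓ₁ ℓ₂} (K : OrderedField c ℓ₁ ℓ₂) {k n : ℕ} (N : Networks.PlabicNetwork K k n)
  (𝔩 : Networks.GaugeDirection K N) where
  open OrderedField K using (_*_; _-_; 0#; -_; _<_; *-pos; *-comm; ≈-refl)
  open OrderedFieldProperties K
  open NetworkGeometry K N
  open GaugeParity K N 𝔩
  open Networks.GaugeDirection 𝔩 using () renaming (direction to l)
  open Trails graph
  open TrailCutting graph
  open Paths graph
  open RotationNumber K N 𝔩
  open DecMembership _≟ᵛ_ using (_∈?_)

  -- During erasure a walk is a reversed trail followed by the remaining edges. The edge `e` belongs
  -- to both parts, so the turns at it are not lost.
  turns-ʳ++ : ∀ es e es′ → turns (es ʳ++ e ∷ es′) ≡ turnsʳ (e ∷ es) xor turns (e ∷ es′)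
  turns-ʳ++ []       e es′ = ≡.refl
  turns-ʳ++ (f ∷ es) e es′ = ≡.trans (turns-ʳ++ es f (e ∷ es′))
    (S.solve 3 (λ a b c → a S.:+ (b S.:+ c) S.:= (b S.:+ a) S.:+ c) ≡.refl (turnsʳ (f ∷ es)) (turn f e) (turns (e ∷ es′)))
    where module S = xor-∧-Solver

  turns-reverse : ∀ es → turns (es ʳ++ []) ≡ turnsʳ es
  turns-reverse []       = ≡.refl
  turns-reverse (e ∷ es) = ≡.trans (turns-ʳ++ es e []) (Bool.xor-identityʳ (turnsʳ (e ∷ es)))

  turnsʳ-++ : ∀ es f g es′ → turnsʳ (es ++ f ∷ g ∷ es′) ≡ turnsʳ (es ++ f ∷ []) xor (turn g f xor turnsʳ (g ∷ es′))
  turnsʳ-++ []           f g es′ = ≡.refl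
  turnsʳ-++ (e ∷ [])     f g es′ = cong (_xor (turn g f xor turnsʳ (g ∷ es′))) (≡.sym (Bool.xor-identityʳ (turn f e)))
  turnsʳ-++ (e ∷ h ∷ es) f g es′ = ≡.trans (cong (turn h e xor_) (turnsʳ-++ (h ∷ es) f g es′))
    (≡.sym (Bool.xor-assoc (turn h e) (turnsʳ (h ∷ es ++ f ∷ [])) (turn g f xor turnsʳ (g ∷ es′))))

  -- Seen from a source the whole drawing lies in the closed inward half plane.
  ray-inward : ∀ r e → source e ≢ boundary (pivot r) →
    ray r e ≡ left (boundary (pivot r) ↠ source e) xor left (boundary (pivot r) ↠ target e)
  ray-inward r e se≢ = crosses-inward
    (incident-apart (proj₁ (pivot-edge r)) e (inj₁ (proj₂ (pivot-edge r))) λ { (inj₁ h) → se≢ h ; (inj₂ h) → target≢pivot e h })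
    (from-boundary (pivot r) (source e)) (from-boundary (pivot r) (target e))

  ray-sum : ∀ r {u v es} → Trail u v es → u ≢ boundary (pivot r) →
    ⨁ es (ray r) ≡ left (boundary (pivot r) ↠ u) xor left (boundary (pivot r) ↠ v)
  ray-sum r {u} {v} {es} t u≢ = ≡.trans
    (⨁-cong (All.map (λ {e} (se≢ , _) → ray-inward r e se≢) (all-endpoints t avoid)))
    (trail-sum (λ w → left (boundary (pivot r) ↠ w)) t)
    where
    avoid : All (_≢ boundary (pivot r)) (vertices u es)
    avoid = All.++⁺ (All.map⁺ (All.universal target≢pivot es)) (u≢ ∷ [])

  -- Boundary vertices differ by a multiple of `axis`, and `inward` makes `det l axis` positive.
  left-boundary : ∀ i j → i ≢ j → left (boundary i ↠ boundary j) ≡ does (i Fin.<? j)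
  left-boundary i j i≢j = ≡.trans (left-generic (vertex-generic (boundary j) λ { ≡.refl → i≢j ≡.refl }))
    (≡.trans (isPositive-cong (det-boundary i j)) (does-⇔ (mk⇔ to from) (positive? _) (i Fin.<? j)))
    where
    from : i Fin.< j → 0# < (coordinate j - coordinate i) * det l axis
    from i<j = *-pos (x<y⇒0<y-x (clockwise i<j)) 0<det-l-axis
    to : 0# < (coordinate j - coordinate i) * det l axis → i Fin.< j
    to h with Fin.<-cmp i j
    ... | tri< i<j _ _ = i<j
    ... | tri≈ _ i≡j _ = contradiction i≡j i≢j
    ... | tri> _ _ j<i = contradiction
      (pos-resp (solve 2 (λ a b → b :- a := :- (a :- b)) ≈-refl (coordinate i) (coordinate j)) (pos-cancelˡ 0<det-l-axis (pos-resp (*-comm _ _) h)))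
      (pos-≁-neg (x<y⇒0<y-x (clockwise j<i)))

  between : Fin k → Fin n → Fin k → Bool
  between r j s = does (((pivot r Fin.<? pivot s) ×-dec (pivot s Fin.<? j)) ⊎-dec ((j Fin.<? pivot s) ×-dec (pivot s Fin.<? pivot r)))

  -- Away from the two ends, lying between them means lying beyond exactly one of them.
  between-xor : ∀ r j s → pivot s ≢ pivot r → pivot s ≢ j →
    between r j s ≡ does (pivot s Fin.<? pivot r) xor does (pivot s Fin.<? j)
  between-xor r j s s≢r s≢j = ≡.trans
    (cong₂ (λ a b → (a ∧ does (pivot s Fin.<? j)) ∨ (b ∧ does (pivot s Fin.<? pivot r))) (flip s≢r) (flip s≢j))
    (bool (does (pivot s Fin.<? pivot r)) (does (pivot s Fin.<? j)))
    where
    flip : ∀ {i j : Fin n} → i ≢ j → does (j Fin.<? i) ≡ not (does (i Fin.<? j))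
    flip {i} {j} i≢j with Fin.<-cmp i j
    ... | tri< i<j _ j≮i = ≡.trans (dec-false (j Fin.<? i) j≮i) (cong not (≡.sym (dec-true (i Fin.<? j) i<j)))
    ... | tri≈ _ i≡j _   = contradiction i≡j i≢j
    ... | tri> i≮j _ j<i = ≡.trans (dec-true (j Fin.<? i) j<i) (cong not (≡.sym (dec-false (i Fin.<? j) i≮j)))
    bool : ∀ a b → (not a ∧ b) ∨ (not b ∧ a) ≡ a xor b
    bool = from-yes (∀ᵇ? λ a → ∀ᵇ? λ b → (not a ∧ b) ∨ (not b ∧ a) Bool.≟ a xor b)

  pivot-injective : ∀ {r s} → pivot r ≡ pivot s → r ≡ s
  pivot-injective {r} {s} eq with Fin.<-cmp r s
  ... | tri< r<s _ _ = contradiction eq (Fin.<⇒≢ (pivot-mono r<s))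
  ... | tri≈ _ r≡s _ = r≡s
  ... | tri> _ _ s<r = contradiction (≡.sym eq) (Fin.<⇒≢ (pivot-mono s<r))

  -- The fan at the source is literally the crossing count of its own ray, and the cofan at the sink
  -- vanishes because no secant to the boundary points inwards. The other rays remain and give `σ`
  -- through `left-boundary`.
  simple-parity : ∀ {r j es} → Trail (boundary (pivot r)) (boundary j) es → Unique (vertices (boundary (pivot r)) es) →
    (∀ s → pivot s ≢ j) → turnsʳ es xor rays es ≡ odd (σ r j)
  simple-parity {r} {j} {es} t u ¬pivot = begin
    turnsʳ es xor rays es
      ≡⟨ cong (_xor rays es) (≡.trans (turning-trail t u) (cong (fan b es xor_) outward)) ⟩
    (fan b es xor false) xor rays es
      ≡⟨ cong (_xor rays es) (≡.trans (Bool.xor-identityʳ (fan b es)) (≡.trans (≡.sym own) (⨁-xor (allFin k) (between r j) (λ s → ⨁ es (ray s))))) ⟩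
    (⨁ (allFin k) (between r j) xor rays es) xor rays es
      ≡⟨ S.solve 2 (λ a b → (a S.:+ b) S.:+ b S.:= a) ≡.refl (⨁ (allFin k) (between r j)) (rays es) ⟩
    ⨁ (allFin k) (between r j)
      ≡⟨ odd-count (λ s → ((pivot r Fin.<? pivot s) ×-dec (pivot s Fin.<? j)) ⊎-dec ((j Fin.<? pivot s) ×-dec (pivot s Fin.<? pivot r))) ⟨
    odd (σ r j) ∎
    where
    open ≡.≡-Reasoning
    module S = xor-∧-Solver
    b : Vertex
    b = boundary (pivot r)
    outward : cofan (boundary j) es ≡ false
    outward = ⨁-false (All.universal (λ e → crosses-outward (to-boundary j (source e)) (to-boundary j (target e))) es)
    other : ∀ s → s ≢ r → between r j s xor ⨁ es (ray s) ≡ false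
    other s s≢r = ≡.trans (cong₂ _xor_
      (between-xor r j s (s≢r ∘ pivot-injective) (¬pivot s))
      (≡.trans (ray-sum s t λ { eq → s≢r (pivot-injective (≡.sym (inj₁-injective eq))) })
        (cong₂ _xor_ (left-boundary (pivot s) (pivot r) (s≢r ∘ pivot-injective)) (left-boundary (pivot s) j (¬pivot s)))))
      (Bool.xor-same (does (pivot s Fin.<? pivot r) xor does (pivot s Fin.<? j)))
    own : ⨁ (allFin k) (λ s → between r j s xor ⨁ es (ray s)) ≡ fan b es
    own = ≡.trans (⨁-allFin-single r other) (cong (_xor fan b es) not-between)
      where
      not-between : between r j r ≡ false
      not-between = dec-false (((pivot r Fin.<? pivot r) ×-dec (pivot r Fin.<? j)) ⊎-dec ((j Fin.<? pivot r) ×-dec (pivot r Fin.<? pivot r))) λ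
        { (inj₁ (r<r , _)) → Fin.<-irrefl ≡.refl r<r ; (inj₂ (_ , r<r)) → Fin.<-irrefl ≡.refl r<r }

  parity : List Edge → Bool
  parity es = turns es xor rays es

  rays-cycle : ∀ {v es} → Trail v v es → (∀ r → v ≢ boundary (pivot r)) → rays es ≡ false
  rays-cycle {v} t v≢ = ⨁-false (All.universal (λ r → ≡.trans (ray-sum r t (v≢ r)) (Bool.xor-same (left (boundary (pivot r) ↠ v)))) (allFin k))

  rays-cut : ∀ loop rest e es → rays ((loop ++ rest) ʳ++ e ∷ es) ≡ rays (e ∷ loop) xor rays (rest ʳ++ es)
  rays-cut loop rest e es = ≡.trans (⨁-cong (All.universal each (allFin k)))
    (⨁-xor (allFin k) (λ r → ⨁ (e ∷ loop) (ray r)) (λ r → ⨁ (rest ʳ++ es) (ray r)))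
    where
    module S = xor-∧-Solver
    each : ∀ r → ⨁ ((loop ++ rest) ʳ++ e ∷ es) (ray r) ≡ ⨁ (e ∷ loop) (ray r) xor ⨁ (rest ʳ++ es) (ray r)
    each r = ≡.trans (⨁-ʳ++ (loop ++ rest) (e ∷ es) (ray r)) (≡.trans
      (cong (_xor ⨁ (e ∷ es) (ray r)) (⨁-++ loop rest (ray r)))
      (≡.trans
        (S.solve 4 (λ a b c d → (a S.:+ b) S.:+ (c S.:+ d) S.:= (c S.:+ a) S.:+ (b S.:+ d)) ≡.refl
          (⨁ loop (ray r)) (⨁ rest (ray r)) (ray r e) (⨁ es (ray r)))
        (cong (⨁ (e ∷ loop) (ray r) xor_) (≡.sym (⨁-ʳ++ rest es (ray r))))))

  -- The two passages share an edge, so swapping their continuations only permutes the turns.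
  turn-exchange : ∀ {a b c d} → target a ≡ source b → target a ≡ source c → target d ≡ source b →
    turn a c xor turn d b ≡ turn a b xor turn d c
  turn-exchange {a} {b} {c} {d} ab ac db with passages {a} {b} {c} {d} ab ac db
  ... | inj₁ ≡.refl = Bool.xor-comm (turn a c) (turn a b)
  ... | inj₂ ≡.refl = ≡.refl

  private
    cut-sum : ∀ tab teg teb R B Y {X tag} → teg xor X ≡ true → tag xor teb ≡ tab xor teg →
              ((X xor (tag xor R)) xor (teb xor B)) xor Y ≡ not (((tab xor R) xor B) xor Y)
    cut-sum tab teg teb R B Y {X} {tag} h h′ rewrite solve-for {tag} teb h′ | solve-for {X} teg (≡.trans (Bool.xor-comm X teg) h) =
      S.solve 6 (λ tab teg teb R B Y →
          (((S.con true S.:+ teg) S.:+ (((tab S.:+ teg) S.:+ teb) S.:+ R)) S.:+ (teb S.:+ B)) S.:+ Y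
          S.:= S.con true S.:+ (((tab S.:+ R) S.:+ B) S.:+ Y))
        ≡.refl tab teg teb R B Y
      where module S = xor-∧-Solver

  -- Let `a` be the edge of the first arrival at `v`, `g` and `e` the first and last edge of the
  -- loop, and `b` the edge after it. Erasure replaces the turns from `a` to `g` and from `e` to `b`
  -- by the one from `a` to `b`. By `turn-exchange` the remaining loss is the turn from `e` to `g`,
  -- which completes the odd turning of the cycle.
  cut-parity : ∀ {u v loop rest b es} e → Trail v (source e) loop → Trail u v rest → target e ≡ v → source b ≡ v →
    (∀ r → v ≢ boundary (pivot r)) → u ≢ v → Unique (map target loop ++ vertices u rest) →
    parity ((loop ++ rest) ʳ++ e ∷ b ∷ es) ≡ not (parity (rest ʳ++ b ∷ es))
  -- The walk does not return to its first vertex, so some edge `a` precedes the loop.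
  cut-parity e _ (nil u≡v) _ _ _ u≢v _ = contradiction u≡v u≢v
  cut-parity {loop = []} e (nil v≡se) _ te≡v _ _ _ _ = contradiction (≡.trans (≡.sym v≡se) (≡.sym te≡v)) (no-loops e)
  cut-parity {u} {v} {f ∷ loop} {a ∷ rest} {b} {es} e t₁@(snoc t tf≡se) t₂@(snoc _ ta≡v) ≡.refl sb≡v v≢ u≢v uniq with initLast loop
  -- A loop of two edges would be a digon; `turning-cycle` needs a first edge `g` besides the last
  -- two, `f` and `e`.
  ... | [] with nil v≡sf ← t = contradiction tf≡se (no-digons {e} {f} v≡sf)
  ... | mid ∷ʳ′ g with trail-split mid t
  ...   | w , t₃ , snoc (nil v≡sg) ≡.refl = begin
    turns (((f ∷ mid ++ g ∷ []) ++ a ∷ rest) ʳ++ e ∷ b ∷ es) xor rays (((f ∷ mid ++ g ∷ []) ++ a ∷ rest) ʳ++ e ∷ b ∷ es)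
      ≡⟨ cong₂ _xor_ whole-turns (≡.trans (rays-cut (f ∷ mid ++ g ∷ []) (a ∷ rest) e (b ∷ es))
           (cong (_xor rays ((a ∷ rest) ʳ++ b ∷ es)) (rays-cycle (snoc t₁ ≡.refl) v≢))) ⟩
    ((turnsʳ (e ∷ f ∷ mid ++ g ∷ []) xor (turn a g xor turnsʳ (a ∷ rest))) xor (turn e b xor turns (b ∷ es))) xor rays ((a ∷ rest) ʳ++ b ∷ es)
      ≡⟨ cut-sum (turn a b) (turn e g) (turn e b) (turnsʳ (a ∷ rest)) (turns (b ∷ es)) (rays ((a ∷ rest) ʳ++ b ∷ es)) {tag = turn a g}
           (turning-cycle (≡.sym v≡sg) tf≡se t₃ (≡.subst (λ x → Unique (map target (f ∷ mid ++ g ∷ []) ++ x ∷ [])) ta≡v (unique-prefix (map target (f ∷ mid ++ g ∷ [])) uniq)))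
           (turn-exchange {a} {b} {g} {e} (≡.trans ta≡v (≡.sym sb≡v)) (≡.trans ta≡v v≡sg) (≡.sym sb≡v)) ⟩
    not (((turn a b xor turnsʳ (a ∷ rest)) xor turns (b ∷ es)) xor rays ((a ∷ rest) ʳ++ b ∷ es))
      ≡⟨ cong (λ x → not (x xor rays ((a ∷ rest) ʳ++ b ∷ es))) (turns-ʳ++ (a ∷ rest) b es) ⟨
    not (parity ((a ∷ rest) ʳ++ b ∷ es)) ∎
    where
    open ≡.≡-Reasoning
    whole-turns : turns (((f ∷ mid ++ g ∷ []) ++ a ∷ rest) ʳ++ e ∷ b ∷ es) ≡
      (turnsʳ (e ∷ f ∷ mid ++ g ∷ []) xor (turn a g xor turnsʳ (a ∷ rest))) xor (turn e b xor turns (b ∷ es))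
    whole-turns = ≡.trans (turns-ʳ++ ((f ∷ mid ++ g ∷ []) ++ a ∷ rest) e (b ∷ es)) (cong (_xor (turn e b xor turns (b ∷ es)))
      (≡.trans (cong (λ x → turnsʳ (e ∷ f ∷ x)) (List.++-assoc mid (g ∷ []) (a ∷ rest))) (turnsʳ-++ (e ∷ f ∷ mid) g a rest)))

  trail-start : ∀ {u v e es} → Trail u v (e ∷ es) → ∃[ f ] source f ≡ u
  trail-start {e = e} (snoc (nil u≡se) _)    = e , ≡.sym u≡se
  trail-start         (snoc t@(snoc _ _) _) = trail-start t

  erase-loop : ∀ {u v j} e es loop {rest} → Trail v (source e) loop → Trail u v rest → target e ≡ v → u ≢ v →
    Path v es (boundary j) → Unique (vertices u (loop ++ rest)) →
    parity ((loop ++ rest) ʳ++ e ∷ es) ≡ not (parity (rest ʳ++ es))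
  erase-loop e es [] (nil v≡se) _ te≡v _ _ _ = contradiction (≡.trans (≡.sym v≡se) (≡.sym te≡v)) (no-loops e)
  -- If the walk ended here, `v` would be a boundary vertex that the loop leaves again.
  erase-loop e [] (f ∷ loop) t₁ _ te≡v _ [] _ = contradiction (proj₂ (trail-start t₁)) (boundary-impassable te≡v)
  erase-loop {u} e (b ∷ es) loop@(_ ∷ _) {rest} t₁ t₂ te≡v u≢v (b ∷ _) uniq = cut-parity e t₁ t₂ te≡v ≡.refl
    (λ r v≡ → target≢pivot e (≡.trans te≡v v≡)) u≢v (≡.subst Unique (vertices-++ loop rest) uniq)

  -- Follows the recursion of `erasedLoops` with a trail that stays simple: a new vertex extends the
  -- trail, a repeated one costs one parity change by `erase-loop`, and at the end `simple-parity`
  -- applies.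
  walk-parity : ∀ {r j} es {v trail} → (∀ s → pivot s ≢ j) → Trail (boundary (pivot r)) v trail →
    Unique (vertices (boundary (pivot r)) trail) → Path v es (boundary j) →
    parity (trail ʳ++ es) ≡ odd (erasedLoops (vertices (boundary (pivot r)) trail) (map target es)) xor odd (σ r j)
  walk-parity [] {trail = trail} ¬pivot t uniq [] = ≡.trans
    (cong₂ _xor_ (turns-reverse trail) (⨁-cong (All.universal (λ r → ≡.trans (⨁-ʳ++ trail [] (ray r)) (Bool.xor-identityʳ (⨁ trail (ray r)))) (allFin k))))
    (simple-parity t uniq ¬pivot)
  walk-parity {r} {j} (e ∷ es) {trail = trail} ¬pivot t uniq (e ∷ p) with target e ∈? vertices (boundary (pivot r)) trail
  ... | no te∉ = walk-parity es ¬pivot (snoc t ≡.refl) (All.¬Any⇒All¬ _ te∉ ∷ uniq) p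
  ... | yes te∈ with cut t te∈
  ...   | loop , rest , ≡.refl , t₁ , t₂ , dropped = begin
    parity ((loop ++ rest) ʳ++ e ∷ es)
      ≡⟨ erase-loop e es loop t₁ t₂ ≡.refl (target≢pivot e ∘ ≡.sym) p uniq ⟩
    not (parity (rest ʳ++ es))
      ≡⟨ cong not (walk-parity es ¬pivot t₂ (unique-suffix (map target loop) (≡.subst Unique (vertices-++ loop rest) uniq)) p) ⟩
    not (odd (erasedLoops (vertices (boundary (pivot r)) rest) (map target es)) xor odd (σ r j))
      ≡⟨ Bool.not-distribˡ-xor (odd (erasedLoops (vertices (boundary (pivot r)) rest) (map target es))) (odd (σ r j)) ⟩
    not (odd (erasedLoops (vertices (boundary (pivot r)) rest) (map target es))) xor odd (σ r j)
      ≡⟨ cong (λ vs → not (odd (erasedLoops vs (map target es))) xor odd (σ r j)) dropped ⟨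
    not (odd (erasedLoops (dropWhile (λ x → ¬? (x ≟ᵛ target e)) (vertices (boundary (pivot r)) (loop ++ rest))) (map target es))) xor odd (σ r j) ∎
    where open ≡.≡-Reasoning

-- Scaling of formal sums

module FormalSeriesProperties {c ℓ₁ ℓ₂} (K : OrderedField c ℓ₁ ℓ₂) where
  open OrderedField K
  open import Relation.Binary.Reasoning.Setoid setoid

  module _ {q : ℕ} (w : Fin q → Carrier) where
    open FormalSeries K q

    SumsTo-value : ∀ {f x y} → x ≈ y → SumsTo w f x → SumsTo w f y
    SumsTo-value x≈y S = record
      { num = num ; den = den ; expansion = expansion ; den-nonzero = den-nonzero ; value = trans (*-congʳ (sym x≈y)) value }
      where open SumsTo S

    private
      scale : Carrier → Polynomial → Polynomial
      scale κ = map (λ (c , β) → κ * c , β)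

      coeff-scale : ∀ κ p α → coeff (scale κ p) α ≈ κ * coeff p α
      coeff-scale κ []            α = sym (zeroʳ κ)
      coeff-scale κ ((c , β) ∷ p) α with does (β ≟ᵉ α)
      ... | true  = trans (+-congˡ (coeff-scale κ p α)) (sym (distribˡ κ c _))
      ... | false = trans (+-cong (sym (zeroʳ κ)) (coeff-scale κ p α)) (sym (distribˡ κ 0# _))

      eval-scale : ∀ κ p → eval w (scale κ p) ≈ κ * eval w p
      eval-scale κ []            = sym (zeroʳ κ)
      eval-scale κ ((c , β) ∷ p) = trans (+-cong (*-assoc κ c _) (eval-scale κ p)) (sym (distribˡ κ _ _))

      ⊛-scale : ∀ κ p {f g : Series} → (∀ α → g α ≈ κ * f α) → ∀ α → (p ⊛ g) α ≈ κ * (p ⊛ f) α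
      ⊛-scale κ []            h α = sym (zeroʳ κ)
      ⊛-scale κ ((c , β) ∷ p) {f} {g} h α with does (β ≤ᵉ? α)
      ... | false = trans (+-cong (sym (zeroʳ κ)) (⊛-scale κ p h α)) (sym (distribˡ κ 0# _))
      ... | true  = trans (+-cong (begin
        c * g (α ⊟ β)         ≈⟨ *-congˡ (h (α ⊟ β)) ⟩
        c * (κ * f (α ⊟ β))   ≈⟨ *-assoc c κ _ ⟨
        c * κ * f (α ⊟ β)     ≈⟨ *-congʳ (*-comm c κ) ⟩
        κ * c * f (α ⊟ β)     ≈⟨ *-assoc κ c _ ⟩
        κ * (c * f (α ⊟ β))   ∎) (⊛-scale κ p h α)) (sym (distribˡ κ _ _))

    SumsTo-scale : ∀ κ {f g x} → (∀ α → g α ≈ κ * f α) → SumsTo w f x → SumsTo w g (κ * x)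
    SumsTo-scale κ h S = record
      { num         = scale κ num
      ; den         = den
      ; expansion   = λ α → trans (⊛-scale κ den h α) (trans (*-congˡ (expansion α)) (sym (coeff-scale κ num α)))
      ; den-nonzero = den-nonzero
      ; value       = trans (*-assoc κ _ _) (trans (*-congˡ value) (sym (eval-scale κ num)))
      }
      where open SumsTo S

    SumsTo-zero : ∀ {f} → (∀ α → f α ≈ 0#) → SumsTo w f 0#
    SumsTo-zero {f} f≈0 = record
      { num         = []
      ; den         = (1# , Vec.replicate q 0) ∷ []
      ; expansion   = λ α → trans (+-identityʳ _) (first (does (Vec.replicate q 0 ≤ᵉ? α)) (f≈0 _))
      ; den-nonzero = λ h → 1≉0 (trans (sym (trans (+-identityʳ _) (trans (*-identityˡ _) one))) h)
      ; value       = zeroˡ _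
      }
      where
      first : ∀ b {x} → x ≈ 0# → (if b then 1# * x else 0#) ≈ 0#
      first true  x≈0 = trans (*-identityˡ _) x≈0
      first false x≈0 = ≈-refl
      one : monomial w (Vec.replicate q 0) ≈ 1#
      one = trans (product-cong (λ e → reflexive (cong (w e ^_) (Vec.lookup-replicate e 0)))) (MonoidSum.sum-replicate-zero *-commutativeMonoid q)

module SignedSums {c ℓ₁ ℓ₂} (K : OrderedField c ℓ₁ ℓ₂) {k n : ℕ} (N : Networks.PlabicNetwork K k n) where
  open OrderedField K
  open Networks K using (signedSum; module PlabicNetwork)
  open PlabicNetwork N
  open import Relation.Binary.Reasoning.Setoid setoid
  open RingProperties ring using (-1*x≈-x; -‿involutive)

  sign : Bool → Carrier
  sign b = if b then - 1# else 1#

  power-sign : ∀ m → (- 1#) ^ m ≈ sign (odd m)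
  power-sign zero    = ≈-refl
  power-sign (suc m) = trans (*-congˡ (power-sign m)) (step (odd m))
    where
    step : ∀ b → - 1# * sign b ≈ sign (not b)
    step true  = trans (-1*x≈-x (- 1#)) (-‿involutive 1#)
    step false = *-identityʳ (- 1#)

  power-odd : ∀ m a b → odd m ≡ odd a xor odd b → (- 1#) ^ m ≈ (- 1#) ^ a * (- 1#) ^ b
  power-odd m a b h = begin
    (- 1#) ^ m                ≈⟨ power-sign m ⟩
    sign (odd m)              ≡⟨ cong sign (≡.trans h (≡.sym (odd-+ a b))) ⟩
    sign (odd (a ℕ.+ b))      ≈⟨ power-sign (a ℕ.+ b) ⟨
    (- 1#) ^ (a ℕ.+ b)        ≈⟨ ^-homo-* (- 1#) a b ⟩
    (- 1#) ^ a * (- 1#) ^ b   ∎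

  private
    module _ {ℓ ℓ′} {Q : Pred (List Edge) ℓ} {Q′ : Pred (List Edge) ℓ′} (Q? : Decidable Q) (Q′? : Decidable Q′)
             (κ : Carrier) {f f′ : List Edge → Carrier}
             (to : ∀ P → Q P → Q′ P) (from : ∀ P → Q′ P → Q P) (scaled : ∀ P → Q P → f P ≈ κ * f′ P) where
      filtered-sum : ∀ Ps → foldr _+_ 0# (map f (filter Q? Ps)) ≈ κ * foldr _+_ 0# (map f′ (filter Q′? Ps))
      filtered-sum []       = sym (zeroʳ κ)
      filtered-sum (P ∷ Ps) with Q? P | Q′? P
      ... | yes q | yes _  = trans (+-cong (scaled P q) (filtered-sum Ps)) (sym (distribˡ κ _ _))
      ... | no _  | no _   = filtered-sum Ps
      ... | yes q | no ¬q′ = contradiction (to P q) ¬q′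
      ... | no ¬q | yes q′ = contradiction (from P q′) ¬q

  -- Each coefficient is a finite sum over words, so a relation between the signs of single paths
  -- passes to the series. The factor 0 covers empty sums.
  signedSum-scale : ∀ {ℓ ℓ′} {Q : Pred (List Edge) ℓ} {Q′ : Pred (List Edge) ℓ′} (Q? : Decidable Q) (Q′? : Decidable Q′)
    {sgn sgn′ : List Edge → ℕ} κ → (∀ P → Q P → Q′ P) → (∀ P → Q′ P → Q P) →
    (∀ P → Q P → (- 1#) ^ sgn P ≈ κ * (- 1#) ^ sgn′ P) →
    ∀ α → signedSum N Q? sgn α ≈ κ * signedSum N Q′? sgn′ α
  signedSum-scale Q? Q′? κ to from scaled α = filtered-sum _ _ κ
    (λ P (q , m) → to P q , m) (λ P (q′ , m) → from P q′ , m) (λ P (q , _) → scaled P q) (edgeWords (Vec.sum α))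

  signedSum-empty : ∀ {ℓ} {Q : Pred (List Edge) ℓ} (Q? : Decidable Q) {sgn} → (∀ P → ¬ Q P) → ∀ α → signedSum N Q? sgn α ≈ 0#
  signedSum-empty Q? {sgn} empty α = trans
    (signedSum-scale Q? Q? {sgn} {sgn} 0# (λ _ q → q) (λ _ q → q) (λ P q → contradiction q (empty P)) α) (zeroˡ _)

-- Uniqueness of the echelon form

module MatrixProperties {c ℓ₁ ℓ₂} (K : OrderedField c ℓ₁ ℓ₂) where
  open OrderedField K
  open Networks K using (Matrix; identity; _≋ᴹ_; _·_; RowEquivalent)
  open SemiringSum semiring using (sum-cong-≋; ∑-comm; *-distribˡ-sum; *-distribʳ-sum; sum-replicate-zero)
  open import Relation.Binary.Reasoning.Setoid setoid

  ·-congˡ : ∀ {k m n} (A : Matrix k m) {B B′ : Matrix m n} → B ≋ᴹ B′ → (A · B) ≋ᴹ (A · B′)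
  ·-congˡ A q r j = sum-cong-≋ (λ i → *-congˡ (q i j))

  ·-congʳ : ∀ {k m n} {A A′ : Matrix k m} (B : Matrix m n) → A ≋ᴹ A′ → (A · B) ≋ᴹ (A′ · B)
  ·-congʳ B p r j = sum-cong-≋ (λ i → *-congʳ (p r i))

  ·-assoc : ∀ {k l m n} (A : Matrix k l) (B : Matrix l m) (C : Matrix m n) → ((A · B) · C) ≋ᴹ (A · (B · C))
  ·-assoc A B C r j = begin
    sum (λ i → sum (λ h → A r h * B h i) * C i j)     ≈⟨ sum-cong-≋ (λ i → *-distribʳ-sum (C i j) (λ h → A r h * B h i)) ⟩
    sum (λ i → sum (λ h → A r h * B h i * C i j))     ≈⟨ ∑-comm (λ i h → A r h * B h i * C i j) ⟩
    sum (λ h → sum (λ i → A r h * B h i * C i j))     ≈⟨ sum-cong-≋ (λ h → sum-cong-≋ (λ i → *-assoc (A r h) (B h i) (C i j))) ⟩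
    sum (λ h → sum (λ i → A r h * (B h i * C i j)))   ≈⟨ sum-cong-≋ (λ h → *-distribˡ-sum (A r h) (λ i → B h i * C i j)) ⟨
    sum (λ h → A r h * sum (λ i → B h i * C i j))     ∎

  sum-single : ∀ {m} (i : Fin m) (x : Fin m → Carrier) → (∀ j → j ≢ i → x j ≈ 0#) → sum x ≈ x i
  sum-single {suc m} Fin.zero    x off = trans (+-congˡ (trans (sum-cong-≋ (λ j → off (Fin.suc j) λ ())) (sum-replicate-zero m))) (+-identityʳ _)
  sum-single {suc m} (Fin.suc i) x off = trans
    (+-cong (off Fin.zero λ ()) (sum-single i (x ∘ Fin.suc) λ j j≢i → off (Fin.suc j) (j≢i ∘ Fin.suc-injective))) (+-identityˡ _)

  identity-diagonal : ∀ {m} (i : Fin m) → identity i i ≡ 1#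
  identity-diagonal i = cong (if_then 1# else 0#) (dec-true (i Fin.≟ i) ≡.refl)

  identity-off-diagonal : ∀ {m} {i j : Fin m} → i ≢ j → identity i j ≡ 0#
  identity-off-diagonal {i = i} {j} i≢j = cong (if_then 1# else 0#) (dec-false (i Fin.≟ j) i≢j)

  ·-identityˡ : ∀ {m n} (A : Matrix m n) → (identity · A) ≋ᴹ A
  ·-identityˡ A r j = trans
    (sum-single r _ (λ i i≢r → trans (*-congʳ (reflexive (identity-off-diagonal (i≢r ∘ ≡.sym)))) (zeroˡ _)))
    (trans (*-congʳ (reflexive (identity-diagonal r))) (*-identityˡ _))

  ·-identityʳ : ∀ {m n} (A : Matrix m n) → (A · identity) ≋ᴹ A
  ·-identityʳ A r j = trans
    (sum-single j _ (λ i i≢j → trans (*-congˡ (reflexive (identity-off-diagonal i≢j))) (zeroʳ _)))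
    (trans (*-congˡ (reflexive (identity-diagonal j))) (*-identityʳ _))

  -- Both forms are images of A, hence related by an invertible M; comparing the pivot columns gives M = 1.
  echelon-unique : ∀ {k n} {A R R′ : Matrix k n} (p : Fin k → Fin n) → RowEquivalent A R → RowEquivalent A R′ →
    (∀ r t → R r (p t) ≈ identity r t) → (∀ r t → R′ r (p t) ≈ identity r t) → R ≋ᴹ R′
  echelon-unique {A = A} {R} {R′} p (g , h , gh≈1 , hg≈1 , R≈gA) (g′ , h′ , _ , _ , R′≈g′A) R-pivots R′-pivots r j = begin
    R r j                     ≈⟨ ·-identityˡ R r j ⟨
    (identity · R) r j        ≈⟨ ·-congʳ R M≈1 r j ⟨
    ((g′ · h) · R) r j        ≈⟨ R′≈MR r j ⟨
    R′ r j                    ∎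
    where
    A≈hR : A ≋ᴹ (h · R)
    A≈hR i j = sym (begin
      (h · R) i j             ≈⟨ ·-congˡ h R≈gA i j ⟩
      (h · (g · A)) i j       ≈⟨ ·-assoc h g A i j ⟨
      ((h · g) · A) i j       ≈⟨ ·-congʳ A hg≈1 i j ⟩
      (identity · A) i j      ≈⟨ ·-identityˡ A i j ⟩
      A i j                   ∎)
    R′≈MR : R′ ≋ᴹ ((g′ · h) · R)
    R′≈MR r j = begin
      R′ r j                  ≈⟨ R′≈g′A r j ⟩
      (g′ · A) r j            ≈⟨ ·-congˡ g′ A≈hR r j ⟩
      (g′ · (h · R)) r j      ≈⟨ ·-assoc g′ h R r j ⟨
      ((g′ · h) · R) r j      ∎
    M≈1 : (g′ · h) ≋ᴹ identity
    M≈1 r t = begin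
      (g′ · h) r t                            ≈⟨ ·-identityʳ (g′ · h) r t ⟨
      ((g′ · h) · identity) r t               ≈⟨ sum-cong-≋ (λ s → *-congˡ (R-pivots s t)) ⟨
      ((g′ · h) · R) r (p t)                  ≈⟨ R′≈MR r (p t) ⟨
      R′ r (p t)                              ≈⟨ R′-pivots r t ⟩
      identity r t                            ∎

-- From signs of paths to edge vectors

module LinkedPaths {k n} (G : PlabicGraph k n) where
  open PlabicGraph G
  open Paths G

  linked-path : ∀ {e es j} → IsPath (e ∷ es) → EndsAt j (e ∷ es) → Path (source e) (e ∷ es) (boundary j)
  linked-path {e} [-] ends = e ∷ ≡.subst (λ v → Path v [] _) (≡.sym (just-injective ends)) []
  linked-path {e} {f ∷ es} (te≡sf ∷ linked) ends = e ∷ ≡.subst (λ v → Path v (f ∷ es) _) (≡.sym te≡sf) (linked-path linked ends)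

  path-last : ∀ es {j} → EndsAt j es → ∃[ e ] target e ≡ boundary j
  path-last (e ∷ [])     ends = e , just-injective ends
  path-last (e ∷ f ∷ es) ends = path-last (f ∷ es) ends

open import Data.Nat using (_<_; _+_)

module EdgeVectors {c ℓ₁ ℓ₂} (K : OrderedField c ℓ₁ ℓ₂) {k n : ℕ} (N : Networks.PlabicNetwork K k n) where
  open OrderedField K hiding (_<_; _+_)
  open Networks K using (IsEdgeVector; Represents; EchelonForm; Matrix; GaugeDirection; row-minus-basis; identity; cr; par; windPath; intPath; module PlabicNetwork)
  open PlabicNetwork N
  open GraphProperties graph
  open Paths graph
  open LinkedPaths graph
  open FormalSeries K using (SumsTo-unique)
  open FormalSeriesProperties K
  open SignedSums K N
  open MatrixProperties K
  open Trails graph using (nil)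
  open import Algebra.Properties.Ring ring using (-0#≈0#)

  signExponent : GaugeDirection N → List Edge → ℕ
  signExponent 𝔩 P = ∣ windPath N 𝔩 P ℤ.+ + intPath N 𝔩 P ∣

  -- The exponent depends only on the first edge of a path, so the sign factors out of the series.
  gauge-change : ∀ 𝔩 𝔩′ {e x} → (∀ r → source e ≢ boundary (pivot r)) → IsEdgeVector N 𝔩 e x →
    IsEdgeVector N 𝔩′ e (λ j → (- 1#) ^ (cr N 𝔩 𝔩′ (source e) + par N 𝔩 𝔩′ e) * x j)
  gauge-change 𝔩 𝔩′ {e} ¬pivot E j = SumsTo-scale weight _
    (signedSum-scale (pathFromEdge? e j) (pathFromEdge? e j) {signExponent 𝔩′} {signExponent 𝔩} _ (λ _ q → q) (λ _ q → q) signs) (E j)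
    where
    κ : ℕ
    κ = cr N 𝔩 𝔩′ (source e) + par N 𝔩 𝔩′ e
    signs : ∀ P → PathFromEdge e j P → (- 1#) ^ signExponent 𝔩′ P ≈ (- 1#) ^ κ * (- 1#) ^ signExponent 𝔩 P
    signs (e ∷ es) (linked , ≡.refl , ends) = power-odd (signExponent 𝔩′ (e ∷ es)) κ (signExponent 𝔩 (e ∷ es))
      (solve-for (odd (signExponent 𝔩 (e ∷ es))) (≡.trans
        (≡.trans (Bool.xor-comm (odd (signExponent 𝔩′ (e ∷ es))) _)
          (cong₂ _xor_ (GaugeParity.odd-sign K N 𝔩 (e ∷ es)) (GaugeParity.odd-sign K N 𝔩′ (e ∷ es))))
        (GaugeChange.sign-change K N 𝔩 𝔩′ (linked-path linked ends) ¬pivot)))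

  module _ {A R} (represents : Represents N A) (echelon : EchelonForm N A R) (𝔩 : GaugeDirection N) where
    private
      -- `Represents` supplies some echelon form with the path sums as entries; uniqueness
      -- identifies it with the given `R`.
      R′ : Matrix k n
      R′ = proj₁ represents

      R′≈R : ∀ r j → R′ r j ≈ R r j
      R′≈R = echelon-unique pivot (proj₁ (proj₁ (proj₂ represents))) (proj₁ echelon)
        (proj₂ (proj₁ (proj₂ represents))) (proj₂ echelon)

      pivot-injective : ∀ {r s} → pivot r ≡ pivot s → r ≡ s
      pivot-injective {r} {s} = LoopErasure.pivot-injective K N 𝔩 {r} {s}

    boundary-edge-vector : ∀ r {e} → source e ≡ boundary (pivot r) → IsEdgeVector N 𝔩 e (row-minus-basis N R r)
    boundary-edge-vector r {e} se≡b j with Fin.any? (λ s → pivot s Fin.≟ j)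
    -- No path ends at a boundary source, so the series vanishes. The entry vanishes too: the pivot
    -- columns of `R` form the identity, and subtracting the basis vector removes the diagonal 1.
    ... | yes (s , ≡.refl) = SumsTo-value weight (sym difference≈0) (SumsTo-zero weight
        (signedSum-empty (pathFromEdge? e (pivot s)) {signExponent 𝔩} λ P (_ , _ , ends) →
          let (f , tf≡) = path-last P ends in target≢pivot f tf≡))
      where
      same : identity (pivot r) (pivot s) ≈ identity r s
      same with r Fin.≟ s
      ... | yes ≡.refl = reflexive (identity-diagonal (pivot r))
      ... | no r≢s     = reflexive (identity-off-diagonal (r≢s ∘ pivot-injective))
      difference≈0 : row-minus-basis N R r (pivot s) ≈ 0#
      difference≈0 = trans (+-cong (proj₂ echelon r s) (-‿cong same)) (-‿inverseʳ _)
    ... | no ¬pivot = SumsTo-value weight value (SumsTo-scale weight ((- 1#) ^ σ r j)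
        (signedSum-scale (pathFromEdge? e j) (pathFromBoundary? (pivot r) j) {signExponent 𝔩} {windTop} ((- 1#) ^ σ r j) to from signs)
        (proj₁ (proj₂ entry)))
      where
      off : ∀ s → pivot s ≢ j
      off s ps≡j = ¬pivot (s , ps≡j)
      entry = proj₂ (proj₂ represents) r j off
      value : (- 1#) ^ σ r j * proj₁ entry ≈ row-minus-basis N R r j
      value = trans (sym (proj₂ (proj₂ entry))) (trans (R′≈R r j) (sym (trans
        (+-congˡ (trans (-‿cong (reflexive (identity-off-diagonal (off r)))) -0#≈0#)) (+-identityʳ _))))
      to : ∀ P → PathFromEdge e j P → PathFromBoundary (pivot r) j P
      to (e ∷ es) (linked , ≡.refl , ends) = linked , cong just se≡b , ends
      from : ∀ P → PathFromBoundary (pivot r) j P → PathFromEdge e j P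
      -- A boundary source has a single edge, so a path leaving the vertex begins with `e`.
      from (f ∷ es) (linked , start , ends) = linked , cong just (boundary-source-unique (just-injective start) se≡b) , ends
      signs : ∀ P → PathFromEdge e j P → (- 1#) ^ signExponent 𝔩 P ≈ (- 1#) ^ σ r j * (- 1#) ^ windTop P
      signs (e ∷ es) (linked , ≡.refl , ends) = power-odd (signExponent 𝔩 (e ∷ es)) (σ r j) (windTop (e ∷ es)) (≡.trans
        (GaugeParity.odd-sign K N 𝔩 (e ∷ es)) (≡.trans
        (LoopErasure.walk-parity K N 𝔩 (e ∷ es) off (nil ≡.refl) ([] ∷ []) (≡.subst (λ v → Path v (e ∷ es) (boundary j)) se≡b (linked-path linked ends)))
        (≡.trans (Bool.xor-comm _ (odd (σ r j))) (cong (λ v → odd (σ r j) xor odd (erasedLoops (v ∷ []) (List.map target (e ∷ es)))) (≡.sym se≡b)))))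

proposition5p1 : ∀ {c ℓ₁ ℓ₂} (K : OrderedField c ℓ₁ ℓ₂) →
    let open Networks K in
    ∀ {k n : ℕ} → 0 < k → k < n →
    (N : PlabicNetwork k n) (A R : Matrix k n) →
    Represents N A → EchelonForm N A R →
    (𝔩 𝔩′ : GaugeDirection N) →
    let open PlabicNetwork N in
    (∀ (r : Fin k) (e : Edge) → source e ≡ boundary (pivot r) →
    (∀ x x′ → IsEdgeVector N 𝔩 e x → IsEdgeVector N 𝔩′ e x′ → ∀ j → x j ≈ x′ j) ×
    IsEdgeVector N 𝔩 e (row-minus-basis N R r)) ×
    (∀ (e : Edge) → (∀ r → source e ≢ boundary (pivot r)) →
    ∀ x → IsEdgeVector N 𝔩 e x →
    IsEdgeVector N 𝔩′ e (λ j → (- 1#) ^ (cr N 𝔩 𝔩′ (source e) + par N 𝔩 𝔩′ e) * x j))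
proposition5p1 K _ _ N A R represents echelon 𝔩 𝔩′ =
  (λ r e se≡b →
    -- The row does not mention the gauge direction, so identifying both edge vectors with it gives
    -- the independence.
    (λ x x′ E E′ j → trans
      (SumsTo-unique (E j) (boundary-edge-vector represents echelon 𝔩 r se≡b j))
      (SumsTo-unique (boundary-edge-vector represents echelon 𝔩′ r se≡b j) (E′ j))) ,
    boundary-edge-vector represents echelon 𝔩 r se≡b) ,
  λ e ¬pivot x → gauge-change 𝔩 𝔩′ ¬pivot
  where
  open OrderedField K using (trans)
  open FormalSeries K _ using (SumsTo-unique)
  open EdgeVectors K N
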